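{- Let $\epsilon>0$. There is a constant $Q=Q(\epsilon)$ such that for every prime power $q>Q$, every divisor $d$ of $q-1$ with $2\le d\le q^{1/10-\epsilon}$, and every $\lambda\in\mathbb{F}_q^*$, there are no sets $A,B,C\subset\mathbb{F}_q^*$ with $|A|,|B|,|C|\ge 2$ such that $ABC=(S_d(\mathbb{F}_q)-\lambda)\setminus\{0\}$.
   Context: $S_d(\mathbb{F}_q)=\{x^d:x\in\mathbb{F}_q^*\}$, $S_d(\mathbb{F}_q)-\lambda=\{s-\lambda:s\in S_d(\mathbb{F}_q)\}$, and $ABC=\{abc:a\in A,b\in B,c\in C\}$. -}

module Defs where

open import Level using (0ℓ)
open import Data.Nat using (ℕ; zero; suc)
open import Data.Fin using (Fin)
open import Data.Bool using (Bool; true)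
open import Data.Product using (Σ; ∃; _×_; _,_)
open import Relation.Binary.PropositionalEquality using (_≡_; _≢_)
open import Algebra.Structures using (IsCommutativeRing)
open import Function.Bundles using (_↔_; _⇔_)

record FiniteField : Set₁ where
  infixl 7 _*_
  infixl 6 _+_ _-_
  field
    Carrier : Set
    _+_ _*_ : Carrier → Carrier → Carrier
    -_      : Carrier → Carrier
    0# 1#   : Carrier
    isCommutativeRing : IsCommutativeRing _≡_ _+_ _*_ -_ 0# 1#
    1≢0     : 1# ≢ 0#
    inverse : ∀ x → x ≢ 0# → ∃ λ y → x * y ≡ 1#
    order   : ℕ
    enum    : Carrier ↔ Fin order

  _-_ : Carrier → Carrier → Carrier
  x - y = x + (- y)

  _^_ : Carrier → ℕ → Carrier
  x ^ zero  = 1#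
  x ^ suc n = x * (x ^ n)

  InShiftedPowersNonzero : ℕ → Carrier → Carrier → Set
  InShiftedPowersNonzero d λ' y =
    (y ≢ 0#) × (∃ λ x → (x ≢ 0#) × (y ≡ (x ^ d) - λ'))

  Subset : Set
  Subset = Carrier → Bool

  _∈_ : Carrier → Subset → Set
  x ∈ A = A x ≡ true

  ⊆Units : Subset → Set
  ⊆Units A = ∀ x → x ∈ A → x ≢ 0#

  AtLeastTwo : Subset → Set
  AtLeastTwo A = ∃ λ x → ∃ λ y → (x ≢ y) × (x ∈ A) × (y ∈ A)

  TripleProductEquals : Subset → Subset → Subset → (Carrier → Set) → Set
  TripleProductEquals A B C T =
    ∀ y → T y ⇔ (∃ λ a → ∃ λ b → ∃ λ c →
                   (a ∈ A) × (b ∈ B) × (c ∈ C) × (y ≡ a * b * c))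

-- Let S be the shifted subgroup without 0, n = (q - 1) / d, and suppose S = A B C.  If D is a set with
-- c x ∈ S for all x ∈ D and all c in a set C, then c x + lam is a d-th power for every c ∈ C, and |D| is small:
--   * for two multipliers, |D| ≤ q / d² + √q + 1 by a variance over all lines of the plane;
--   * for k multipliers and a prime r ∣ d, |D| ≤ q / r ^ k + O(k d √q).  By orthogonality this follows from
--     Stepanov's bound n + O(m √q) for the number of solutions of f(x) ^ n = ω, where f has degree m and a
--     simple zero at 0.  Stepanov's auxiliary polynomial is a combination of x ^ u (x ^ q) ^ i f ^ (n j) with u < n
--     and j < d; these have pairwise distinct orders at 0, which makes them linearly independent.
-- As S = C D forces |D| ≥ |S| / |C|, the set C must have more than log₂ q elements, and then |A B| is
-- O(d √q log q).  By symmetry so are |A C| and |B C|, which for d ≤ q ^ (1/10 - ε) contradicts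
-- |A B C|² ≤ |A B| |A C| |B C|.
module Submission where

open import Defs
open import Level using (0ℓ; _⊔_)
open import Algebra.Bundles using (CommutativeRing)
open import Data.Bool using (true)
import Data.Bool as Bool
open import Data.Nat as ℕ using (ℕ; zero; suc; _+_; _*_; _^_; _∸_; _≤_; _<_; z≤n; s≤s; _/_; _%_; NonZero)
import Data.Nat.Properties as ℕ
import Data.Nat.DivMod as DM
open import Data.Nat.Coprimality using (coprime-Bézout; prime⇒coprime)
open import Data.Nat.Divisibility using (_∣_; divides; ∣⇒≤)
open import Data.Nat.GCD using (module Bézout)
open import Data.Nat.Primality using (Prime; prime[2]; prime⇒nonZero; prime⇒nonTrivial)
open import Data.Nat.Primality.Factorisation using (factorise)
open import Data.Nat.Tactic.RingSolver using (solve-∀)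
open import Data.Fin as Fin using (Fin; zero; suc; toℕ)
import Data.Fin.Properties as Finₚ
import Data.Fin.Permutation as Perm
open import Data.List using (List; []; _∷_; length; map; allFin; tabulate; filter; take)
import Data.List.Properties as Listₚ
open import Data.List.Membership.Propositional using (_∈_)
open import Data.List.Membership.Propositional.Properties using (∈-filter⁺; ∈-map⁺; ∈-allFin)
open import Data.List.Relation.Unary.All as All using (All; []; _∷_)
import Data.List.Relation.Unary.All.Properties as Allₚ
open import Data.List.Relation.Unary.AllPairs using (AllPairs; []; _∷_)
import Data.List.Relation.Unary.AllPairs.Properties as AllPairsₚ
open import Data.List.Relation.Unary.Any as Any using (Any; here; there)
open import Data.Empty using (⊥; ⊥-elim)
open import Data.Product using (Σ; ∃; _×_; _,_; proj₁; proj₂)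
open import Data.Sum as Sum using (_⊎_; inj₁; inj₂)
open import Data.Vec.Functional using (removeAt)
open import Function using (_∘_; Inverse; Equivalence)
open import Relation.Binary using (tri<; tri≈; tri>)
open import Relation.Binary.PropositionalEquality using (_≡_; _≢_; refl; sym; trans; cong; cong₂; subst; subst₂; module ≡-Reasoning)
import Relation.Binary.Reasoning.Setoid as SetoidReasoning
open import Relation.Nullary using (¬_; Dec; yes; no; _×-dec_; ¬?)
open import Relation.Unary using (Pred; Decidable)

-- Write k = |C|. Since |S| is about q / d, S cannot be covered by k multiples of D once k |D| falls
-- short of q / d. The variance bound does this for 2 ≤ k < d. For k ≥ d the bound q / r ^ k does it
-- as soon as r ^ k exceeds d k by a fixed factor. That fails only for d = k = 2 and d = k = 4,
-- where main terms agree and a finer condition on a multiplier is imposed. Stepanov's method gives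
-- upper bounds only, so no character sum is estimated: each count is played off against its known
-- total. A prime r makes every non-trivial r-th root of unity a generator of all of them, which is
-- what the averaging over exponents uses. The simple zero at 0 comes from the coordinate y = c x +
-- lam for one multiplier c; lam ≠ 0 keeps the forms of the other multipliers away from 0 there. The
-- exponent 1/10: with K about log₂ q, the three pairwise products have size O(K d √q). The final
-- inequality then reads q² / d² ≪ K³ d³ q ^ (3/2), that is √q ≪ K³ d⁵, which fails for d ≤ q ^
-- (1/10 - ε) and large q.

module Sumℕ where
  open import Algebra.Properties.Semiring.Sum ℕ.+-*-semiring public
    using (sum; sum-cong-≗; ∑-distrib-+; ∑-comm; *-distribˡ-sum; *-distribʳ-sum; sum-permute; sum-replicate-zero)

  𝟏 : ∀ {p} {P : Set p} → Dec P → ℕ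
  𝟏 (yes _) = 1
  𝟏 (no _)  = 0

  𝟏-yes : ∀ {p} {P : Set p} (d : Dec P) → P → 𝟏 d ≡ 1
  𝟏-yes (yes _) _ = refl
  𝟏-yes (no ¬p) p = ⊥-elim (¬p p)

  𝟏-no : ∀ {p} {P : Set p} (d : Dec P) → ¬ P → 𝟏 d ≡ 0
  𝟏-no (yes p) ¬p = ⊥-elim (¬p p)
  𝟏-no (no _)  _  = refl

  𝟏≤1 : ∀ {p} {P : Set p} (d : Dec P) → 𝟏 d ≤ 1
  𝟏≤1 (yes _) = s≤s z≤n
  𝟏≤1 (no _)  = z≤n

  𝟏-mono : ∀ {p q} {P : Set p} {Q : Set q} (d : Dec P) (e : Dec Q) → (P → Q) → 𝟏 d ≤ 𝟏 e
  𝟏-mono (no _)  e f = z≤n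
  𝟏-mono (yes p) e f rewrite 𝟏-yes e (f p) = s≤s z≤n

  𝟏-cong : ∀ {p q} {P : Set p} {Q : Set q} (d : Dec P) (e : Dec Q) → (P → Q) → (Q → P) → 𝟏 d ≡ 𝟏 e
  𝟏-cong d e f g = ℕ.≤-antisym (𝟏-mono d e f) (𝟏-mono e d g)

  sum-mono : ∀ {n} {f g : Fin n → ℕ} → (∀ i → f i ≤ g i) → sum f ≤ sum g
  sum-mono {zero}  h = z≤n
  sum-mono {suc n} h = ℕ.+-mono-≤ (h zero) (sum-mono (h ∘ suc))

  sum-const : ∀ n c → sum {n} (λ _ → c) ≡ n * c
  sum-const zero    c = refl
  sum-const (suc n) c = cong (c +_) (sum-const n c)

  term≤sum : ∀ {n} (f : Fin n → ℕ) i → f i ≤ sum f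
  term≤sum f zero    = ℕ.m≤m+n _ _
  term≤sum f (suc i) = ℕ.≤-trans (term≤sum (f ∘ suc) i) (ℕ.m≤n+m _ _)

  sum-indicator : ∀ {n} (j : Fin n) → sum (λ i → 𝟏 (i Finₚ.≟ j)) ≡ 1
  sum-indicator {suc n} zero = cong suc (trans (sum-cong-≗ {n} (λ _ → refl)) (sum-replicate-zero n))
  sum-indicator {suc n} (suc j) = trans (sum-cong-≗ (λ i → 𝟏-cong (suc i Finₚ.≟ suc j) (i Finₚ.≟ j) Finₚ.suc-injective (cong suc))) (sum-indicator j)

  2xy≤x²+y² : ∀ x y → 2 * (x * y) ≤ x * x + y * y
  2xy≤x²+y² x y with ℕ.≤-total x y
  ... | inj₁ le with ℕ.m≤n⇒∃[o]m+o≡n le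
  ...   | k , refl = ℕ.≤-trans (ℕ.m≤m+n _ (k * k)) (ℕ.≤-reflexive (lem x k))
    where
    lem : ∀ x k → 2 * (x * (x + k)) + k * k ≡ x * x + (x + k) * (x + k)
    lem = solve-∀
  2xy≤x²+y² x y | inj₂ le with ℕ.m≤n⇒∃[o]m+o≡n le
  ...   | k , refl = ℕ.≤-trans (ℕ.m≤m+n _ (k * k)) (ℕ.≤-reflexive (lem y k))
    where
    lem : ∀ y k → 2 * ((y + k) * y) + k * k ≡ (y + k) * (y + k) + y * y
    lem = solve-∀

-- Arithmetic in a finite field and sums over its elements.

module FieldBasics (F : FiniteField) where
  open FiniteField F public
    using (Carrier; order; enum; inverse; 1≢0; isCommutativeRing)
    renaming (_+_ to infixl 6 _⊕_; _*_ to infixl 7 _⊗_; -_ to infix 8 ⊖_; 0# to 𝟘; 1# to 𝟙)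
  open Sumℕ

  fieldRing : CommutativeRing 0ℓ 0ℓ
  fieldRing = record { isCommutativeRing = isCommutativeRing }

  open CommutativeRing fieldRing public
    using (semiring; commutativeSemiring; ring; *-commutativeMonoid
          ; +-assoc; +-comm; +-identityˡ; +-identityʳ; *-assoc; *-comm; *-identityˡ; *-identityʳ
          ; distribˡ; distribʳ; zeroˡ; zeroʳ; -‿inverseˡ; -‿inverseʳ)
  open import Algebra.Properties.Semiring.Exp semiring public
    using (^-homo-*; ^-assocʳ) renaming (_^_ to infixr 8 _↑_)
  open import Algebra.Properties.CommutativeSemiring.Exp commutativeSemiring public
    using (^-distrib-*)

  ⊕-cancelʳ : ∀ {a b} c → a ⊕ c ≡ b ⊕ c → a ≡ b
  ⊕-cancelʳ {a} {b} c e = begin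
    a ≡⟨ lem a ⟩
    (a ⊕ c) ⊕ ⊖ c ≡⟨ cong (_⊕ ⊖ c) e ⟩
    (b ⊕ c) ⊕ ⊖ c ≡⟨ sym (lem b) ⟩
    b ∎
    where
    open ≡-Reasoning
    lem : ∀ x → x ≡ (x ⊕ c) ⊕ ⊖ c
    lem x = sym (trans (+-assoc x c (⊖ c)) (trans (cong (x ⊕_) (-‿inverseʳ c)) (+-identityʳ x)))

  ⊕-⊖-cancel : ∀ x c → (x ⊕ ⊖ c) ⊕ c ≡ x
  ⊕-⊖-cancel x c = trans (+-assoc x (⊖ c) c) (trans (cong (x ⊕_) (-‿inverseˡ c)) (+-identityʳ x))

  ⊕-⊖-cancel′ : ∀ x c → (x ⊕ c) ⊕ ⊖ c ≡ x
  ⊕-⊖-cancel′ x c = trans (+-assoc x c (⊖ c)) (trans (cong (x ⊕_) (-‿inverseʳ c)) (+-identityʳ x))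

  infix 4 _≟_
  _≟_ : (x y : Carrier) → Dec (x ≡ y)
  x ≟ y with Inverse.to enum x Finₚ.≟ Inverse.to enum y
  ... | yes e = yes (trans (sym (Inverse.strictlyInverseʳ enum x)) (trans (cong (Inverse.from enum) e) (Inverse.strictlyInverseʳ enum y)))
  ... | no ne = no (ne ∘ cong (Inverse.to enum))

  elem : Fin order → Carrier
  elem = Inverse.from enum

  index : Carrier → Fin order
  index = Inverse.to enum

  elem-index : ∀ x → elem (index x) ≡ x
  elem-index = Inverse.strictlyInverseʳ enum

  index-elem : ∀ i → index (elem i) ≡ i
  index-elem = Inverse.strictlyInverseˡ enum

  inv : ∀ x → x ≢ 𝟘 → Carrier
  inv x nz = proj₁ (inverse x nz)

  inv-r : ∀ x nz → x ⊗ inv x nz ≡ 𝟙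
  inv-r x nz = proj₂ (inverse x nz)

  ⊗-cancelˡ : ∀ {x y z} → x ≢ 𝟘 → x ⊗ y ≡ x ⊗ z → y ≡ z
  ⊗-cancelˡ {x} {y} {z} nz e = begin
    y ≡⟨ lem y ⟩
    inv x nz ⊗ (x ⊗ y) ≡⟨ cong (inv x nz ⊗_) e ⟩
    inv x nz ⊗ (x ⊗ z) ≡⟨ sym (lem z) ⟩
    z ∎
    where
    open ≡-Reasoning
    lem : ∀ w → w ≡ inv x nz ⊗ (x ⊗ w)
    lem w = sym (trans (sym (*-assoc _ _ _)) (trans (cong (_⊗ w) (trans (*-comm _ _) (inv-r x nz))) (*-identityˡ w)))

  ⊗-zero : ∀ {x y} → x ≢ 𝟘 → x ⊗ y ≡ 𝟘 → y ≡ 𝟘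
  ⊗-zero {x} nz e = ⊗-cancelˡ nz (trans e (sym (zeroʳ x)))

  ⊗-nonzero : ∀ {x y} → x ≢ 𝟘 → y ≢ 𝟘 → x ⊗ y ≢ 𝟘
  ⊗-nonzero nx ny e = ny (⊗-zero nx e)

  inv-nonzero : ∀ x nz → inv x nz ≢ 𝟘
  inv-nonzero x nz e = 1≢0 (trans (sym (inv-r x nz)) (trans (cong (x ⊗_) e) (zeroʳ x)))

  ↑-nonzero : ∀ {x} n → x ≢ 𝟘 → x ↑ n ≢ 𝟘
  ↑-nonzero zero    nz = 1≢0
  ↑-nonzero (suc n) nz = ⊗-nonzero nz (↑-nonzero n nz)

  ↑-one : ∀ n → 𝟙 ↑ n ≡ 𝟙
  ↑-one zero    = refl
  ↑-one (suc n) = trans (*-identityˡ _) (↑-one n)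

  𝟘↑ : ∀ k → .{{NonZero k}} → 𝟘 ↑ k ≡ 𝟘
  𝟘↑ (suc k) = zeroˡ _

  ⊖𝟙≢0 : ⊖ 𝟙 ≢ 𝟘
  ⊖𝟙≢0 z = 1≢0 (trans (sym (+-identityʳ 𝟙)) (trans (cong (𝟙 ⊕_) (sym z)) (-‿inverseʳ 𝟙)))

  ⊖𝟙² : (⊖ 𝟙) ↑ 2 ≡ 𝟙
  ⊖𝟙² = trans (cong (⊖ 𝟙 ⊗_) (*-identityʳ (⊖ 𝟙))) (⊕-cancelʳ (⊖ 𝟙) (begin
    ⊖ 𝟙 ⊗ ⊖ 𝟙 ⊕ ⊖ 𝟙 ≡⟨ cong (⊖ 𝟙 ⊗ ⊖ 𝟙 ⊕_) (sym (*-identityʳ (⊖ 𝟙))) ⟩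
    ⊖ 𝟙 ⊗ ⊖ 𝟙 ⊕ ⊖ 𝟙 ⊗ 𝟙 ≡⟨ sym (distribˡ (⊖ 𝟙) (⊖ 𝟙) 𝟙) ⟩
    ⊖ 𝟙 ⊗ (⊖ 𝟙 ⊕ 𝟙) ≡⟨ cong (⊖ 𝟙 ⊗_) (-‿inverseˡ 𝟙) ⟩
    ⊖ 𝟙 ⊗ 𝟘 ≡⟨ zeroʳ (⊖ 𝟙) ⟩
    𝟘 ≡⟨ sym (-‿inverseʳ 𝟙) ⟩
    𝟙 ⊕ ⊖ 𝟙 ∎))
    where open ≡-Reasoning

  square-one : ∀ w → w ↑ 2 ≡ 𝟙 → w ≡ 𝟙 ⊎ w ≡ ⊖ 𝟙
  square-one w w² with w ⊕ 𝟙 ≟ 𝟘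
  ... | yes z = inj₂ (⊕-cancelʳ 𝟙 (trans z (sym (-‿inverseˡ 𝟙))))
  ... | no nz = inj₁ (⊗-cancelˡ nz (begin
    (w ⊕ 𝟙) ⊗ w ≡⟨ distribʳ w w 𝟙 ⟩
    w ⊗ w ⊕ 𝟙 ⊗ w ≡⟨ cong₂ _⊕_ (trans (cong (w ⊗_) (sym (*-identityʳ w))) w²) (*-identityˡ w) ⟩
    𝟙 ⊕ w ≡⟨ +-comm 𝟙 w ⟩
    w ⊕ 𝟙 ≡⟨ sym (*-identityʳ _) ⟩
    (w ⊕ 𝟙) ⊗ 𝟙 ∎))
    where open ≡-Reasoning

  ∑ : (Carrier → ℕ) → ℕ
  ∑ g = sum (g ∘ elem)

  ∑-cong : ∀ {f g} → (∀ x → f x ≡ g x) → ∑ f ≡ ∑ g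
  ∑-cong h = sum-cong-≗ (h ∘ elem)

  ∑-mono : ∀ {f g} → (∀ x → f x ≤ g x) → ∑ f ≤ ∑ g
  ∑-mono h = sum-mono (h ∘ elem)

  ∑-+ : ∀ f g → ∑ (λ x → f x + g x) ≡ ∑ f + ∑ g
  ∑-+ f g = ∑-distrib-+ (f ∘ elem) (g ∘ elem)

  ∑-const : ∀ c → ∑ (λ _ → c) ≡ order * c
  ∑-const c = sum-const order c

  ∑-*ˡ : ∀ c f → ∑ (λ x → c * f x) ≡ c * ∑ f
  ∑-*ˡ c f = sym (*-distribˡ-sum c (f ∘ elem))

  ∑-*ʳ : ∀ c f → ∑ (λ x → f x * c) ≡ ∑ f * c
  ∑-*ʳ c f = sym (*-distribʳ-sum c (f ∘ elem))

  ∑-swap : ∀ (f : Carrier → Carrier → ℕ) → ∑ (λ x → ∑ (f x)) ≡ ∑ (λ y → ∑ (λ x → f x y))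
  ∑-swap f = ∑-comm (λ i j → f (elem i) (elem j))

  ∑-sum-swap : ∀ {n} (f : Carrier → Fin n → ℕ) → ∑ (λ x → sum (f x)) ≡ sum (λ i → ∑ (λ x → f x i))
  ∑-sum-swap f = ∑-comm (λ i j → f (elem i) j)

  ∑² : (Carrier → Carrier → ℕ) → ℕ
  ∑² h = ∑ (λ u → ∑ (h u))

  ∑²-mono : ∀ {f g} → (∀ u v → f u v ≤ g u v) → ∑² f ≤ ∑² g
  ∑²-mono h = ∑-mono (λ u → ∑-mono (h u))

  ∑²-cong : ∀ {f g} → (∀ u v → f u v ≡ g u v) → ∑² f ≡ ∑² g
  ∑²-cong h = ∑-cong (λ u → ∑-cong (h u))

  ∑²-+ : ∀ f g → ∑² (λ u v → f u v + g u v) ≡ ∑² f + ∑² g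
  ∑²-+ f g = trans (∑-cong (λ u → ∑-+ (f u) (g u))) (∑-+ (λ u → ∑ (f u)) (λ u → ∑ (g u)))

  ∑²-*ˡ : ∀ c f → ∑² (λ u v → c * f u v) ≡ c * ∑² f
  ∑²-*ˡ c f = trans (∑-cong (λ u → ∑-*ˡ c (f u))) (∑-*ˡ c (λ u → ∑ (f u)))

  ∑²-*ʳ : ∀ c f → ∑² (λ u v → f u v * c) ≡ ∑² f * c
  ∑²-*ʳ c f = trans (∑-cong (λ u → ∑-*ʳ c (f u))) (∑-*ʳ c (λ u → ∑ (f u)))

  permutation : (f g : Carrier → Carrier) → (∀ x → f (g x) ≡ x) → (∀ x → g (f x) ≡ x) → Perm.Permutation order order
  permutation f g fg gf = Perm.permutation (index ∘ f ∘ elem) (index ∘ g ∘ elem)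
    (λ i → trans (cong (index ∘ f) (elem-index _)) (trans (cong index (fg _)) (index-elem i)))
    (λ i → trans (cong (index ∘ g) (elem-index _)) (trans (cong index (gf _)) (index-elem i)))

  ∑-reindex : ∀ h (f g : Carrier → Carrier) → (∀ x → f (g x) ≡ x) → (∀ x → g (f x) ≡ x) → ∑ (h ∘ f) ≡ ∑ h
  ∑-reindex h f g fg gf = sym (trans (sum-permute (h ∘ elem) (permutation f g fg gf)) (sum-cong-≗ {order} (λ i → cong h (elem-index (f (elem i))))))

  ∑-translate : ∀ h c → ∑ (λ x → h (x ⊕ c)) ≡ ∑ h
  ∑-translate h c = ∑-reindex h (_⊕ c) (_⊕ ⊖ c) (λ x → ⊕-⊖-cancel x c) (λ x → ⊕-⊖-cancel′ x c)

  ∑-scale : ∀ h c → c ≢ 𝟘 → ∑ (λ x → h (c ⊗ x)) ≡ ∑ h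
  ∑-scale h c nz = ∑-reindex h (c ⊗_) (inv c nz ⊗_)
    (λ x → trans (sym (*-assoc _ _ _)) (trans (cong (_⊗ x) (inv-r c nz)) (*-identityˡ x)))
    (λ x → trans (sym (*-assoc _ _ _)) (trans (cong (_⊗ x) (trans (*-comm _ _) (inv-r c nz))) (*-identityˡ x)))

  ∑-indicator : ∀ a → ∑ (λ x → 𝟏 (x ≟ a)) ≡ 1
  ∑-indicator a = trans (sum-cong-≗ (λ i → 𝟏-cong (elem i ≟ a) (i Finₚ.≟ index a)
    (λ e → trans (sym (index-elem i)) (cong index e)) (λ e → trans (cong elem e) (elem-index a)))) (sum-indicator (index a))

  term≤∑ : ∀ f x → f x ≤ ∑ f
  term≤∑ f x = ℕ.≤-trans (ℕ.≤-reflexive (cong f (sym (elem-index x)))) (term≤sum (f ∘ elem) (index x))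

  1<order : 1 < order
  1<order = go order index elem-index′
    where
    elem-index′ : ∀ x y → index x ≡ index y → x ≡ y
    elem-index′ x y e = trans (sym (elem-index x)) (trans (cong elem e) (elem-index y))
    go : ∀ n (ix : Carrier → Fin n) → (∀ x y → ix x ≡ ix y → x ≡ y) → 1 < n
    go zero ix inj with ix 𝟘
    ... | ()
    go (suc zero) ix inj = ⊥-elim (1≢0 (inj _ _ (one (ix 𝟙) (ix 𝟘))))
      where
      one : (i j : Fin 1) → i ≡ j
      one zero zero = refl
    go (suc (suc n)) ix inj = s≤s (s≤s z≤n)

-- Fermat's little theorem in the field.

module FieldPowers (F : FiniteField) where
  open FieldBasics F
  import Algebra.Properties.CommutativeMonoid.Sum *-commutativeMonoid as ∏

  private
    -- The factor at 0 is replaced by 1, so that a product over the multiplicative group can run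
    -- over the enumeration of the whole field.
    units : Carrier → Carrier → Carrier
    units b x with x ≟ 𝟘
    ... | yes _ = 𝟙
    ... | no _  = b

    units-zero : ∀ b → units b 𝟘 ≡ 𝟙
    units-zero b with 𝟘 ≟ 𝟘
    ... | yes _ = refl
    ... | no ne = ⊥-elim (ne refl)

    units-nz : ∀ b {x} → x ≢ 𝟘 → units b x ≡ b
    units-nz b {x} nz with x ≟ 𝟘
    ... | yes e = ⊥-elim (nz e)
    ... | no _  = refl

    units-≢0 : ∀ x → units x x ≢ 𝟘
    units-≢0 x with x ≟ 𝟘
    ... | yes _ = 1≢0
    ... | no ne = ne

    units-scale : ∀ b → b ≢ 𝟘 → ∀ x → units (b ⊗ x) (b ⊗ x) ≡ units b x ⊗ units x x
    units-scale b nz x with x ≟ 𝟘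
    ... | yes refl = trans (cong (λ y → units y y) (zeroʳ b)) (trans (units-zero 𝟘) (sym (*-identityˡ 𝟙)))
    ... | no ne    = units-nz (b ⊗ x) (⊗-nonzero nz ne)

    ∏-nonzero : ∀ {n} (f : Fin n → Carrier) → (∀ i → f i ≢ 𝟘) → ∏.sum f ≢ 𝟘
    ∏-nonzero {zero}  f h = 1≢0
    ∏-nonzero {suc n} f h = ⊗-nonzero (h zero) (∏-nonzero (f ∘ suc) (h ∘ suc))

    ∏-all-but-one : ∀ n (j : Fin n) (f : Fin n → Carrier) b → f j ≡ 𝟙 → (∀ i → i ≢ j → f i ≡ b) → ∏.sum f ≡ b ↑ (n ∸ 1)
    ∏-all-but-one (suc n) j f b fj fi = begin
      ∏.sum f ≡⟨ ∏.sum-remove {i = j} f ⟩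
      f j ⊗ ∏.sum (removeAt f j) ≡⟨ cong (_⊗ ∏.sum (removeAt f j)) fj ⟩
      𝟙 ⊗ ∏.sum (removeAt f j) ≡⟨ *-identityˡ _ ⟩
      ∏.sum (removeAt f j) ≡⟨ ∏.sum-cong-≗ (λ i → fi (Fin.punchIn j i) (Finₚ.punchInᵢ≢i j i)) ⟩
      ∏.sum {n} (λ _ → b) ≡⟨ ∏.sum-replicate n ⟩
      b ↑ n ∎
      where open ≡-Reasoning

  -- Multiplication by b permutes the non-zero elements, so it preserves their product.
  fermat : ∀ b → b ≢ 𝟘 → b ↑ (order ∸ 1) ≡ 𝟙
  fermat b nz = ⊗-cancelˡ (∏-nonzero g (units-≢0 ∘ elem)) (begin
    P ⊗ b ↑ (order ∸ 1) ≡⟨ cong (P ⊗_) (sym (∏-all-but-one order (index 𝟘) u b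
                                           (trans (cong (units b) (elem-index 𝟘)) (units-zero b))
                                           (λ i ne → units-nz b (λ e → ne (trans (sym (index-elem i)) (cong index e)))))) ⟩
    P ⊗ ∏.sum u ≡⟨ *-comm _ _ ⟩
    ∏.sum u ⊗ P ≡⟨ sym (∏.∑-distrib-+ u g) ⟩
    ∏.sum (λ i → u i ⊗ g i) ≡⟨ ∏.sum-cong-≗ {order} (λ i → sym (trans (cong (λ y → units y y) (elem-index (b ⊗ elem i))) (units-scale b nz (elem i)))) ⟩
    ∏.sum (λ i → g (index (b ⊗ elem i))) ≡⟨ sym (∏.sum-permute g π) ⟩
    P ≡⟨ sym (*-identityʳ P) ⟩
    P ⊗ 𝟙 ∎)
    where
    open ≡-Reasoning
    u g : Fin order → Carrier
    u i = units b (elem i)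
    g i = units (elem i) (elem i)
    P = ∏.sum g
    π = permutation (b ⊗_) (inv b nz ⊗_)
      (λ x → trans (sym (*-assoc _ _ _)) (trans (cong (_⊗ x) (inv-r b nz)) (*-identityˡ x)))
      (λ x → trans (sym (*-assoc _ _ _)) (trans (cong (_⊗ x) (trans (*-comm _ _) (inv-r b nz))) (*-identityˡ x)))

  suc-order∸1 : suc (order ∸ 1) ≡ order
  suc-order∸1 = ℕ.m+[n∸m]≡n (ℕ.≤-trans (s≤s z≤n) 1<order)

  ↑-order : ∀ b → b ↑ order ≡ b
  ↑-order b with b ≟ 𝟘
  ... | yes refl = trans (cong (𝟘 ↑_) (sym suc-order∸1)) (zeroˡ _)
  ... | no nz    = trans (cong (b ↑_) (sym suc-order∸1)) (trans (cong (b ⊗_) (fermat b nz)) (*-identityʳ b))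

-- Homogeneous linear systems with more unknowns than equations.

module Kernel (F : FiniteField) where
  open FieldBasics F
  import Algebra.Properties.Semiring.Sum semiring as Σᶠ

  -- Two of the order ^ U vectors have the same image, and their difference lies in the kernel.
  kernel : ∀ {U E} → E < U → (A : Fin U → Fin E → Carrier) →
           ∃ λ (h : Fin U → Carrier) → (∃ λ i → h i ≢ 𝟘) × (∀ e → Σᶠ.sum (λ i → h i ⊗ A i e) ≡ 𝟘)
  kernel {U} {E} E<U A = h , nonzero , vanish
    where
    open ≡-Reasoning
    vec : Fin (order ^ U) → Fin U → Carrier
    vec k i = elem (Fin.finToFun k i)
    image : (Fin U → Carrier) → Fin E → Carrier
    image v e = Σᶠ.sum (λ i → v i ⊗ A i e)
    code : Fin (order ^ U) → Fin (order ^ E)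
    code k = Fin.funToFin (λ e → index (image (vec k) e))
    collision = Finₚ.pigeonhole (ℕ.^-monoʳ-< order 1<order E<U) code
    k₁ = proj₁ collision
    k₂ = proj₁ (proj₂ collision)
    same : ∀ e → image (vec k₁) e ≡ image (vec k₂) e
    same e = begin
      image (vec k₁) e ≡⟨ sym (elem-index _) ⟩
      elem (index (image (vec k₁) e)) ≡⟨ cong elem (sym (Finₚ.finToFun-funToFin _ e)) ⟩
      elem (Fin.finToFun (code k₁) e) ≡⟨ cong (λ c → elem (Fin.finToFun c e)) (proj₂ (proj₂ (proj₂ collision))) ⟩
      elem (Fin.finToFun (code k₂) e) ≡⟨ cong elem (Finₚ.finToFun-funToFin _ e) ⟩
      elem (index (image (vec k₂) e)) ≡⟨ elem-index _ ⟩
      image (vec k₂) e ∎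
    h : Fin U → Carrier
    h i = vec k₁ i ⊕ ⊖ vec k₂ i
    funToFin-cong : ∀ {m n} {f g : Fin m → Fin n} → (∀ i → f i ≡ g i) → Fin.funToFin f ≡ Fin.funToFin g
    funToFin-cong {zero}  e = refl
    funToFin-cong {suc m} e = cong₂ Fin.combine (e zero) (funToFin-cong (e ∘ suc))
    differ : ¬ (∀ i → Fin.finToFun {order} {U} k₁ i ≡ Fin.finToFun k₂ i)
    differ eq = Finₚ.<⇒≢ (proj₁ (proj₂ (proj₂ collision)))
      (trans (sym (Finₚ.funToFin-finToFin {U} k₁)) (trans (funToFin-cong eq) (Finₚ.funToFin-finToFin {U} k₂)))
    nonzero : ∃ λ i → h i ≢ 𝟘
    nonzero with Finₚ.¬∀⟶∃¬ U _ (λ i → Fin.finToFun {order} {U} k₁ i Finₚ.≟ Fin.finToFun k₂ i) differ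
    ... | i , ne = i , λ z → ne (trans (sym (index-elem _)) (trans (cong index (⊕-cancelʳ (⊖ vec k₂ i) (trans z (sym (-‿inverseʳ _))))) (index-elem _)))
    vanish : ∀ e → image h e ≡ 𝟘
    vanish e = ⊕-cancelʳ (image (vec k₂) e) (begin
      image h e ⊕ image (vec k₂) e ≡⟨ sym (Σᶠ.∑-distrib-+ (λ i → h i ⊗ A i e) (λ i → vec k₂ i ⊗ A i e)) ⟩
      Σᶠ.sum (λ i → h i ⊗ A i e ⊕ vec k₂ i ⊗ A i e) ≡⟨ Σᶠ.sum-cong-≗ (λ i → trans (sym (distribʳ (A i e) (h i) (vec k₂ i))) (cong (_⊗ A i e) (⊕-⊖-cancel (vec k₁ i) (vec k₂ i)))) ⟩
      image (vec k₁) e ≡⟨ same e ⟩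
      image (vec k₂) e ≡⟨ sym (+-identityˡ _) ⟩
      𝟘 ⊕ image (vec k₂) e ∎)

-- Formal power series and their truncations.

module PowerSeries (F : FiniteField) where
  open FieldBasics F
  open ≡-Reasoning

  Series : Set
  Series = ℕ → Carrier

  infixl 6 _⊞_
  infixl 7 _⊠_

  shift : Series → Series
  shift f k = f (suc k)

  -- The product is the Cauchy product, by the recursion f g = f₀ g + z (shift f) g, which avoids
  -- sums over splittings of the index. It treats the factors asymmetrically; `⊠-sucʳ` is the mirror
  -- recursion, from which commutativity follows.
  _⊞_ _⊠_ : Series → Series → Series
  (f ⊞ g) k = f k ⊕ g k
  (f ⊠ g) zero    = f 0 ⊗ g 0
  (f ⊠ g) (suc n) = f 0 ⊗ g (suc n) ⊕ (shift f ⊠ g) n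

  ⊟_ : Series → Series
  (⊟ f) k = ⊖ f k

  const : Carrier → Series
  const c zero    = c
  const c (suc _) = 𝟘

  monomial : Carrier → Series
  monomial w zero          = 𝟘
  monomial w (suc zero)    = w
  monomial w (suc (suc _)) = 𝟘

  const-zero : ∀ n → const 𝟘 n ≡ 𝟘
  const-zero zero    = refl
  const-zero (suc n) = refl

  -- This makes agreement modulo z ^ M compatible with multiplication.
  ⊠-local : ∀ {f f′ g g′} n → (∀ k → k ≤ n → f k ≡ f′ k) → (∀ k → k ≤ n → g k ≡ g′ k) → (f ⊠ g) n ≡ (f′ ⊠ g′) n
  ⊠-local zero    p q = cong₂ _⊗_ (p 0 z≤n) (q 0 z≤n)
  ⊠-local (suc n) p q = cong₂ _⊕_ (cong₂ _⊗_ (p 0 z≤n) (q (suc n) ℕ.≤-refl))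
    (⊠-local n (λ k k≤n → p (suc k) (s≤s k≤n)) (λ k k≤n → q k (ℕ.≤-trans k≤n (ℕ.n≤1+n n))))

  ⊠-zeroˡ : ∀ f {z} n → (∀ k → k ≤ n → z k ≡ 𝟘) → (z ⊠ f) n ≡ 𝟘
  ⊠-zeroˡ f zero    h = trans (cong (_⊗ f 0) (h 0 z≤n)) (zeroˡ _)
  ⊠-zeroˡ f (suc n) h = trans (cong₂ _⊕_ (trans (cong (_⊗ f (suc n)) (h 0 z≤n)) (zeroˡ _)) (⊠-zeroˡ f n (λ k k≤n → h (suc k) (s≤s k≤n)))) (+-identityˡ 𝟘)

  ⊠-sucʳ : ∀ f g n → (f ⊠ g) (suc n) ≡ (f ⊠ shift g) n ⊕ f (suc n) ⊗ g 0
  ⊠-sucʳ f g zero    = refl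
  ⊠-sucʳ f g (suc n) = trans (cong (f 0 ⊗ g (suc (suc n)) ⊕_) (⊠-sucʳ (shift f) g n)) (sym (+-assoc _ _ _))

  ⊠-comm : ∀ f g n → (f ⊠ g) n ≡ (g ⊠ f) n
  ⊠-comm f g zero    = *-comm _ _
  ⊠-comm f g (suc n) = trans (+-comm _ _) (trans (cong₂ _⊕_ (⊠-comm (shift f) g n) (*-comm _ _)) (sym (⊠-sucʳ g f n)))

  ⊠-zeroʳ : ∀ f {z} n → (∀ k → k ≤ n → z k ≡ 𝟘) → (f ⊠ z) n ≡ 𝟘
  ⊠-zeroʳ f {z} n h = trans (⊠-comm f z n) (⊠-zeroˡ f n h)

  ⊠-distribʳ : ∀ h f g n → ((f ⊞ g) ⊠ h) n ≡ (f ⊠ h ⊞ g ⊠ h) n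
  ⊠-distribʳ h f g zero    = distribʳ _ _ _
  ⊠-distribʳ h f g (suc n) = trans (cong₂ _⊕_ (distribʳ _ _ _) (⊠-distribʳ h (shift f) (shift g) n)) (interchange _ _ _ _)
    where
    open import Algebra.Properties.CommutativeSemigroup
      (Algebra.Bundles.CommutativeRing.+-commutativeSemigroup fieldRing) using (interchange)

  ⊠-distribˡ : ∀ h f g n → (h ⊠ (f ⊞ g)) n ≡ (h ⊠ f ⊞ h ⊠ g) n
  ⊠-distribˡ h f g n = trans (⊠-comm h (f ⊞ g) n) (trans (⊠-distribʳ h f g n) (cong₂ _⊕_ (⊠-comm f h n) (⊠-comm g h n)))

  ⊠-scaleˡ : ∀ c f g n → ((λ k → c ⊗ f k) ⊠ g) n ≡ c ⊗ (f ⊠ g) n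
  ⊠-scaleˡ c f g zero    = *-assoc _ _ _
  ⊠-scaleˡ c f g (suc n) = trans (cong₂ _⊕_ (*-assoc _ _ _) (⊠-scaleˡ c (shift f) g n)) (sym (distribˡ _ _ _))

  ⊠-assoc : ∀ f g h n → ((f ⊠ g) ⊠ h) n ≡ (f ⊠ (g ⊠ h)) n
  ⊠-assoc f g h zero    = *-assoc _ _ _
  ⊠-assoc f g h (suc n) = begin
    f 0 ⊗ g 0 ⊗ h (suc n) ⊕ (((λ k → f 0 ⊗ shift g k) ⊞ (shift f ⊠ g)) ⊠ h) n
      ≡⟨ cong₂ _⊕_ (*-assoc _ _ _) (trans (⊠-distribʳ h _ _ n) (cong₂ _⊕_ (⊠-scaleˡ (f 0) (shift g) h n) (⊠-assoc (shift f) g h n))) ⟩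
    f 0 ⊗ (g 0 ⊗ h (suc n)) ⊕ (f 0 ⊗ (shift g ⊠ h) n ⊕ (shift f ⊠ (g ⊠ h)) n)
      ≡⟨ sym (+-assoc _ _ _) ⟩
    f 0 ⊗ (g 0 ⊗ h (suc n)) ⊕ f 0 ⊗ (shift g ⊠ h) n ⊕ (shift f ⊠ (g ⊠ h)) n
      ≡⟨ cong (_⊕ (shift f ⊠ (g ⊠ h)) n) (sym (distribˡ _ _ _)) ⟩
    f 0 ⊗ (g ⊠ h) (suc n) ⊕ (shift f ⊠ (g ⊠ h)) n ∎

  const-⊠ : ∀ c f n → (const c ⊠ f) n ≡ c ⊗ f n
  const-⊠ c f zero    = refl
  const-⊠ c f (suc n) = trans (cong (c ⊗ f (suc n) ⊕_) (⊠-zeroˡ f n (λ _ _ → refl))) (+-identityʳ _)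

  monomial-⊠-zero : ∀ w f → (monomial w ⊠ f) 0 ≡ 𝟘
  monomial-⊠-zero w f = zeroˡ _

  monomial-⊠-suc : ∀ w f n → (monomial w ⊠ f) (suc n) ≡ w ⊗ f n
  monomial-⊠-suc w f n = trans (cong₂ _⊕_ (zeroˡ _) (trans (⊠-local n shift-monomial (λ _ _ → refl)) (const-⊠ w f n))) (+-identityˡ _)
    where
    shift-monomial : ∀ k → k ≤ n → shift (monomial w) k ≡ const w k
    shift-monomial zero    _ = refl
    shift-monomial (suc k) _ = refl

  -- Power series modulo z ^ M.
  truncatedRing : ℕ → CommutativeRing 0ℓ 0ℓ
  truncatedRing M = record
    { Carrier = Series
    ; _≈_ = λ f g → ∀ n → n < M → f n ≡ g n
    ; _+_ = _⊞_ ; _*_ = _⊠_ ; -_ = ⊟_ ; 0# = const 𝟘 ; 1# = const 𝟙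
    ; isCommutativeRing = record
      { isRing = record
        { +-isAbelianGroup = record
          { isGroup = record
            { isMonoid = record
              { isSemigroup = record
                { isMagma = record
                  { isEquivalence = record
                    { refl = λ _ _ → refl ; sym = λ e n l → sym (e n l) ; trans = λ e e′ n l → trans (e n l) (e′ n l) }
                  ; ∙-cong = λ e e′ n l → cong₂ _⊕_ (e n l) (e′ n l) }
                ; assoc = λ f g h n l → +-assoc _ _ _ }
              ; identity = (λ f n l → trans (cong (_⊕ f n) (const-zero n)) (+-identityˡ _))
                         , (λ f n l → trans (cong (f n ⊕_) (const-zero n)) (+-identityʳ _)) }
            ; inverse = (λ f n l → trans (-‿inverseˡ _) (sym (const-zero n)))
                      , (λ f n l → trans (-‿inverseʳ _) (sym (const-zero n)))
            ; ⁻¹-cong = λ e n l → cong ⊖_ (e n l) }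
          ; comm = λ f g n l → +-comm _ _ }
        ; *-cong = λ e e′ n l → ⊠-local n (λ k k≤n → e k (ℕ.<-≤-trans (s≤s k≤n) l)) (λ k k≤n → e′ k (ℕ.<-≤-trans (s≤s k≤n) l))
        ; *-assoc = λ f g h n l → ⊠-assoc f g h n
        ; *-identity = (λ f n l → trans (const-⊠ 𝟙 f n) (*-identityˡ _))
                     , (λ f n l → trans (⊠-comm f (const 𝟙) n) (trans (const-⊠ 𝟙 f n) (*-identityˡ _)))
        ; distrib = (λ h f g n l → ⊠-distribˡ h f g n) , (λ h f g n l → ⊠-distribʳ h f g n) }
      ; *-comm = λ f g n l → ⊠-comm f g n } }

-- Polynomials as coefficient lists, substitution of series, multiplicity of zeros.

module Polynomials (F : FiniteField) where
  open FieldBasics F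
  open PowerSeries F

  Poly : Set
  Poly = List Carrier

  infixl 6 _+ₚ_
  infixl 7 _*ₚ_ _·ₚ_
  infixr 8 _^ₚ_

  _+ₚ_ : Poly → Poly → Poly
  []      +ₚ q       = q
  (c ∷ p) +ₚ []      = c ∷ p
  (c ∷ p) +ₚ (d ∷ q) = c ⊕ d ∷ p +ₚ q

  _·ₚ_ : Carrier → Poly → Poly
  c ·ₚ []      = []
  c ·ₚ (d ∷ p) = c ⊗ d ∷ c ·ₚ p

  _*ₚ_ : Poly → Poly → Poly
  []      *ₚ q = []
  (c ∷ p) *ₚ q = c ·ₚ q +ₚ (𝟘 ∷ p *ₚ q)

  _^ₚ_ : Poly → ℕ → Poly
  p ^ₚ zero  = 𝟙 ∷ []
  p ^ₚ suc n = p *ₚ p ^ₚ n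

  x^_·_ : ℕ → Poly → Poly
  x^ zero · p  = p
  x^ suc n · p = 𝟘 ∷ x^ n · p

  length-+ₚ : ∀ {l} p q → length p ≤ l → length q ≤ l → length (p +ₚ q) ≤ l
  length-+ₚ []      q       hp hq = hq
  length-+ₚ (c ∷ p) []      hp hq = hp
  length-+ₚ (c ∷ p) (d ∷ q) (s≤s hp) (s≤s hq) = s≤s (length-+ₚ p q hp hq)

  length-·ₚ : ∀ c p → length (c ·ₚ p) ≡ length p
  length-·ₚ c []      = refl
  length-·ₚ c (d ∷ p) = cong suc (length-·ₚ c p)

  length-*ₚ : ∀ {d e} p q → length p ≤ suc d → length q ≤ suc e → length (p *ₚ q) ≤ suc (d + e)
  length-*ₚ         []          q hp       hq = z≤n
  length-*ₚ {d} {e} (c ∷ p)     q (s≤s hp) hq = length-+ₚ (c ·ₚ q) (𝟘 ∷ p *ₚ q)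
    (ℕ.≤-trans (ℕ.≤-reflexive (length-·ₚ c q)) (ℕ.≤-trans hq (s≤s (ℕ.m≤n+m e d)))) (s≤s (rest p hp))
    where
    rest : ∀ p → length p ≤ d → length (p *ₚ q) ≤ d + e
    rest []      _         = z≤n
    rest (c ∷ p) (s≤s hp′) = length-*ₚ (c ∷ p) q (s≤s hp′) hq

  length-^ₚ : ∀ {d} p n → length p ≤ suc d → length (p ^ₚ n) ≤ suc (n * d)
  length-^ₚ p zero    hp = s≤s z≤n
  length-^ₚ p (suc n) hp = length-*ₚ p (p ^ₚ n) hp (length-^ₚ p n hp)

  length-x^ : ∀ n p → length (x^ n · p) ≡ n + length p
  length-x^ zero    p = refl
  length-x^ (suc n) p = cong suc (length-x^ n p)

  ev : Poly → Carrier → Carrier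
  ev []      a = 𝟘
  ev (c ∷ p) a = c ⊕ a ⊗ ev p a

  eval : Poly → Series → Series
  eval []      y = const 𝟘
  eval (c ∷ p) y = const c ⊞ y ⊠ eval p y

  eval-zero : ∀ p y → eval p y 0 ≡ ev p (y 0)
  eval-zero []      y = refl
  eval-zero (c ∷ p) y = cong (λ e → c ⊕ y 0 ⊗ e) (eval-zero p y)

  coeff : Poly → ℕ → Carrier
  coeff []      _       = 𝟘
  coeff (c ∷ p) zero    = c
  coeff (c ∷ p) (suc i) = coeff p i

  coeff-beyond : ∀ p i → length p ≤ i → coeff p i ≡ 𝟘
  coeff-beyond []      i       _       = refl
  coeff-beyond (c ∷ p) (suc i) (s≤s h) = coeff-beyond p i h

  -- The quotient of p by x - a; its coefficients are polynomials in a.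
  quotient : Carrier → Poly → Poly
  quotient a []            = []
  quotient a (c ∷ [])      = []
  quotient a (c ∷ p@(_ ∷ _)) = ev p a ∷ quotient a p

  length-quotient : ∀ a p → length (quotient a p) ≡ length p ∸ 1
  length-quotient a []          = refl
  length-quotient a (c ∷ [])    = refl
  length-quotient a (c ∷ d ∷ p) = cong suc (length-quotient a (d ∷ p))

  module Truncated (M : ℕ) where
    open CommutativeRing (truncatedRing M) public
      using (_≈_; setoid)
    module T = CommutativeRing (truncatedRing M)
    module ≈-Reasoning = SetoidReasoning T.setoid
    private
      open module R = ≈-Reasoning
    open import Algebra.Properties.Semiring.Exp T.semiring public
      renaming (_^_ to infixr 8 _^ₛ_; ^-homo-* to ^ₛ-homo-*; ^-assocʳ to ^ₛ-assocʳ; ^-congˡ to ^ₛ-congˡ; ^-congʳ to ^ₛ-congʳ) using ()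
    open import Algebra.Properties.CommutativeSemiring.Exp T.commutativeSemiring public
      renaming (^-distrib-* to ^ₛ-distrib-*) using ()
    open import Algebra.Solver.Ring.NaturalCoefficients.Default T.commutativeSemiring public
      using (solve; _:=_; _:+_; _:*_)

    const-+ : ∀ c d → const (c ⊕ d) ≈ const c ⊞ const d
    const-+ c d zero    _ = refl
    const-+ c d (suc n) _ = sym (+-identityˡ 𝟘)

    const-* : ∀ c d → const (c ⊗ d) ≈ const c ⊠ const d
    const-* c d n _ = trans (lem n) (sym (const-⊠ c (const d) n))
      where
      lem : ∀ n → const (c ⊗ d) n ≡ c ⊗ const d n
      lem zero    = refl
      lem (suc n) = sym (zeroʳ c)

    const-^ : ∀ c n → const (c ↑ n) ≈ const c ^ₛ n
    const-^ c zero    = T.refl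
    const-^ c (suc n) = T.trans (const-* c (c ↑ n)) (T.*-congˡ {const c} (const-^ c n))

    eval-+ : ∀ p q y → eval (p +ₚ q) y ≈ eval p y ⊞ eval q y
    eval-+ []      q       y = T.sym (T.+-identityˡ (eval q y))
    eval-+ (c ∷ p) []      y = T.sym (T.+-identityʳ (eval (c ∷ p) y))
    eval-+ (c ∷ p) (d ∷ q) y = begin
      const (c ⊕ d) ⊞ y ⊠ eval (p +ₚ q) y
        ≈⟨ T.+-cong (const-+ c d) (T.*-congˡ {y} (eval-+ p q y)) ⟩
      const c ⊞ const d ⊞ y ⊠ (eval p y ⊞ eval q y)
        ≈⟨ solve 5 (λ c d y p q → c :+ d :+ y :* (p :+ q) := (c :+ y :* p) :+ (d :+ y :* q)) T.refl (const c) (const d) y (eval p y) (eval q y) ⟩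
      (const c ⊞ y ⊠ eval p y) ⊞ (const d ⊞ y ⊠ eval q y) ∎

    eval-· : ∀ c p y → eval (c ·ₚ p) y ≈ const c ⊠ eval p y
    eval-· c []      y = T.sym (T.zeroʳ (const c))
    eval-· c (d ∷ p) y = begin
      const (c ⊗ d) ⊞ y ⊠ eval (c ·ₚ p) y
        ≈⟨ T.+-cong (const-* c d) (T.*-congˡ {y} (eval-· c p y)) ⟩
      const c ⊠ const d ⊞ y ⊠ (const c ⊠ eval p y)
        ≈⟨ solve 4 (λ c d y p → c :* d :+ y :* (c :* p) := c :* (d :+ y :* p)) T.refl (const c) (const d) y (eval p y) ⟩
      const c ⊠ (const d ⊞ y ⊠ eval p y) ∎

    const0+ : ∀ f → const 𝟘 ⊞ f ≈ f
    const0+ = T.+-identityˡ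

    eval-* : ∀ p q y → eval (p *ₚ q) y ≈ eval p y ⊠ eval q y
    eval-* []      q y = T.sym (T.zeroˡ (eval q y))
    eval-* (c ∷ p) q y = begin
      eval (c ·ₚ q +ₚ (𝟘 ∷ p *ₚ q)) y
        ≈⟨ eval-+ (c ·ₚ q) (𝟘 ∷ p *ₚ q) y ⟩
      eval (c ·ₚ q) y ⊞ (const 𝟘 ⊞ y ⊠ eval (p *ₚ q) y)
        ≈⟨ T.+-cong (eval-· c q y) (T.trans (const0+ _) (T.*-congˡ {y} (eval-* p q y))) ⟩
      const c ⊠ eval q y ⊞ y ⊠ (eval p y ⊠ eval q y)
        ≈⟨ solve 4 (λ c y p q → c :* q :+ y :* (p :* q) := (c :+ y :* p) :* q) T.refl (const c) y (eval p y) (eval q y) ⟩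
      (const c ⊞ y ⊠ eval p y) ⊠ eval q y ∎

    eval-const : ∀ c y → eval (c ∷ []) y ≈ const c
    eval-const c y = T.trans (T.+-congˡ {const c} (T.zeroʳ y)) (T.+-identityʳ (const c))

    eval-^ : ∀ p n y → eval (p ^ₚ n) y ≈ eval p y ^ₛ n
    eval-^ p zero    y = eval-const 𝟙 y
    eval-^ p (suc n) y = T.trans (eval-* p (p ^ₚ n) y) (T.*-congˡ {eval p y} (eval-^ p n y))

    eval-x^ : ∀ n p y → eval (x^ n · p) y ≈ y ^ₛ n ⊠ eval p y
    eval-x^ zero    p y = T.sym (T.*-identityˡ (eval p y))
    eval-x^ (suc n) p y = T.trans (const0+ _) (T.trans (T.*-congˡ {y} (eval-x^ n p y)) (T.sym (T.*-assoc y (y ^ₛ n) (eval p y))))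

    -- Horner's scheme: if p = c + x p′ and p′ has quotient Q, then p has quotient p′(a) + x Q. Here
    -- `u` plays the role of y - a.
    eval-quotient : ∀ a p y u → y ≈ const a ⊞ u → eval p y ≈ const (ev p a) ⊞ u ⊠ eval (quotient a p) y
    eval-quotient a [] y u e = T.sym (T.trans (const0+ _) (T.zeroʳ u))
    eval-quotient a (c ∷ []) y u e = T.+-cong
      (λ n _ → cong (λ x → const x n) (sym (trans (cong (c ⊕_) (zeroʳ a)) (+-identityʳ c))))
      (T.trans (T.zeroʳ y) (T.sym (T.zeroʳ u)))
    eval-quotient a (c ∷ p@(_ ∷ _)) y u e = begin
      const c ⊞ y ⊠ eval p y
        ≈⟨ T.+-congˡ {const c} (T.*-congˡ {y} (eval-quotient a p y u e)) ⟩
      const c ⊞ y ⊠ (pa ⊞ u ⊠ Q)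
        ≈⟨ solve 5 (λ c y pa u Q → c :+ y :* (pa :+ u :* Q) := (c :+ y :* pa) :+ u :* (y :* Q)) T.refl (const c) y pa u Q ⟩
      (const c ⊞ y ⊠ pa) ⊞ u ⊠ (y ⊠ Q)
        ≈⟨ T.+-congʳ {u ⊠ (y ⊠ Q)} (T.+-congˡ {const c} (T.*-congʳ {pa} e)) ⟩
      (const c ⊞ (const a ⊞ u) ⊠ pa) ⊞ u ⊠ (y ⊠ Q)
        ≈⟨ solve 6 (λ c y pa u Q a → (c :+ (a :+ u) :* pa) :+ u :* (y :* Q) := (c :+ a :* pa) :+ u :* (pa :+ y :* Q)) T.refl (const c) y pa u Q (const a) ⟩
      (const c ⊞ const a ⊠ pa) ⊞ u ⊠ (pa ⊞ y ⊠ Q)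
        ≈⟨ T.+-congʳ {u ⊠ (pa ⊞ y ⊠ Q)} (T.sym (T.trans (const-+ c (a ⊗ ev p a)) (T.+-congˡ {const c} (const-* a (ev p a))))) ⟩
      const (c ⊕ a ⊗ ev p a) ⊞ u ⊠ (pa ⊞ y ⊠ Q) ∎
      where
      pa = const (ev p a)
      Q = eval (quotient a p) y

    eval-vanish : ∀ p y → (∀ i → coeff p i ≡ 𝟘) → eval p y ≈ const 𝟘
    eval-vanish []      y h = T.refl
    eval-vanish (c ∷ p) y h = T.trans (T.+-cong (λ n _ → cong (λ x → const x n) (h 0)) (T.*-congˡ {y} (eval-vanish p y (h ∘ suc)))) (T.trans (const0+ _) (T.zeroʳ y))

    eval-monomial : ∀ p i → i < M → eval p (monomial 𝟙) i ≡ coeff p i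
    eval-monomial []      zero    _ = refl
    eval-monomial []      (suc i) _ = refl
    eval-monomial (c ∷ p) zero    _ = trans (cong (c ⊕_) (monomial-⊠-zero 𝟙 (eval p (monomial 𝟙)))) (+-identityʳ c)
    eval-monomial (c ∷ p) (suc i) l = trans (+-identityˡ _) (trans (monomial-⊠-suc 𝟙 (eval p (monomial 𝟙)) i) (trans (*-identityˡ _) (eval-monomial p i (ℕ.<-trans (ℕ.n<1+n i) l))))

  module _ where
    open Truncated 1

    ev-+ : ∀ p q a → ev (p +ₚ q) a ≡ ev p a ⊕ ev q a
    ev-+ p q a = trans (sym (eval-zero (p +ₚ q) (const a))) (trans (eval-+ p q (const a) 0 (s≤s z≤n)) (cong₂ _⊕_ (eval-zero p (const a)) (eval-zero q (const a))))

    ev-* : ∀ p q a → ev (p *ₚ q) a ≡ ev p a ⊗ ev q a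
    ev-* p q a = trans (sym (eval-zero (p *ₚ q) (const a))) (trans (eval-* p q (const a) 0 (s≤s z≤n)) (cong₂ _⊗_ (eval-zero p (const a)) (eval-zero q (const a))))

  coeff-x^-below : ∀ n p i → i < n → coeff (x^ n · p) i ≡ 𝟘
  coeff-x^-below (suc n) p zero    _       = refl
  coeff-x^-below (suc n) p (suc i) (s≤s l) = coeff-x^-below n p i l

  coeff-x^-at : ∀ n p → coeff (x^ n · p) n ≡ coeff p 0
  coeff-x^-at zero    p = refl
  coeff-x^-at (suc n) p = coeff-x^-at n p

  ev-at-zero : ∀ p → ev p 𝟘 ≡ coeff p 0
  ev-at-zero []      = refl
  ev-at-zero (c ∷ p) = trans (cong (c ⊕_) (zeroˡ _)) (+-identityʳ c)

  ev-^ : ∀ p n a → ev (p ^ₚ n) a ≡ ev p a ↑ n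
  ev-^ p zero    a = trans (cong (𝟙 ⊕_) (zeroʳ a)) (+-identityʳ 𝟙)
  ev-^ p (suc n) a = trans (ev-* p (p ^ₚ n) a) (cong (ev p a ⊗_) (ev-^ p n a))

  -- Substituting the series z itself makes the coefficients of p visible, and p = p(a) + (x - a) Q
  -- then gives p = 0.
  coeff-vanish-quotient : ∀ a p → ev p a ≡ 𝟘 → (∀ i → coeff (quotient a p) i ≡ 𝟘) → ∀ i → coeff p i ≡ 𝟘
  coeff-vanish-quotient a p pa h i = trans (sym (eval-monomial p i (ℕ.n<1+n i))) (trans (chain i (ℕ.n<1+n i)) (const-zero i))
    where
    open Truncated (suc i)
    open ≈-Reasoning
    X = monomial 𝟙
    chain : eval p X ≈ const 𝟘
    chain = begin
      eval p X
        ≈⟨ eval-quotient a p X (X ⊞ ⊟ const a)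
             (T.sym (T.trans (T.+-comm (const a) (X ⊞ ⊟ const a)) (T.trans (T.+-assoc X (⊟ const a) (const a)) (T.trans (T.+-congˡ {X} (T.-‿inverseˡ (const a))) (T.+-identityʳ X))))) ⟩
      const (ev p a) ⊞ (X ⊞ ⊟ const a) ⊠ eval (quotient a p) X
        ≈⟨ T.+-cong (λ n _ → cong (λ x → const x n) pa) (T.trans (T.*-congˡ {X ⊞ ⊟ const a} (eval-vanish (quotient a p) X h)) (T.zeroʳ (X ⊞ ⊟ const a))) ⟩
      const 𝟘 ⊞ const 𝟘
        ≈⟨ T.+-identityˡ (const 𝟘) ⟩
      const 𝟘 ∎

  affine : Carrier → Carrier → Series
  affine a w = const a ⊞ monomial w

  affine-zero : ∀ a w → affine a w 0 ≡ a
  affine-zero a w = +-identityʳ a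

  -- For w ≠ 0 this says that p has a zero of order at least m at a. Expanding p (a + w z) replaces
  -- iterated derivatives, which lose multiplicities in small characteristic. The slope w is free
  -- because the auxiliary polynomial will be expanded along a + f(a) z.
  VanishesTo : ℕ → Poly → Carrier → Carrier → Set
  VanishesTo m p a w = ∀ t → t < m → eval p (affine a w) t ≡ 𝟘

  vanishes-quotient : ∀ {m p a w} → w ≢ 𝟘 → VanishesTo (suc m) p a w → VanishesTo m (quotient a p) a w
  vanishes-quotient {m} {p} {a} {w} nz h t t<m = ⊗-zero nz (begin
    w ⊗ eval (quotient a p) (affine a w) t ≡⟨ sym (monomial-⊠-suc w _ t) ⟩
    (monomial w ⊠ eval (quotient a p) (affine a w)) (suc t) ≡⟨ sym (+-identityˡ _) ⟩
    𝟘 ⊕ (monomial w ⊠ eval (quotient a p) (affine a w)) (suc t) ≡⟨ sym (R.eval-quotient a p (affine a w) (monomial w) R.T.refl (suc t) (s≤s t<m)) ⟩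
    eval p (affine a w) (suc t) ≡⟨ h (suc t) (s≤s t<m) ⟩
    𝟘 ∎)
    where
    module R = Truncated (suc m)
    open ≡-Reasoning

  -- Along b + w z the divisor x - a becomes (b - a) + w z. Its constant term is invertible, so it
  -- cancels coefficient by coefficient.
  vanishes-quotient-elsewhere : ∀ {m p a b w} → ev p a ≡ 𝟘 → b ≢ a → VanishesTo m p b w → VanishesTo m (quotient a p) b w
  vanishes-quotient-elsewhere {m} {p} {a} {b} {w} pa b≢a h t t<m = cancel t t<m
    where
    open Truncated m
    e = b ⊕ ⊖ a
    e≢0 : e ≢ 𝟘
    e≢0 z = b≢a (trans (sym (⊕-⊖-cancel b a)) (trans (cong (_⊕ a) z) (+-identityˡ a)))
    Q = eval (quotient a p) (affine b w)
    u = affine e w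
    split : affine b w ≈ const a ⊞ u
    split = T.trans (T.+-congʳ {monomial w} (λ n l → trans (cong (λ x → const x n) (sym (trans (+-comm a e) (⊕-⊖-cancel b a)))) (const-+ a e n l))) (T.+-assoc (const a) (const e) (monomial w))
    product : u ⊠ Q ≈ const 𝟘
    product = T.trans (T.sym (T.trans (eval-quotient a p (affine b w) u split) (T.trans (T.+-congʳ {u ⊠ Q} (λ n _ → cong (λ x → const x n) pa)) (const0+ _))))
                      (λ t l → trans (h t l) (sym (const-zero t)))
    expand : ∀ t → (u ⊠ Q) t ≡ e ⊗ Q t ⊕ (monomial w ⊠ Q) t
    expand t = trans (⊠-distribʳ Q (const e) (monomial w) t) (cong (_⊕ (monomial w ⊠ Q) t) (const-⊠ e Q t))
    product′ : ∀ t → t < m → e ⊗ Q t ⊕ (monomial w ⊠ Q) t ≡ 𝟘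
    product′ zero    l = trans (sym (expand 0)) (trans (product 0 l) (const-zero 0))
    product′ (suc t) l = trans (sym (expand (suc t))) (trans (product (suc t) l) (const-zero (suc t)))
    cancel : ∀ t → t < m → Q t ≡ 𝟘
    cancel zero    l = ⊗-zero e≢0 (trans (sym (trans (cong (e ⊗ Q 0 ⊕_) (zeroˡ _)) (+-identityʳ _))) (product′ 0 l))
    cancel (suc t) l = ⊗-zero e≢0 (trans (sym (trans (cong (e ⊗ Q (suc t) ⊕_) (trans (monomial-⊠-suc w Q t) (trans (cong (w ⊗_) (cancel t (ℕ.<-trans (ℕ.n<1+n t) l))) (zeroʳ w)))) (+-identityʳ _))) (product′ (suc t) l))

  root-of-vanishing : ∀ {m p a w} → VanishesTo (suc m) p a w → ev p a ≡ 𝟘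
  root-of-vanishing {m} {p} {a} {w} h = trans (trans (cong (ev p) (sym (affine-zero a w))) (sym (eval-zero p (affine a w)))) (h 0 (s≤s z≤n))

  divide-out : ∀ M p a w → w ≢ 𝟘 → VanishesTo M p a w →
               ∃ λ q → length q ≡ length p ∸ M × ((∀ i → coeff q i ≡ 𝟘) → ∀ i → coeff p i ≡ 𝟘)
                     × (∀ {m b v} → b ≢ a → VanishesTo m p b v → VanishesTo m q b v)
  divide-out zero    p a w nz h = p , refl , (λ z → z) , (λ _ v → v)
  divide-out (suc M) p a w nz h with divide-out M (quotient a p) a w nz (vanishes-quotient {p = p} nz h)
  ... | q , len , back , others = q
      , trans len (trans (cong (_∸ M) (length-quotient a p)) (ℕ.∸-+-assoc (length p) 1 M))
      , (λ z → coeff-vanish-quotient a p pa (back z))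
      , (λ b≢a v → others b≢a (vanishes-quotient-elsewhere {p = p} pa b≢a v))
    where
    pa = root-of-vanishing {p = p} {w = w} h


  -- Dividing out a zero of order M shortens the list by M, and after all of them nothing is left.
  -- Lists may end in zeros, so the conclusion concerns coefficients.
  vanishing-bound : ∀ M (ds : List Carrier) p → AllPairs _≢_ ds →
                    All (λ a → ∃ λ w → w ≢ 𝟘 × VanishesTo M p a w) ds →
                    length p ≤ length ds * M → ∀ i → coeff p i ≡ 𝟘
  vanishing-bound M [] p _ _ hl i = coeff-beyond p i (ℕ.≤-trans hl z≤n)
  vanishing-bound M (a ∷ ds) p (a∉ ∷ dist) ((w , nz , v) ∷ vs) hl with divide-out M p a w nz v
  ... | q , len , back , others = back (vanishing-bound M ds q dist
      (All.zipWith (λ (a≢b , (w′ , nz′ , v′)) → w′ , nz′ , others (λ e → a≢b (sym e)) v′) (a∉ , vs))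
      (ℕ.≤-trans (ℕ.≤-reflexive len) (ℕ.≤-trans (ℕ.∸-monoˡ-≤ M hl) (ℕ.≤-reflexive (ℕ.m+n∸m≡n M (length ds * M))))))

-- The q-th power map on power series.

module Frobenius (F : FiniteField) where
  open FieldBasics F
  open FieldPowers F
  open PowerSeries F
  open Polynomials F

  private
    -- Only the shape "y ^ n plus lower terms" matters, so neither binomial coefficients nor the
    -- characteristic enter. The same `r` serves for all M: with M = 1 it can be evaluated at
    -- points, and what is learnt there is applied to series.
    translate-power : ∀ a n → ∃ λ r → length r ≤ n × (∀ M y → let open Truncated M in (const a ⊞ y) ^ₛ n ≈ eval r y ⊞ y ^ₛ n)
    translate-power a zero = [] , z≤n , λ M y → let open Truncated M in T.sym (const0+ (const 𝟙))
    translate-power a (suc n) with translate-power a n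
    ... | r , len , eq = r′ , len′ , eq′
      where
      r′ = a ·ₚ r +ₚ (𝟘 ∷ r) +ₚ x^ n · (a ∷ [])
      len′ : length r′ ≤ suc n
      len′ = length-+ₚ (a ·ₚ r +ₚ (𝟘 ∷ r)) (x^ n · (a ∷ []))
        (length-+ₚ (a ·ₚ r) (𝟘 ∷ r) (ℕ.≤-trans (ℕ.≤-reflexive (length-·ₚ a r)) (ℕ.m≤n⇒m≤1+n len)) (s≤s len))
        (ℕ.≤-reflexive (trans (length-x^ n (a ∷ [])) (ℕ.+-comm n 1)))
      eq′ : ∀ M y → let open Truncated M in (const a ⊞ y) ^ₛ suc n ≈ eval r′ y ⊞ y ^ₛ suc n
      eq′ M y = begin
        (const a ⊞ y) ⊠ (const a ⊞ y) ^ₛ n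
          ≈⟨ T.*-congˡ {const a ⊞ y} (eq M y) ⟩
        (const a ⊞ y) ⊠ (eval r y ⊞ y ^ₛ n)
          ≈⟨ solve 4 (λ a y r Y → (a :+ y) :* (r :+ Y) := ((a :* r :+ y :* r) :+ Y :* a) :+ y :* Y) T.refl (const a) y (eval r y) (y ^ₛ n) ⟩
        ((const a ⊠ eval r y ⊞ y ⊠ eval r y) ⊞ y ^ₛ n ⊠ const a) ⊞ y ⊠ y ^ₛ n
          ≈⟨ T.+-congʳ {y ⊠ y ^ₛ n} (T.sym (T.trans (eval-+ (a ·ₚ r +ₚ (𝟘 ∷ r)) (x^ n · (a ∷ [])) y) (T.+-cong
               (T.trans (eval-+ (a ·ₚ r) (𝟘 ∷ r) y) (T.+-cong (eval-· a r y) (const0+ (y ⊠ eval r y))))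
               (T.trans (eval-x^ n (a ∷ []) y) (T.*-congˡ {y ^ₛ n} (eval-const a y)))))) ⟩
        eval r′ y ⊞ y ⊠ y ^ₛ n ∎
        where
        open Truncated M
        open ≈-Reasoning

  ^ₛ-zero : ∀ M y n → let open Truncated M in (y ^ₛ n) 0 ≡ y 0 ↑ n
  ^ₛ-zero M y zero    = refl
  ^ₛ-zero M y (suc n) = cong (y 0 ⊗_) (^ₛ-zero M y n)

  elements : List Carrier
  elements = map elem (allFin order)

  length-elements : length elements ≡ order
  length-elements = trans (Listₚ.length-map elem (allFin order)) (Listₚ.length-tabulate {n = order} (λ i → i))

  distinct-elements : AllPairs _≢_ elements
  distinct-elements = AllPairsₚ.map⁺ (AllPairsₚ.tabulate⁺ {f = λ i → i} (λ i≢j e → i≢j (trans (sym (index-elem _)) (trans (cong index e) (index-elem _)))))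

  -- (x + a) ^ q - x ^ q - a has degree less than q and vanishes on the whole field.
  frobenius : ∀ M a y → let open Truncated M in (const a ⊞ y) ^ₛ order ≈ const a ⊞ y ^ₛ order
  frobenius M a y = begin
    (const a ⊞ y) ^ₛ order ≈⟨ eq M y ⟩
    eval r y ⊞ y ^ₛ order ≈⟨ T.+-congʳ {y ^ₛ order} r≈a ⟩
    const a ⊞ y ^ₛ order ∎
    where
    open Truncated M
    open ≈-Reasoning
    r = proj₁ (translate-power a order)
    len = proj₁ (proj₂ (translate-power a order))
    eq = proj₂ (proj₂ (translate-power a order))
    w = r +ₚ (⊖ a ∷ [])
    ev-r : ∀ b → ev r b ≡ a
    ev-r b = ⊕-cancelʳ b (trans (cong₂ _⊕_ (sym (eval-zero r (const b))) (sym (trans (^ₛ-zero 1 (const b) order) (↑-order b))))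
      (trans (sym (eq 1 (const b) 0 (s≤s z≤n))) (trans (^ₛ-zero 1 (const a ⊞ const b) order) (↑-order (a ⊕ b)))))
    ev-w : ∀ b → ev w b ≡ 𝟘
    ev-w b = trans (ev-+ r (⊖ a ∷ []) b) (trans (cong₂ _⊕_ (ev-r b) (trans (cong (⊖ a ⊕_) (zeroʳ b)) (+-identityʳ _))) (-‿inverseʳ a))
    w-vanishes : ∀ b → VanishesTo 1 w b 𝟙
    w-vanishes b zero _ = trans (eval-zero w (affine b 𝟙)) (ev-w _)
    w-vanishes b (suc t) (s≤s ())
    w≡0 : ∀ i → coeff w i ≡ 𝟘
    w≡0 = vanishing-bound 1 elements w distinct-elements (All.universal (λ b → 𝟙 , 1≢0 , w-vanishes b) elements)
      (ℕ.≤-trans (length-+ₚ r (⊖ a ∷ []) len (ℕ.<⇒≤ 1<order)) (ℕ.≤-reflexive (sym (trans (ℕ.*-identityʳ _) length-elements))))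
    r≈a : eval r y ≈ const a
    r≈a = begin
      eval r y ≈⟨ T.sym (T.+-identityʳ (eval r y)) ⟩
      eval r y ⊞ const 𝟘 ≈⟨ T.+-congˡ {eval r y} (T.trans (λ n _ → cong (λ c → const c n) (sym (-‿inverseˡ a))) (const-+ (⊖ a) a)) ⟩
      eval r y ⊞ (const (⊖ a) ⊞ const a) ≈⟨ T.sym (T.+-assoc (eval r y) (const (⊖ a)) (const a)) ⟩
      eval r y ⊞ const (⊖ a) ⊞ const a ≈⟨ T.+-congʳ {const a} (T.sym (T.trans (eval-+ r (⊖ a ∷ []) y) (T.+-congˡ {eval r y} (eval-const (⊖ a) y)))) ⟩
      eval w y ⊞ const a ≈⟨ T.+-congʳ {const a} (eval-vanish w y w≡0) ⟩
      const 𝟘 ⊞ const a ≈⟨ const0+ (const a) ⟩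
      const a ∎

  power-order : ∀ M y → y 0 ≡ 𝟘 → ∀ n t → t < n → let open Truncated M in (y ^ₛ n) t ≡ 𝟘
  power-order M y y0 (suc n) zero    _       = trans (cong₂ _⊗_ y0 refl) (zeroˡ _)
  power-order M y y0 (suc n) (suc t) (s≤s l) = trans (cong₂ _⊕_ (trans (cong₂ _⊗_ y0 refl) (zeroˡ _))
    (⊠-zeroʳ (shift y) t (λ k k≤t → power-order M y y0 n k (ℕ.≤-<-trans k≤t l)))) (+-identityˡ 𝟘)

  -- (a + w z) ^ q = a + (w z) ^ q, and the second term has order q ≥ M. So x ^ q is constant in a
  -- local expansion of length M.
  frobenius-affine : ∀ M → M ≤ order → ∀ a w → let open Truncated M in affine a w ^ₛ order ≈ const a
  frobenius-affine M M≤q a w t l = trans (frobenius M a (monomial w) t l)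
    (trans (cong (const a t ⊕_) (power-order M (monomial w) refl order t (ℕ.<-≤-trans l M≤q))) (+-identityʳ _))

-- Degrees in the base point of the coefficients of a local expansion.

module Graded (F : FiniteField) where
  open FieldBasics F
  open PowerSeries F
  open Polynomials F

  PolyFun : ℕ → (Carrier → Carrier) → Set
  PolyFun e g = ∃ λ p → length p ≤ suc e × (∀ a → g a ≡ ev p a)

  polyFun-weaken : ∀ {e e′ g} → e ≤ e′ → PolyFun e g → PolyFun e′ g
  polyFun-weaken le (p , len , eq) = p , ℕ.≤-trans len (s≤s le) , eq

  polyFun-+ : ∀ {e g h} → PolyFun e g → PolyFun e h → PolyFun e (λ a → g a ⊕ h a)
  polyFun-+ (p , lp , ep) (q , lq , eq) = p +ₚ q , length-+ₚ p q lp lq , λ a → trans (cong₂ _⊕_ (ep a) (eq a)) (sym (ev-+ p q a))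

  polyFun-* : ∀ {e e′ g h} → PolyFun e g → PolyFun e′ h → PolyFun (e + e′) (λ a → g a ⊗ h a)
  polyFun-* (p , lp , ep) (q , lq , eq) = p *ₚ q , length-*ₚ p q lp lq , λ a → trans (cong₂ _⊗_ (ep a) (eq a)) (sym (ev-* p q a))

  polyFun-const : ∀ {e} c → PolyFun e (λ _ → c)
  polyFun-const c = c ∷ [] , s≤s z≤n , λ a → sym (trans (cong (c ⊕_) (zeroʳ a)) (+-identityʳ c))

  polyFun-zero : ∀ {e} → PolyFun e (λ _ → 𝟘)
  polyFun-zero = polyFun-const 𝟘

  polyFun-id : PolyFun 1 (λ a → a)
  polyFun-id = 𝟘 ∷ 𝟙 ∷ [] , ℕ.≤-refl , λ a → sym (trans (+-identityˡ _) (trans (cong (a ⊗_) (trans (cong (𝟙 ⊕_) (zeroʳ a)) (+-identityʳ 𝟙))) (*-identityʳ a)))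

  module _ (m : ℕ) where

    -- The coefficient of z ^ t grows in degree by m for each step in t.
    IsGraded : ℕ → (Carrier → Series) → Set
    IsGraded e s = ∀ t → PolyFun (e + t * m) (λ a → s a t)

    graded-weaken : ∀ {e e′ s} → e ≤ e′ → IsGraded e s → IsGraded e′ s
    graded-weaken {e} {e′} le G t = polyFun-weaken {e + t * m} {e′ + t * m} (ℕ.+-monoˡ-≤ (t * m) le) (G t)

    graded-+ : ∀ {e s s′} → IsGraded e s → IsGraded e s′ → IsGraded e (λ a → s a ⊞ s′ a)
    graded-+ G G′ t = polyFun-+ (G t) (G′ t)

    graded-shift : ∀ {e s} → IsGraded e s → IsGraded (e + m) (λ a → shift (s a))
    graded-shift {e} G t = polyFun-weaken (ℕ.≤-reflexive (sym (ℕ.+-assoc e m (t * m)))) (G (suc t))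

    graded-* : ∀ {e e′ s s′} → IsGraded e s → IsGraded e′ s′ → IsGraded (e + e′) (λ a → s a ⊠ s′ a)
    graded-* {e} {e′} {s} {s′} G G′ zero = polyFun-weaken (ℕ.≤-reflexive lem) (polyFun-* (G 0) (G′ 0))
      where
      lem : e + 0 + (e′ + 0) ≡ e + e′ + 0
      lem = trans (cong₂ _+_ (ℕ.+-identityʳ e) (ℕ.+-identityʳ e′)) (sym (ℕ.+-identityʳ _))
    graded-* {e} {e′} {s} {s′} G G′ (suc t) = polyFun-+
      (polyFun-weaken (ℕ.≤-reflexive lem₁) (polyFun-* (G 0) (G′ (suc t))))
      (polyFun-weaken (ℕ.≤-reflexive lem₂) (graded-* (graded-shift G) G′ t))
      where
      open ≡-Reasoning
      lem₁ : e + 0 + (e′ + suc t * m) ≡ e + e′ + suc t * m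
      lem₁ = trans (cong (_+ (e′ + suc t * m)) (ℕ.+-identityʳ e)) (sym (ℕ.+-assoc e e′ _))
      lem₂ : e + m + e′ + t * m ≡ e + e′ + suc t * m
      lem₂ = begin
        e + m + e′ + t * m ≡⟨ cong (_+ t * m) (trans (ℕ.+-assoc e m e′) (trans (cong (e +_) (ℕ.+-comm m e′)) (sym (ℕ.+-assoc e e′ m)))) ⟩
        e + e′ + m + t * m ≡⟨ ℕ.+-assoc (e + e′) m (t * m) ⟩
        e + e′ + suc t * m ∎

    graded-const : ∀ {e g} → PolyFun e g → IsGraded e (λ a → const (g a))
    graded-const {e} G zero    = polyFun-weaken (ℕ.≤-reflexive (sym (ℕ.+-identityʳ e))) G
    graded-const G (suc t) = polyFun-zero

    graded-monomial : ∀ {g} → PolyFun m g → IsGraded 0 (λ a → monomial (g a))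
    graded-monomial G zero          = polyFun-zero
    graded-monomial G (suc zero)    = polyFun-weaken (ℕ.m≤m+n m 0) G
    graded-monomial G (suc (suc t)) = polyFun-zero

    graded-^ : ∀ M {e s} n → IsGraded e s → let open Truncated M in IsGraded (n * e) (λ a → s a ^ₛ n)
    graded-^ M zero    G = graded-const (polyFun-const 𝟙)
    graded-^ M (suc n) G = graded-* G (graded-^ M n G)

    -- The coefficients of the quotient are values at a of tails of p. Each further tail is one
    -- degree shorter, which pays for the additional factor y of weight 1.
    graded-quotient : ∀ {e y} p → length p ≤ suc e → IsGraded 1 y → IsGraded e (λ a → eval (quotient a p) (y a))
    graded-quotient []       _  Y = graded-const polyFun-zero
    graded-quotient (c ∷ []) _  Y = graded-const polyFun-zero
    graded-quotient {suc e} (c ∷ p@(_ ∷ _)) (s≤s l) Y = graded-+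
      (graded-weaken {e} {suc e} (ℕ.n≤1+n e) (graded-const (p , l , λ _ → refl)))
      (graded-* Y (graded-quotient p l Y))

-- Stepanov's auxiliary polynomial.

module Stepanov (F : FiniteField) where
  open FieldBasics F
  open FieldPowers F
  open PowerSeries F
  open Polynomials F
  open Frobenius F
  open Graded F
  open Kernel F
  import Algebra.Properties.Semiring.Sum semiring as Σᶠ

  private
    sum-single : ∀ {n} (f : Fin n → Carrier) j → (∀ i → i ≢ j → f i ≡ 𝟘) → Σᶠ.sum f ≡ f j
    sum-single {suc n} f zero h = trans (cong (f zero ⊕_) (trans (Σᶠ.sum-cong-≗ (λ i → h (suc i) (λ ()))) (Σᶠ.sum-replicate-zero n))) (+-identityʳ _)
    sum-single {suc n} f (suc j) h = trans (cong₂ _⊕_ (h zero (λ ())) (sum-single (f ∘ suc) j (λ i ne → h (suc i) (ne ∘ Finₚ.suc-injective)))) (+-identityˡ _)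

    ev-as-sum : ∀ E p a → length p ≤ E → ev p a ≡ Σᶠ.sum {E} (λ e → coeff p (toℕ e) ⊗ a ↑ toℕ e)
    ev-as-sum E       []      a _ = sym (trans (Σᶠ.sum-cong-≗ {E} (λ e → zeroˡ _)) (Σᶠ.sum-replicate-zero E))
    ev-as-sum (suc E) (c ∷ p) a (s≤s l) = cong₂ _⊕_ (sym (*-identityʳ c)) (begin
      a ⊗ ev p a ≡⟨ cong (a ⊗_) (ev-as-sum E p a l) ⟩
      a ⊗ Σᶠ.sum {E} (λ e → coeff p (toℕ e) ⊗ a ↑ toℕ e) ≡⟨ Σᶠ.*-distribˡ-sum {E} a _ ⟩
      Σᶠ.sum {E} (λ e → a ⊗ (coeff p (toℕ e) ⊗ a ↑ toℕ e)) ≡⟨ Σᶠ.sum-cong-≗ {E} (λ e → trans (sym (*-assoc a _ _)) (trans (cong (_⊗ a ↑ toℕ e) (*-comm a (coeff p (toℕ e)))) (*-assoc _ _ _))) ⟩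
      Σᶠ.sum {E} (λ e → coeff p (toℕ e) ⊗ (a ⊗ a ↑ toℕ e)) ∎)
      where open ≡-Reasoning

    sumₚ : ∀ {U} → (Fin U → Carrier) → (Fin U → Poly) → Poly
    sumₚ {zero}  h b = []
    sumₚ {suc U} h b = h zero ·ₚ b zero +ₚ sumₚ (h ∘ suc) (b ∘ suc)

    length-sumₚ : ∀ {U l} (h : Fin U → Carrier) b → (∀ v → length (b v) ≤ l) → length (sumₚ h b) ≤ l
    length-sumₚ {zero}  h b le = z≤n
    length-sumₚ {suc U} h b le = length-+ₚ (h zero ·ₚ b zero) (sumₚ (h ∘ suc) (b ∘ suc))
      (ℕ.≤-trans (ℕ.≤-reflexive (length-·ₚ (h zero) (b zero))) (le zero)) (length-sumₚ (h ∘ suc) (b ∘ suc) (le ∘ suc))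

    eval-sumₚ : ∀ {U} (h : Fin U → Carrier) b y t → eval (sumₚ h b) y t ≡ Σᶠ.sum (λ v → h v ⊗ eval (b v) y t)
    eval-sumₚ {zero}  h b y t = const-zero t
    eval-sumₚ {suc U} h b y t = trans (eval-+ (h zero ·ₚ b zero) (sumₚ (h ∘ suc) (b ∘ suc)) y t (ℕ.n<1+n t))
      (cong₂ _⊕_ (trans (eval-· (h zero) (b zero) y t (ℕ.n<1+n t)) (const-⊠ (h zero) _ t)) (eval-sumₚ (h ∘ suc) (b ∘ suc) y t))
      where open Truncated (suc t)

    coeff-sumₚ : ∀ {U} (h : Fin U → Carrier) b i → coeff (sumₚ h b) i ≡ Σᶠ.sum (λ v → h v ⊗ coeff (b v) i)
    coeff-sumₚ {U} h b i = trans (sym (eval-monomial (sumₚ h b) i (ℕ.n<1+n i)))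
      (trans (eval-sumₚ h b (monomial 𝟙) i) (Σᶠ.sum-cong-≗ {U} (λ v → cong (h v ⊗_) (eval-monomial (b v) i (ℕ.n<1+n i)))))
      where open Truncated (suc i)

    -- b v = x ^ v * (polynomial with non-zero constant term), a triangular system.
    triangular-independent : ∀ {U} (h : Fin U → Carrier) (p : Fin U → Poly) → (∀ v → coeff (p v) 0 ≢ 𝟘) →
                             (∀ i → coeff (sumₚ h (λ v → x^ toℕ v · p v)) i ≡ 𝟘) → ∀ v → h v ≡ 𝟘
    triangular-independent {U} h p nz vanish v = go (suc (toℕ v)) v (ℕ.n<1+n _)
      where
      go : ∀ k v → toℕ v < k → h v ≡ 𝟘
      go (suc k) v (s≤s l) = ⊗-zero (nz v) (begin
        coeff (p v) 0 ⊗ h v ≡⟨ *-comm _ _ ⟩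
        h v ⊗ coeff (p v) 0 ≡⟨ cong (h v ⊗_) (sym (coeff-x^-at (toℕ v) (p v))) ⟩
        h v ⊗ coeff (x^ toℕ v · p v) (toℕ v) ≡⟨ sym (sum-single (λ u → h u ⊗ coeff (x^ toℕ u · p u) (toℕ v)) v other) ⟩
        Σᶠ.sum (λ u → h u ⊗ coeff (x^ toℕ u · p u) (toℕ v)) ≡⟨ sym (coeff-sumₚ h (λ v → x^ toℕ v · p v) (toℕ v)) ⟩
        coeff (sumₚ h (λ v → x^ toℕ v · p v)) (toℕ v) ≡⟨ vanish (toℕ v) ⟩
        𝟘 ∎)
        where
        open ≡-Reasoning
        other : ∀ u → u ≢ v → h u ⊗ coeff (x^ toℕ u · p u) (toℕ v) ≡ 𝟘
        other u u≢v with ℕ.<-cmp (toℕ u) (toℕ v)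
        ... | tri< lt _ _ = trans (cong₂ _⊗_ (go k u (ℕ.<-≤-trans lt l)) refl) (zeroˡ _)
        ... | tri≈ _ eq _ = ⊥-elim (u≢v (Finₚ.toℕ-injective eq))
        ... | tri> _ _ gt = trans (cong (h u ⊗_) (coeff-x^-below (toℕ u) (p u) (toℕ v) gt)) (zeroʳ _)

  module _ {d n} (dn : d * n ≡ order ∸ 1) .{{_ : NonZero n}} .{{_ : NonZero order}}
           (g₀ : Carrier) (g₀≢0 : g₀ ≢ 𝟘) (g′ : Poly) {m} (deg : length g′ ≤ m)
           (ω : Carrier) (ω≢0 : ω ≢ 𝟘)
           (M R : ℕ) (M≤q : M ≤ order) (room : M * (n + R + M * suc m) < order * R) where

    private
      f g : Poly
      g = g₀ ∷ g′
      f = 𝟘 ∷ g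
      U E : ℕ
      U = order * R
      -- In the expansion of b v the coefficient of z ^ t has degree at most u + i + t (m + 1) in a,
      -- where u < n, i < R and t < M. Vanishing to order M thus costs M E linear equations in U
      -- unknowns.
      E = n + R + M * suc m

      -- Digits with v = u + n j + q i, so that x ^ u f ^ (n j) (x ^ q) ^ i has order exactly v at
      -- 0. As q = d n + 1, the digit j attains d when v leaves remainder q - 1 modulo q, and then u
      -- = 0.
      uu jj ii : ℕ → ℕ
      uu v = v % order % n
      jj v = v % order / n
      ii v = v / order

      split-index : ∀ v → v ≡ uu v + n * jj v + order * ii v
      split-index v = begin
        v ≡⟨ DM.m≡m%n+[m/n]*n v order ⟩
        v % order + v / order * order ≡⟨ cong₂ _+_ (DM.m≡m%n+[m/n]*n (v % order) n) (ℕ.*-comm (v / order) order) ⟩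
        uu v + jj v * n + order * ii v ≡⟨ cong (λ z → uu v + z + order * ii v) (ℕ.*-comm (jj v) n) ⟩
        uu v + n * jj v + order * ii v ∎
        where open ≡-Reasoning

      p : Fin U → Poly
      p v = g ^ₚ (n * jj (toℕ v))

      -- This is x ^ u (x ^ q) ^ i f ^ (n j) with all powers of x collected, using f = x g.
      b : Fin U → Poly
      b v = x^ toℕ v · p v

      jj≤d : ∀ v → n * jj v ≤ order ∸ 1
      jj≤d v = ℕ.≤-trans (ℕ.≤-reflexive (ℕ.*-comm n (jj v))) (ℕ.≤-trans (DM.m/n*n≤m (v % order) n)
        (ℕ.≤-trans (ℕ.m≤m+n _ 0) (ℕ.≤-pred (ℕ.≤-trans (ℕ.≤-reflexive (cong suc (ℕ.+-identityʳ _))) (ℕ.≤-trans (DM.m%n<n v order) (ℕ.≤-reflexive (sym suc-order∸1)))))))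

      -- The step is f(a) z instead of z, so that f (y) = f(a) C with C a series whose coefficients
      -- are polynomials in a. No division by f(a) is needed, and at the points in question f ^ (n
      -- j) contributes only ω ^ j and a power of C.
      y : Carrier → Series
      y a = affine a (ev f a)

      C : Carrier → Series
      C a = const 𝟙 ⊞ monomial 𝟙 ⊠ eval (quotient a f) (y a)

      open Truncated M

      eval-f : ∀ a → eval f (y a) ≈ const (ev f a) ⊠ C a
      eval-f a = begin
        eval f (y a)
          ≈⟨ eval-quotient a f (y a) (monomial (ev f a)) T.refl ⟩
        const (ev f a) ⊞ monomial (ev f a) ⊠ K
          ≈⟨ T.+-congˡ {const (ev f a)} (T.*-congʳ {K} scaled) ⟩
        const (ev f a) ⊞ (const (ev f a) ⊠ monomial 𝟙) ⊠ K
          ≈⟨ T.+-cong (T.sym (T.*-identityʳ (const (ev f a)))) (T.*-assoc (const (ev f a)) (monomial 𝟙) K) ⟩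
        const (ev f a) ⊠ const 𝟙 ⊞ const (ev f a) ⊠ (monomial 𝟙 ⊠ K)
          ≈⟨ T.sym (T.distribˡ (const (ev f a)) (const 𝟙) (monomial 𝟙 ⊠ K)) ⟩
        const (ev f a) ⊠ C a ∎
        where
        open ≈-Reasoning
        K = eval (quotient a f) (y a)
        scaled : monomial (ev f a) ≈ const (ev f a) ⊠ monomial 𝟙
        scaled t _ = trans (lem t) (sym (const-⊠ (ev f a) (monomial 𝟙) t))
          where
          lem : ∀ t → monomial (ev f a) t ≡ ev f a ⊗ monomial 𝟙 t
          lem zero          = sym (zeroʳ _)
          lem (suc zero)    = sym (*-identityʳ _)
          lem (suc (suc t)) = sym (zeroʳ _)

      -- On the points with f a ^ n = ω, the expansion of b v along y a modulo z ^ M.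
      B : ℕ → Carrier → Series
      B v a = y a ^ₛ uu v ⊠ const (a ↑ ii v) ⊠ (const (ω ↑ jj v) ⊠ C a ^ₛ (n * jj v))

      eval-b : ∀ v a → ev f a ↑ n ≡ ω → eval (b v) (y a) ≈ B (toℕ v) a
      eval-b v a fω = begin
        eval (b v) Y
          ≈⟨ eval-x^ (toℕ v) (p v) Y ⟩
        Y ^ₛ toℕ v ⊠ eval (p v) Y
          ≈⟨ T.*-cong (T.trans (^ₛ-congʳ Y (split-index (toℕ v))) (T.trans (^ₛ-homo-* Y (u + n * j) (order * i)) (T.*-congʳ {Y ^ₛ (order * i)} (^ₛ-homo-* Y u (n * j))))) (eval-^ g (n * j) Y) ⟩
        Y ^ₛ u ⊠ Y ^ₛ (n * j) ⊠ Y ^ₛ (order * i) ⊠ eval g Y ^ₛ (n * j)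
          ≈⟨ solve 4 (λ A B C D → A :* B :* C :* D := A :* C :* (B :* D)) T.refl (Y ^ₛ u) (Y ^ₛ (n * j)) (Y ^ₛ (order * i)) (eval g Y ^ₛ (n * j)) ⟩
        Y ^ₛ u ⊠ Y ^ₛ (order * i) ⊠ (Y ^ₛ (n * j) ⊠ eval g Y ^ₛ (n * j))
          ≈⟨ T.*-cong (T.*-congˡ {Y ^ₛ u} frob) radical ⟩
        B (toℕ v) a ∎
        where
        open ≈-Reasoning
        Y = y a
        u = uu (toℕ v)
        j = jj (toℕ v)
        i = ii (toℕ v)
        frob : Y ^ₛ (order * i) ≈ const (a ↑ i)
        frob = begin
          Y ^ₛ (order * i) ≈⟨ T.sym (^ₛ-assocʳ Y order i) ⟩
          (Y ^ₛ order) ^ₛ i ≈⟨ ^ₛ-congˡ i (frobenius-affine M M≤q a (ev f a)) ⟩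
          const a ^ₛ i ≈⟨ T.sym (const-^ a i) ⟩
          const (a ↑ i) ∎
        radical : Y ^ₛ (n * j) ⊠ eval g Y ^ₛ (n * j) ≈ const (ω ↑ j) ⊠ C a ^ₛ (n * j)
        radical = begin
          Y ^ₛ (n * j) ⊠ eval g Y ^ₛ (n * j) ≈⟨ T.sym (^ₛ-distrib-* Y (eval g Y) (n * j)) ⟩
          (Y ⊠ eval g Y) ^ₛ (n * j) ≈⟨ ^ₛ-congˡ (n * j) (T.trans (T.sym (const0+ (Y ⊠ eval g Y))) (eval-f a)) ⟩
          (const (ev f a) ⊠ C a) ^ₛ (n * j) ≈⟨ ^ₛ-distrib-* (const (ev f a)) (C a) (n * j) ⟩
          const (ev f a) ^ₛ (n * j) ⊠ C a ^ₛ (n * j) ≈⟨ T.*-congʳ {C a ^ₛ (n * j)} (T.trans (T.sym (const-^ (ev f a) (n * j))) (λ t _ → cong (λ c → const c t) (trans (sym (^-assocʳ (ev f a) n j)) (cong (_↑ j) fω)))) ⟩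
          const (ω ↑ j) ⊠ C a ^ₛ (n * j) ∎

      deg-f : PolyFun (suc m) (ev f)
      deg-f = f , s≤s (s≤s deg) , λ _ → refl

      graded-y : IsGraded (suc m) 1 y
      graded-y = graded-+ (suc m) (graded-const (suc m) polyFun-id) (graded-weaken (suc m) {0} {1} z≤n (graded-monomial (suc m) deg-f))

      -- The factor z moves the coefficient of z ^ t of the quotient, of degree at most (t + 1) (m +
      -- 1), to index t + 1. Hence C has weight 0, and its power n j, however large, does not raise
      -- the degrees.
      graded-C : IsGraded (suc m) 0 C
      graded-C zero    = polyFun-+ (polyFun-const 𝟙) (λ-zero)
        where
        λ-zero : PolyFun 0 (λ a → (monomial 𝟙 ⊠ eval (quotient a f) (y a)) 0)
        λ-zero = [] , z≤n , λ a → zeroˡ _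
      graded-C (suc t) with graded-quotient (suc m) {suc m} f (s≤s (s≤s deg)) graded-y t
      ... | q , lq , eq = q , lq , λ a → trans (+-identityˡ _) (trans (monomial-⊠-suc 𝟙 (eval (quotient a f) (y a)) t) (trans (*-identityˡ _) (eq a)))

      polyFun-^ : ∀ i → PolyFun i (λ a → a ↑ i)
      polyFun-^ zero    = polyFun-const 𝟙
      polyFun-^ (suc i) = polyFun-* polyFun-id (polyFun-^ i)

      graded-B : ∀ v → IsGraded (suc m) (uu v * 1 + ii v + (0 + n * jj v * 0)) (B v)
      graded-B v = graded-* (suc m) (graded-* (suc m) (graded-^ (suc m) M (uu v) graded-y) (graded-const (suc m) (polyFun-^ (ii v))))
        (graded-* (suc m) (graded-const (suc m) (polyFun-const _)) (graded-^ (suc m) M (n * jj v) graded-C))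

      ii<R : ∀ (v : Fin U) → ii (toℕ v) < R
      ii<R v = DM.m<n*o⇒m/o<n (ℕ.<-≤-trans (Finₚ.toℕ<n v) (ℕ.≤-reflexive (ℕ.*-comm order R)))

      short : ∀ (v : Fin U) t → t < M → suc (uu (toℕ v) * 1 + ii (toℕ v) + (0 + n * jj (toℕ v) * 0) + t * suc m) ≤ E
      short v t t<M = ℕ.+-mono-≤ {suc (uu (toℕ v) * 1 + ii (toℕ v) + (0 + n * jj (toℕ v) * 0))} {n + R}
        (ℕ.≤-trans (ℕ.≤-reflexive (cong suc (trans (cong₂ _+_ (cong (_+ ii (toℕ v)) (ℕ.*-identityʳ (uu (toℕ v)))) (ℕ.*-zeroʳ (n * jj (toℕ v)))) (ℕ.+-identityʳ _))))
          (ℕ.+-mono-≤ (DM.m%n<n (toℕ v % order) n) (ℕ.<⇒≤ (ii<R v))))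
        (ℕ.*-monoˡ-≤ (suc m) (ℕ.<⇒≤ t<M))

      coefficients : Fin U → Fin M → Poly
      coefficients v t = proj₁ (graded-B (toℕ v) (toℕ t))

      length-coefficients : ∀ v t → length (coefficients v t) ≤ E
      length-coefficients v t = ℕ.≤-trans (proj₁ (proj₂ (graded-B (toℕ v) (toℕ t)))) (short v (toℕ t) (Finₚ.toℕ<n t))

      matrix : Fin U → Fin (M * E) → Carrier
      matrix v k = coeff (coefficients v (proj₁ (Fin.remQuot {M} E k))) (toℕ (proj₂ (Fin.remQuot {M} E k)))

      solution = kernel room matrix
      h = proj₁ solution

      equations : ∀ t e → Σᶠ.sum (λ v → h v ⊗ coeff (coefficients v t) (toℕ e)) ≡ 𝟘
      equations t e = trans (Σᶠ.sum-cong-≗ {U} (λ v → cong (λ te → h v ⊗ coeff (coefficients v (proj₁ te)) (toℕ (proj₂ te))) (sym (Finₚ.remQuot-combine t e))))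
        (proj₂ (proj₂ solution) (Fin.combine t e))

      P : Poly
      P = sumₚ h b

      P-vanishes : ∀ a → ev f a ↑ n ≡ ω → VanishesTo M P a (ev f a)
      P-vanishes a fω t t<M = begin
        eval P (y a) t
          ≡⟨ eval-sumₚ h b (y a) t ⟩
        Σᶠ.sum {U} (λ v → h v ⊗ eval (b v) (y a) t)
          ≡⟨ Σᶠ.sum-cong-≗ {U} (λ v → cong (h v ⊗_) (expand v)) ⟩
        Σᶠ.sum {U} (λ v → h v ⊗ Σᶠ.sum {E} (λ e → coeff (coefficients v t′) (toℕ e) ⊗ a ↑ toℕ e))
          ≡⟨ Σᶠ.sum-cong-≗ {U} (λ v → Σᶠ.*-distribˡ-sum {E} (h v) (λ e → coeff (coefficients v t′) (toℕ e) ⊗ a ↑ toℕ e)) ⟩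
        Σᶠ.sum {U} (λ v → Σᶠ.sum {E} (λ e → h v ⊗ (coeff (coefficients v t′) (toℕ e) ⊗ a ↑ toℕ e)))
          ≡⟨ Σᶠ.∑-comm {U} {E} (λ v e → h v ⊗ (coeff (coefficients v t′) (toℕ e) ⊗ a ↑ toℕ e)) ⟩
        Σᶠ.sum {E} (λ e → Σᶠ.sum {U} (λ v → h v ⊗ (coeff (coefficients v t′) (toℕ e) ⊗ a ↑ toℕ e)))
          ≡⟨ Σᶠ.sum-cong-≗ {E} (λ e → trans (Σᶠ.sum-cong-≗ {U} (λ v → sym (*-assoc _ _ _)))
               (trans (sym (Σᶠ.*-distribʳ-sum {U} (a ↑ toℕ e) (λ v → h v ⊗ coeff (coefficients v t′) (toℕ e)))) (trans (cong (_⊗ a ↑ toℕ e) (equations t′ e)) (zeroˡ _)))) ⟩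
        Σᶠ.sum {E} (λ e → 𝟘)
          ≡⟨ Σᶠ.sum-replicate-zero E ⟩
        𝟘 ∎
        where
        open ≡-Reasoning
        t′ = Fin.fromℕ< t<M
        expand : ∀ v → eval (b v) (y a) t ≡ Σᶠ.sum {E} (λ e → coeff (coefficients v t′) (toℕ e) ⊗ a ↑ toℕ e)
        expand v = trans (eval-b v a fω t t<M) (trans (cong (B (toℕ v) a) (sym (Finₚ.toℕ-fromℕ< t<M)))
          (trans (proj₂ (proj₂ (graded-B (toℕ v) (toℕ t′))) a) (ev-as-sum E (coefficients v t′) a (length-coefficients v t′))))

      length-P : length P ≤ order * (R + m)
      length-P = length-sumₚ h b (λ v → ℕ.≤-trans (ℕ.≤-reflexive (length-x^ (toℕ v) (p v)))
        (ℕ.≤-trans (ℕ.+-monoʳ-≤ (toℕ v) (length-^ₚ g (n * jj (toℕ v)) (s≤s deg)))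
        (ℕ.≤-trans (ℕ.≤-reflexive (ℕ.+-suc (toℕ v) _))
        (ℕ.≤-trans (ℕ.+-mono-≤ (Finₚ.toℕ<n v) (ℕ.*-monoˡ-≤ m (ℕ.≤-trans (jj≤d (toℕ v)) (ℕ.m∸n≤m order 1))))
        (ℕ.≤-reflexive (sym (ℕ.*-distribˡ-+ order R m)))))))

    -- With more points than this, P would have too many zeros and be the zero polynomial, so the
    -- independence of the `b v` would force h = 0.
    stepanov : ∀ (ds : List Carrier) → AllPairs _≢_ ds → All (λ a → ev f a ↑ n ≡ ω) ds → length ds * M < order * (R + m)
    stepanov ds dist roots = ℕ.≰⇒> (λ le → proj₂ (proj₁ (proj₂ solution))
      (triangular-independent h p (λ v e → ↑-nonzero (n * jj (toℕ v)) g₀≢0 (trans (cong (_↑ (n * jj (toℕ v))) (sym (ev-at-zero g))) (trans (sym (ev-^ g (n * jj (toℕ v)) 𝟘)) (trans (ev-at-zero (p v)) e))))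
        (vanishing-bound M ds P dist (All.map (λ {a} fω → ev f a , nonroot a fω , P-vanishes a fω) roots) (ℕ.≤-trans length-P le)) _))
      where
      nonroot : ∀ a → ev f a ↑ n ≡ ω → ev f a ≢ 𝟘
      nonroot a fω z = ω≢0 (trans (sym fω) (trans (cong (_↑ n) z) (𝟘↑ n)))

-- Decidable subsets of the field and their cardinalities.

module Counting (F : FiniteField) where
  open FieldBasics F
  open Frobenius F using (elements; distinct-elements)
  open Sumℕ

  members : ∀ {p} {P : Pred Carrier p} → Decidable P → List Carrier
  members P? = filter P? elements

  members-distinct : ∀ {p} {P : Pred Carrier p} (P? : Decidable P) → AllPairs _≢_ (members P?)
  members-distinct P? = AllPairsₚ.filter⁺ P? distinct-elements

  members-satisfy : ∀ {p} {P : Pred Carrier p} (P? : Decidable P) → All P (members P?)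
  members-satisfy P? = Allₚ.all-filter P? elements

  ∈-members : ∀ {p} {P : Pred Carrier p} (P? : Decidable P) {x} → P x → Any (x ≡_) (members P?)
  ∈-members P? {x} px = ∈-filter⁺ P? (subst (_∈ elements) (elem-index x) (∈-map⁺ elem (∈-allFin (index x)))) px

  length-members : ∀ {p} {P : Pred Carrier p} (P? : Decidable P) → length (members P?) ≡ ∑ (λ x → 𝟏 (P? x))
  length-members P? = trans (cong (λ l → length (filter P? l)) (Listₚ.map-tabulate {n = order} (λ i → i) elem)) (go elem)
    where
    go : ∀ {n} (f : Fin n → Carrier) → length (filter P? (tabulate f)) ≡ sum (λ i → 𝟏 (P? (f i)))
    go {zero}  f = refl
    go {suc n} f with P? (f zero)
    ... | yes _ = cong suc (go (f ∘ suc))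
    ... | no _  = go (f ∘ suc)

  any? : ∀ {p} {P : Pred Carrier p} → Decidable P → Dec (∃ P)
  any? {P = P} P? with Finₚ.any? (P? ∘ elem)
  ... | yes (i , p) = yes (elem i , p)
  ... | no ¬p       = no (λ (x , p) → ¬p (index x , subst P (sym (elem-index x)) p))

  ∑-unique : ∀ {p} {P : Pred Carrier p} (P? : Decidable P) → (∀ x y → P x → P y → x ≡ y) → ∑ (λ x → 𝟏 (P? x)) ≤ 1
  ∑-unique P? unique with any? P?
  ... | yes (a , pa) = ℕ.≤-trans (∑-mono (λ x → 𝟏-mono (P? x) (x ≟ a) (λ px → unique x a px pa))) (ℕ.≤-reflexive (∑-indicator a))
  ... | no ¬p        = ℕ.≤-trans (ℕ.≤-reflexive (trans (∑-cong (λ x → 𝟏-no (P? x) (λ px → ¬p (x , px)))) (trans (∑-const 0) (ℕ.*-zeroʳ order)))) z≤n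

-- Stepanov's bound with its parameters chosen.

module Radical (F : FiniteField) where
  open FieldBasics F
  open FieldPowers F
  open Polynomials F
  open Stepanov F
  open Counting F
  open Sumℕ

  private
    -- The condition `room` multiplied by d, with X = d R. The summands of q X = q s + q r + q d D +
    -- q d pay, in this order, for s (d n), s s, s s d D and the remaining s (d (D + 1) + r). The
    -- last payment needs D + 2 ≤ s.
    room-arithmetic : ∀ d n s r X q D → s * s ≤ q → D + 2 ≤ s → 1 ≤ r → r ≤ d → q ≡ suc (d * n) → X ≡ s + r + d * (D + 1) →
                      s * (d * n) + s * X + s * s * (d * D) < q * X
    room-arithmetic d n s r X q D ss≤q D+2≤s 1≤r r≤d eq refl = begin-strict
      s * (d * n) + s * X + s * s * (d * D)
        <⟨ ℕ.m<m+n _ {s} (ℕ.≤-trans (s≤s z≤n) (ℕ.≤-trans (ℕ.m≤n+m 2 D) D+2≤s)) ⟩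
      s * (d * n) + s * (s + r + d * (D + 1)) + s * s * (d * D) + s
        ≡⟨ lem₁ d n s r D ⟩
      s * suc (d * n) + s * s * 1 + s * s * (d * D) + (s * (d * (D + 1)) + s * r)
        ≡⟨ cong (λ z → s * z + s * s * 1 + s * s * (d * D) + (s * (d * (D + 1)) + s * r)) (sym eq) ⟩
      s * q + s * s * 1 + s * s * (d * D) + (s * (d * (D + 1)) + s * r)
        ≤⟨ ℕ.+-mono-≤ (ℕ.+-mono-≤ (ℕ.+-mono-≤ (ℕ.≤-reflexive (ℕ.*-comm s q)) (ℕ.*-mono-≤ ss≤q 1≤r)) (ℕ.*-monoˡ-≤ (d * D) ss≤q)) last ⟩
      q * s + q * r + q * (d * D) + q * d
        ≡⟨ lem₂ d s r q D ⟩
      q * (s + r + d * (D + 1)) ∎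
      where
      open ℕ.≤-Reasoning
      lem₁ : ∀ d n s r D → s * (d * n) + s * (s + r + d * (D + 1)) + s * s * (d * D) + s ≡ s * suc (d * n) + s * s * 1 + s * s * (d * D) + (s * (d * (D + 1)) + s * r)
      lem₁ = solve-∀
      lem₂ : ∀ d s r q D → q * s + q * r + q * (d * D) + q * d ≡ q * (s + r + d * (D + 1))
      lem₂ = solve-∀
      lem₃ : ∀ d s D → s * (d * (D + 1)) + s * d ≡ s * (D + 2) * d
      lem₃ = solve-∀
      last : s * (d * (D + 1)) + s * r ≤ q * d
      last = begin
        s * (d * (D + 1)) + s * r ≤⟨ ℕ.+-monoʳ-≤ (s * (d * (D + 1))) (ℕ.*-monoʳ-≤ s r≤d) ⟩
        s * (d * (D + 1)) + s * d ≡⟨ lem₃ d s D ⟩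
        s * (D + 2) * d ≤⟨ ℕ.*-monoˡ-≤ d (ℕ.≤-trans (ℕ.*-monoʳ-≤ s D+2≤s) ss≤q) ⟩
        q * d ∎

    conclusion-arithmetic : ∀ d n s t q D L → q ≡ suc (d * n) → d * t ≤ s → t ≤ s → q ≤ s * (s + 2) → L * s < q * (t + (2 * D + 1)) → L ≤ n + (s + 2) * (2 * D + 1)
    conclusion-arithmetic d n s t q D L eq dt≤s t≤s q≤ lt = ℕ.≤-pred (ℕ.*-cancelʳ-< s L (suc (n + (s + 2) * (2 * D + 1))) (begin-strict
      L * s <⟨ lt ⟩
      q * (t + (2 * D + 1)) ≡⟨ ℕ.*-distribˡ-+ q t (2 * D + 1) ⟩
      q * t + q * (2 * D + 1) ≡⟨ cong (λ z → z * t + q * (2 * D + 1)) eq ⟩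
      suc (d * n) * t + q * (2 * D + 1) ≡⟨ cong (_+ q * (2 * D + 1)) (lem₁ d n t) ⟩
      n * (d * t) + t + q * (2 * D + 1) ≤⟨ ℕ.+-mono-≤ (ℕ.+-mono-≤ (ℕ.*-monoʳ-≤ n dt≤s) t≤s) (ℕ.*-monoˡ-≤ (2 * D + 1) q≤) ⟩
      n * s + s + s * (s + 2) * (2 * D + 1) ≡⟨ lem₂ n s (2 * D + 1) ⟩
      suc (n + (s + 2) * (2 * D + 1)) * s ∎))
      where
      open ℕ.≤-Reasoning
      lem₁ : ∀ d n t → suc (d * n) * t ≡ n * (d * t) + t
      lem₁ = solve-∀
      lem₂ : ∀ n s k → n * s + s + s * (s + 2) * k ≡ suc (n + (s + 2) * k) * s
      lem₂ = solve-∀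

  stepanov-count : ∀ {d n s D} → d * n ≡ order ∸ 1 → s * s ≤ order → order ≤ s * (s + 2) → D + 2 ≤ s →
                   ∀ g → ev g 𝟘 ≢ 𝟘 → length g ≤ D → ∀ ω → ω ≢ 𝟘 →
                   ∑ (λ x → 𝟏 ((x ⊗ ev g x) ↑ n ≟ ω)) ≤ n + (s + 2) * (2 * D + 1)
  stepanov-count dn ss≤q q≤ D+2≤s [] g0≢0 len ω ω≢0 = ⊥-elim (g0≢0 refl)
  stepanov-count {d} {n} {s} {suc m} dn ss≤q q≤ D+2≤s (g₀ ∷ g′) g0≢0 (s≤s len) ω ω≢0 =
    ℕ.≤-trans (ℕ.≤-reflexive (trans (∑-cong (λ x → 𝟏-cong ((x ⊗ ev (g₀ ∷ g′) x) ↑ n ≟ ω) (P? x) (trans (cong (_↑ n) (+-identityˡ _))) (trans (cong (_↑ n) (sym (+-identityˡ _)))))) (sym (length-members P?))))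
      (conclusion-arithmetic d n s (s / d) order D (length (members P?)) q≡ dt≤s t≤s q≤
        (subst (λ z → length (members P?) * s < order * z) (shape (s / d) m)
          (stepanov {d} {n} dn g₀ (λ e → g0≢0 (trans (ev-at-zero (g₀ ∷ g′)) e)) g′ len ω ω≢0 s R s≤q room (members P?) (members-distinct P?) (members-satisfy P?))))
    where
    D = suc m
    q≡ : order ≡ suc (d * n)
    q≡ = trans (sym suc-order∸1) (cong suc (sym dn))
    dn≢0 : d * n ≢ 0
    dn≢0 e = ℕ.<⇒≢ 1<order (sym (trans q≡ (cong suc e)))
    instance
      d≢0 : NonZero d
      d≢0 = ℕ.≢-nonZero (λ e → dn≢0 (cong (_* n) e))
      n≢0 : NonZero n
      n≢0 = ℕ.≢-nonZero (λ e → dn≢0 (trans (cong (d *_) e) (ℕ.*-zeroʳ d)))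
      q≢0 : NonZero order
      q≢0 = ℕ.>-nonZero (ℕ.<⇒≤ 1<order)
      s≢0 : NonZero s
      s≢0 = ℕ.>-nonZero (ℕ.≤-trans (s≤s z≤n) (ℕ.≤-trans (ℕ.m≤n+m 2 D) D+2≤s))
    P? : Decidable (λ x → ev (𝟘 ∷ g₀ ∷ g′) x ↑ n ≡ ω)
    P? x = ev (𝟘 ∷ g₀ ∷ g′) x ↑ n ≟ ω
    -- The order of vanishing is s, about √q. In q R the part s / d balances s n, the part D
    -- balances s s D, and the 2 absorbs rounding and lower-order terms.
    R = s / d + (D + 2)
    s≤q : s ≤ order
    s≤q = ℕ.≤-trans (ℕ.m≤m*n s s) ss≤q
    dt≤s : d * (s / d) ≤ s
    dt≤s = ℕ.≤-trans (ℕ.≤-reflexive (ℕ.*-comm d (s / d))) (DM.m/n*n≤m s d)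
    t≤s : s / d ≤ s
    t≤s = DM.m/n≤m s d
    shape : ∀ t m → t + (suc m + 2) + m ≡ t + (2 * suc m + 1)
    shape = solve-∀
    -- What s lacks to the next multiple of d, between 1 and d. It expresses d R without a division.
    r = d ∸ s % d
    r+ : s % d + r ≡ d
    r+ = ℕ.m+[n∸m]≡n (ℕ.<⇒≤ (DM.m%n<n s d))
    dR : d * R ≡ s + r + d * (D + 1)
    dR = begin
      d * (s / d + (D + 2)) ≡⟨ lem₁ d (s / d) D ⟩
      s / d * d + d + d * (D + 1) ≡⟨ cong (λ z → s / d * d + z + d * (D + 1)) (sym r+) ⟩
      s / d * d + (s % d + r) + d * (D + 1) ≡⟨ lem₂ (s / d * d) (s % d) r (d * (D + 1)) ⟩
      s % d + s / d * d + r + d * (D + 1) ≡⟨ cong (λ z → z + r + d * (D + 1)) (sym (DM.m≡m%n+[m/n]*n s d)) ⟩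
      s + r + d * (D + 1) ∎
      where
      open ≡-Reasoning
      lem₁ : ∀ d t D → d * (t + (D + 2)) ≡ t * d + d + d * (D + 1)
      lem₁ = solve-∀
      lem₂ : ∀ a b c e → a + (b + c) + e ≡ b + a + c + e
      lem₂ = solve-∀
    room : s * (n + R + s * D) < order * R
    room = ℕ.*-cancelˡ-< d _ _ (begin-strict
      d * (s * (n + R + s * D)) ≡⟨ lem₁ d s n R D ⟩
      s * (d * n) + s * (d * R) + s * s * (d * D) <⟨ room-arithmetic d n s r (d * R) order D ss≤q D+2≤s (ℕ.m<n⇒0<n∸m (DM.m%n<n s d)) (ℕ.m∸n≤m d (s % d)) q≡ dR ⟩
      order * (d * R) ≡⟨ lem₂ order d R ⟩
      d * (order * R) ∎)
      where
      open ℕ.≤-Reasoning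
      lem₁ : ∀ d s n R D → d * (s * (n + R + s * D)) ≡ s * (d * n) + s * (d * R) + s * s * (d * D)
      lem₁ = solve-∀
      lem₂ : ∀ q d R → q * (d * R) ≡ d * (q * R)
      lem₂ = solve-∀

-- Roots of unity of prime order.

module RootsOfUnity (F : FiniteField) where
  open FieldBasics F
  open FieldPowers F
  open Polynomials F
  open PowerSeries F
  open Stepanov F
  open Counting F

  roots-bound : ∀ k → 1 ≤ k → ∀ c ds → AllPairs _≢_ ds → All (λ x → x ↑ k ≡ c) ds → length ds ≤ k
  roots-bound (suc k) _ c ds dist roots = ℕ.≮⇒≥ (λ k< → 1≢0 (trans (sym (coeff-x^-at k (𝟙 ∷ [])))
      (vanishing-bound 1 ds p dist (All.map (λ {a} e → 𝟙 , 1≢0 , v a e) roots)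
        (ℕ.≤-trans (ℕ.≤-reflexive (trans (cong suc (length-x^ k (𝟙 ∷ []))) (cong suc (ℕ.+-comm k 1)))) (ℕ.≤-trans k< (ℕ.≤-reflexive (sym (ℕ.*-identityʳ _))))) (suc k))))
    where
    p : Poly
    p = ⊖ c ∷ x^ k · (𝟙 ∷ [])
    ev-x^ : ∀ k a → ev (x^ k · (𝟙 ∷ [])) a ≡ a ↑ k
    ev-x^ zero    a = trans (cong (𝟙 ⊕_) (zeroʳ a)) (+-identityʳ 𝟙)
    ev-x^ (suc k) a = trans (+-identityˡ _) (cong (a ⊗_) (ev-x^ k a))
    v : ∀ a → a ↑ suc k ≡ c → VanishesTo 1 p a 𝟙
    v a e zero _ = trans (eval-zero p (affine a 𝟙)) (trans (cong (ev p) (affine-zero a 𝟙)) (trans (cong (⊖ c ⊕_) (trans (cong (a ⊗_) (ev-x^ k a)) e)) (-‿inverseˡ c)))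
    v a e (suc t) (s≤s ())

  module _ {r} (pr : Prime r) {ρ} (ρ≢1 : ρ ≢ 𝟙) (ρʳ : ρ ↑ r ≡ 𝟙) where

    private
      ρ≢0 : ρ ≢ 𝟘
      ρ≢0 e = 1≢0 (trans (sym ρʳ) (trans (cong (_↑ r) e) (𝟘↑ r)))
        where
        instance
          r≢0 : NonZero r
          r≢0 = prime⇒nonZero pr

      power-multiple : ∀ {k} → ρ ↑ k ≡ 𝟙 → ∀ x → ρ ↑ (x * k) ≡ 𝟙
      power-multiple {k} e x = trans (cong (ρ ↑_) (ℕ.*-comm x k)) (trans (sym (^-assocʳ ρ k x)) (trans (cong (_↑ x) e) (↑-one x)))

      -- Since r is prime, a Bézout identity between k and r would turn ρ ^ k = ρ ^ r = 1 into ρ =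
      -- 1.
      no-smaller : ∀ k → 0 < k → k < r → ρ ↑ k ≢ 𝟙
      no-smaller k@(suc _) 0<k k<r e with coprime-Bézout (prime⇒coprime pr k<r)
      ... | Bézout.+- x y eq = ρ≢1 (trans (sym (trans (cong (ρ ⊗_) (power-multiple e y)) (*-identityʳ ρ))) (trans (cong (ρ ↑_) eq) (power-multiple ρʳ x)))
      ... | Bézout.-+ x y eq = ρ≢1 (trans (sym (trans (cong (ρ ⊗_) (power-multiple ρʳ x)) (*-identityʳ ρ))) (trans (cong (ρ ↑_) eq) (power-multiple e y)))

      distinct-below : ∀ i j → i < j → j < r → ρ ↑ i ≢ ρ ↑ j
      distinct-below i j i<j j<r e = no-smaller (j ∸ i) (ℕ.m<n⇒0<n∸m i<j) (ℕ.≤-<-trans (ℕ.m∸n≤m j i) j<r)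
        (⊗-cancelˡ (↑-nonzero i ρ≢0) (trans (sym (^-homo-* ρ i (j ∸ i))) (trans (cong (ρ ↑_) (ℕ.m+[n∸m]≡n (ℕ.<⇒≤ i<j))) (trans (sym e) (sym (*-identityʳ _))))))

      powers : List Carrier
      powers = tabulate {n = r} (λ i → ρ ↑ toℕ i)

      powers-distinct : AllPairs _≢_ powers
      powers-distinct = AllPairsₚ.tabulate⁺ distinct
        where
        distinct : ∀ {i j : Fin r} → i ≢ j → ρ ↑ toℕ i ≢ ρ ↑ toℕ j
        distinct {i} {j} i≢j with ℕ.<-cmp (toℕ i) (toℕ j)
        ... | tri< lt _ _ = distinct-below (toℕ i) (toℕ j) lt (Finₚ.toℕ<n j)
        ... | tri≈ _ eq _ = ⊥-elim (i≢j (Finₚ.toℕ-injective eq))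
        ... | tri> _ _ gt = λ e → distinct-below (toℕ j) (toℕ i) gt (Finₚ.toℕ<n i) (sym e)

    -- The powers of ρ below r are r distinct roots of x ^ r = 1, so there is no room for another
    -- root.
    generates : ∀ ζ → ζ ↑ r ≡ 𝟙 → ∃ λ (b : Fin r) → ρ ↑ toℕ b ≡ ζ
    generates ζ ζʳ with Finₚ.any? (λ (b : Fin r) → ρ ↑ toℕ b ≟ ζ)
    ... | yes found = found
    ... | no ¬found = ⊥-elim (ℕ.1+n≰n (subst (λ l → suc l ≤ r) (Listₚ.length-tabulate {n = r} (λ i → ρ ↑ toℕ i))
          (roots-bound r (ℕ.>-nonZero⁻¹ r) 𝟙 (ζ ∷ powers) (Allₚ.tabulate⁺ (λ i e → ¬found (i , sym e)) ∷ powers-distinct)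
            (ζʳ ∷ Allₚ.tabulate⁺ (λ i → trans (^-assocʳ ρ (toℕ i) r) (power-multiple ρʳ (toℕ i)))))))
      where
      instance
        r≢0 : NonZero r
        r≢0 = prime⇒nonZero pr

-- Averaging over exponents in place of orthogonality of characters.

module Recursion (F : FiniteField) where
  open FieldBasics F
  open FieldPowers F
  open Polynomials F
  open Counting F
  open Radical F
  open RootsOfUnity F
  open Sumℕ

  -- Number of exponent vectors b below r with ρ₁ ^ b₁ ⋯ ρₖ ^ bₖ τ = ω.
  solutions : ℕ → List Carrier → Carrier → Carrier → ℕ
  solutions r []       τ ω = 𝟏 (τ ≟ ω)
  solutions r (ρ ∷ ρs) τ ω = sum {r} (λ b → solutions r ρs (ρ ↑ toℕ b ⊗ τ) ω)

  solutions-trivial : ∀ r {ρs τ ω} → All (_≡ 𝟙) ρs → τ ≡ ω → solutions r ρs τ ω ≡ r ^ length ρs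
  solutions-trivial r [] e = 𝟏-yes _ e
  solutions-trivial r {ρ ∷ ρs} {τ} {ω} (ρ1 ∷ ones) e = trans
    (sum-cong-≗ {r} (λ b → solutions-trivial r ones (trans (cong (_⊗ τ) (trans (cong (_↑ toℕ b) ρ1) (↑-one (toℕ b)))) (trans (*-identityˡ τ) e))))
    (sum-const r (r ^ length ρs))

  ρ^r-scaled : ∀ r {ρ τ ω} b → ρ ↑ r ≡ 𝟙 → τ ↑ r ≡ ω ↑ r → (ρ ↑ b ⊗ τ) ↑ r ≡ ω ↑ r
  ρ^r-scaled r {ρ} {τ} b e eτ = trans (^-distrib-* (ρ ↑ b) τ r) (trans (cong₂ _⊗_
    (trans (^-assocʳ ρ b r) (trans (cong (ρ ↑_) (ℕ.*-comm b r)) (trans (sym (^-assocʳ ρ r b)) (trans (cong (_↑ b) e) (↑-one b))))) eτ) (*-identityˡ _))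

  -- If some ρ is non-trivial, its powers carry τ to every element with the r-th power of ω, so at
  -- least one r-th of the exponent vectors hits ω. Together with `solutions-trivial` this is
  -- orthogonality in counting form.
  solutions-lower : ∀ {r} → Prime r → ∀ {ρs τ ω} → ω ≢ 𝟘 → All (λ ρ → ρ ↑ r ≡ 𝟙) ρs → τ ↑ r ≡ ω ↑ r → ¬ All (_≡ 𝟙) ρs →
                    r ^ length ρs ≤ r * solutions r ρs τ ω
  solutions-lower pr {[]} ω≢0 _ _ ¬ones = ⊥-elim (¬ones [])
  solutions-lower {r} pr {ρ ∷ ρs} {τ} {ω} ω≢0 (ρr ∷ ρsr) eτ ¬ones with All.all? (_≟ 𝟙) ρs
  ... | no ¬ones′ = begin
    r * r ^ length ρs ≡⟨ sym (sum-const r _) ⟩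
    sum {r} (λ b → r ^ length ρs) ≤⟨ sum-mono {r} (λ b → solutions-lower pr ω≢0 ρsr (ρ^r-scaled r (toℕ b) ρr eτ) ¬ones′) ⟩
    sum {r} (λ b → r * solutions r ρs (ρ ↑ toℕ b ⊗ τ) ω) ≡⟨ sym (*-distribˡ-sum {r} r (λ b → solutions r ρs (ρ ↑ toℕ b ⊗ τ) ω)) ⟩
    r * solutions r (ρ ∷ ρs) τ ω ∎
    where open ℕ.≤-Reasoning
  ... | yes ones = ℕ.*-monoʳ-≤ r (ℕ.≤-trans (ℕ.≤-reflexive (sym (solutions-trivial r ones hit)))
                     (term≤sum (λ (b : Fin r) → solutions r ρs (ρ ↑ toℕ b ⊗ τ) ω) (proj₁ found)))
    where
    instance
      r≢0 : NonZero r
      r≢0 = prime⇒nonZero pr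
    τ≢0 : τ ≢ 𝟘
    τ≢0 z = ↑-nonzero r ω≢0 (trans (sym eτ) (trans (cong (_↑ r) z) (𝟘↑ r)))
    ζ = inv τ τ≢0 ⊗ ω
    ζʳ : ζ ↑ r ≡ 𝟙
    ζʳ = trans (^-distrib-* (inv τ τ≢0) ω r) (trans (cong (inv τ τ≢0 ↑ r ⊗_) (sym eτ)) (trans (sym (^-distrib-* (inv τ τ≢0) τ r))
           (trans (cong (_↑ r) (trans (*-comm _ τ) (inv-r τ τ≢0))) (↑-one r))))
    found = generates pr (λ e → ¬ones (e ∷ ones)) ρr ζ ζʳ
    hit : ρ ↑ toℕ (proj₁ found) ⊗ τ ≡ ω
    hit = trans (cong (_⊗ τ) (proj₂ found)) (trans (*-comm ζ τ) (trans (sym (*-assoc τ _ ω)) (trans (cong (_⊗ ω) (inv-r τ τ≢0)) (*-identityˡ ω))))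

  Form : Poly → Set
  Form ℓ = ∃ λ δ → ∃ λ γ → δ ≢ 𝟘 × ℓ ≡ δ ∷ γ ∷ []

  ev-form : ∀ δ γ x → ev (δ ∷ γ ∷ []) x ≡ δ ⊕ x ⊗ γ
  ev-form δ γ x = cong (λ z → δ ⊕ x ⊗ z) (trans (cong (γ ⊕_) (zeroʳ x)) (+-identityʳ γ))

  form-at-zero : ∀ {ℓ} → Form ℓ → ev ℓ 𝟘 ≢ 𝟘
  form-at-zero (δ , γ , δ≢0 , refl) e = δ≢0 (trans (sym (ev-at-zero (δ ∷ γ ∷ []))) e)

  form-length : ∀ {ℓ} → Form ℓ → length ℓ ≤ 2
  form-length (δ , γ , δ≢0 , refl) = ℕ.≤-refl

  form-root : ∀ {ℓ} → Form ℓ → ∀ x y → ev ℓ x ≡ 𝟘 → ev ℓ y ≡ 𝟘 → x ≡ y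
  form-root (δ , γ , δ≢0 , refl) x y ex ey = ⊗-cancelˡ γ≢0 (⊕-cancelʳ δ (trans (swap x) (trans ex (trans (sym ey) (sym (swap y))))))
    where
    swap : ∀ z → γ ⊗ z ⊕ δ ≡ ev (δ ∷ γ ∷ []) z
    swap z = trans (+-comm _ δ) (trans (cong (δ ⊕_) (*-comm γ z)) (sym (ev-form δ γ z)))
    γ≢0 : γ ≢ 𝟘
    γ≢0 refl = δ≢0 (trans (sym (trans (ev-form δ 𝟘 x) (trans (cong (δ ⊕_) (zeroʳ x)) (+-identityʳ δ)))) ex)

  module _ {r m n s D} (pr : Prime r) (rmn : r * m * n ≡ order ∸ 1) (ss≤q : s * s ≤ order) (q≤ : order ≤ s * (s + 2)) (D+2≤s : D + 2 ≤ s)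
           {ω} (ω≢0 : ω ≢ 𝟘) where

    private
      bound : ℕ
      bound = n + (s + 2) * (2 * D + 1)

      ρs : List Poly → Carrier → List Carrier
      ρs ls x = map (λ ℓ → ev ℓ x ↑ (m * n)) ls

      -- Since m n b = (m b) n, the power of ℓ can be drawn under the exponent n. The result is
      -- again the n-th power of x times a polynomial, as Stepanov's bound requires, and the degree
      -- grows by at most m b.
      absorb : ∀ ℓ g b x → (ev ℓ x ↑ (m * n)) ↑ b ⊗ (x ⊗ ev g x) ↑ n ≡ (x ⊗ ev (ℓ ^ₚ (m * b) *ₚ g) x) ↑ n
      absorb ℓ g b x = begin
        (ev ℓ x ↑ (m * n)) ↑ b ⊗ (x ⊗ ev g x) ↑ n ≡⟨ cong (_⊗ (x ⊗ ev g x) ↑ n) (trans (^-assocʳ (ev ℓ x) (m * n) b) (trans (cong (ev ℓ x ↑_) (lem m n b)) (sym (^-assocʳ (ev ℓ x) (m * b) n)))) ⟩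
        (ev ℓ x ↑ (m * b)) ↑ n ⊗ (x ⊗ ev g x) ↑ n ≡⟨ sym (^-distrib-* _ _ n) ⟩
        (ev ℓ x ↑ (m * b) ⊗ (x ⊗ ev g x)) ↑ n ≡⟨ cong (_↑ n) (trans (sym (*-assoc _ x _)) (trans (cong (_⊗ ev g x) (*-comm _ x)) (*-assoc x _ _))) ⟩
        (x ⊗ (ev ℓ x ↑ (m * b) ⊗ ev g x)) ↑ n ≡⟨ cong (λ z → (x ⊗ z) ↑ n) (sym (trans (ev-* (ℓ ^ₚ (m * b)) g x) (cong (_⊗ ev g x) (ev-^ ℓ (m * b) x)))) ⟩
        (x ⊗ ev (ℓ ^ₚ (m * b) *ₚ g) x) ↑ n ∎
        where
        open ≡-Reasoning
        lem : ∀ m n b → m * n * b ≡ m * b * n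
        lem = solve-∀

      solutions-upper : ∀ ls g e → All Form ls → ev g 𝟘 ≢ 𝟘 → length g ≤ suc e → suc e + length ls * (m * r) ≤ D →
                        ∑ (λ x → solutions r (ρs ls x) ((x ⊗ ev g x) ↑ n) ω) ≤ r ^ length ls * bound
      solutions-upper [] g e _ g0 lg le = ℕ.≤-trans (stepanov-count {r * m} {n} {s} {D} rmn ss≤q q≤ D+2≤s g g0 (ℕ.≤-trans lg (ℕ.≤-trans (ℕ.m≤m+n (suc e) 0) le)) ω ω≢0)
        (ℕ.≤-reflexive (sym (ℕ.*-identityˡ bound)))
      solutions-upper (ℓ ∷ ls) g e (fℓ ∷ fs) g0 lg le = begin
        ∑ (λ x → sum {r} (λ b → solutions r (ρs ls x) ((ev ℓ x ↑ (m * n)) ↑ toℕ b ⊗ (x ⊗ ev g x) ↑ n) ω))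
          ≡⟨ ∑-sum-swap {r} (λ x b → solutions r (ρs ls x) ((ev ℓ x ↑ (m * n)) ↑ toℕ b ⊗ (x ⊗ ev g x) ↑ n) ω) ⟩
        sum {r} (λ b → ∑ (λ x → solutions r (ρs ls x) ((ev ℓ x ↑ (m * n)) ↑ toℕ b ⊗ (x ⊗ ev g x) ↑ n) ω))
          ≤⟨ sum-mono {r} each ⟩
        sum {r} (λ b → r ^ length ls * bound)
          ≡⟨ sum-const r _ ⟩
        r * (r ^ length ls * bound)
          ≡⟨ sym (ℕ.*-assoc r (r ^ length ls) bound) ⟩
        r ^ length (ℓ ∷ ls) * bound ∎
        where
        open ℕ.≤-Reasoning
        each : ∀ (b : Fin r) → ∑ (λ x → solutions r (ρs ls x) ((ev ℓ x ↑ (m * n)) ↑ toℕ b ⊗ (x ⊗ ev g x) ↑ n) ω) ≤ r ^ length ls * bound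
        each b = ℕ.≤-trans (ℕ.≤-reflexive (∑-cong (λ x → cong (λ τ → solutions r (ρs ls x) τ ω) (absorb ℓ g (toℕ b) x))))
          (solutions-upper ls g′ (m * toℕ b * 1 + e) fs
            (λ z → ⊗-nonzero (↑-nonzero (m * toℕ b) (form-at-zero fℓ)) g0 (trans (sym (trans (ev-* (ℓ ^ₚ (m * toℕ b)) g 𝟘) (cong (_⊗ ev g 𝟘) (ev-^ ℓ (m * toℕ b) 𝟘)))) z))
            (length-*ₚ {m * toℕ b * 1} {e} (ℓ ^ₚ (m * toℕ b)) g (length-^ₚ ℓ (m * toℕ b) (form-length fℓ)) lg)
            (begin
              suc (m * toℕ b * 1 + e) + length ls * (m * r) ≡⟨ lem (m * toℕ b) e (length ls * (m * r)) ⟩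
              suc e + (m * toℕ b + length ls * (m * r)) ≤⟨ ℕ.+-monoʳ-≤ (suc e) (ℕ.+-monoˡ-≤ (length ls * (m * r)) (ℕ.*-monoʳ-≤ m (ℕ.<⇒≤ (Finₚ.toℕ<n b)))) ⟩
              suc e + (m * r + length ls * (m * r)) ≤⟨ le ⟩
              D ∎))
          where
          g′ = ℓ ^ₚ (m * toℕ b) *ₚ g
          lem : ∀ a e c → suc (a * 1 + e) + c ≡ suc e + (a + c)
          lem = solve-∀

      zeros : List Poly → Carrier → ℕ
      zeros []       x = 0
      zeros (ℓ ∷ ls) x = 𝟏 (ev ℓ x ≟ 𝟘) + zeros ls x

      zeros-bound : ∀ {ls} → All Form ls → ∑ (zeros ls) ≤ length ls
      zeros-bound []       = ℕ.≤-reflexive (trans (∑-const 0) (ℕ.*-zeroʳ order))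
      zeros-bound {ℓ ∷ ls} (fℓ ∷ fs) = ℕ.≤-trans (ℕ.≤-reflexive (∑-+ (λ x → 𝟏 (ev ℓ x ≟ 𝟘)) (zeros ls)))
        (ℕ.+-mono-≤ (∑-unique (λ x → ev ℓ x ≟ 𝟘) (form-root fℓ)) (zeros-bound fs))

      nonzero-or-zeros : ∀ ls x → All (λ ℓ → ev ℓ x ≢ 𝟘) ls ⊎ 1 ≤ zeros ls x
      nonzero-or-zeros [] x = inj₁ []
      nonzero-or-zeros (ℓ ∷ ls) x with ev ℓ x ≟ 𝟘 | nonzero-or-zeros ls x
      ... | yes _ | _       = inj₂ (s≤s z≤n)
      ... | no ne | inj₁ nz = inj₁ (ne ∷ nz)
      ... | no ne | inj₂ z  = inj₂ z

    All-one : List Poly → Carrier → Set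
    All-one ls x = All (λ ℓ → ev ℓ x ↑ (m * n) ≡ 𝟙) ls

    all-one? : ∀ ls x → Dec (All-one ls x)
    all-one? ls x = All.all? (λ ℓ → ev ℓ x ↑ (m * n) ≟ 𝟙) ls

    private
      -- If all powers are 1 and x ^ n = ω, then `solutions` is L. If some power is not 1 but x ^ n
      -- and ω have the same r-th power, then `solutions` is at least L / r. At a zero of a form the
      -- power is not a root of unity, and such x are charged to `zeros`.
      pointwise : ∀ ls x → let L = r ^ length ls in
        L * (r * 𝟏 (all-one? ls x ×-dec (x ↑ n ≟ ω)) + 𝟏 ((x ↑ n) ↑ r ≟ ω ↑ r)) ≤
        r * solutions r (ρs ls x) (x ↑ n) ω + L * (𝟏 (all-one? ls x ×-dec ((x ↑ n) ↑ r ≟ ω ↑ r)) + zeros ls x)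
      pointwise ls x with all-one? ls x
      pointwise ls x | yes a with x ↑ n ≟ ω
      pointwise ls x | yes a | yes e = begin
        L * (r * 1 + 𝟏 ((x ↑ n) ↑ r ≟ ω ↑ r)) ≤⟨ ℕ.*-monoʳ-≤ L (ℕ.+-monoʳ-≤ (r * 1) (𝟏-mono ((x ↑ n) ↑ r ≟ ω ↑ r) (yes a ×-dec ((x ↑ n) ↑ r ≟ ω ↑ r)) (a ,_))) ⟩
        L * (r * 1 + I) ≡⟨ lem L r I ⟩
        r * L + L * I ≤⟨ ℕ.+-mono-≤ (ℕ.*-monoʳ-≤ r (ℕ.≤-reflexive (sym (trans (solutions-trivial r (Allₚ.map⁺ a) e) (cong (r ^_) (Listₚ.length-map _ ls)))))) (ℕ.*-monoʳ-≤ L (ℕ.m≤m+n I (zeros ls x))) ⟩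
        r * solutions r (ρs ls x) (x ↑ n) ω + L * (I + zeros ls x) ∎
        where
        open ℕ.≤-Reasoning
        L = r ^ length ls
        I = 𝟏 (yes a ×-dec ((x ↑ n) ↑ r ≟ ω ↑ r))
        lem : ∀ L r I → L * (r * 1 + I) ≡ r * L + L * I
        lem = solve-∀
      pointwise ls x | yes a | no _ = ℕ.≤-trans
        (ℕ.*-monoʳ-≤ L (ℕ.≤-trans (ℕ.≤-reflexive (cong (_+ 𝟏 ((x ↑ n) ↑ r ≟ ω ↑ r)) (ℕ.*-zeroʳ r)))
          (ℕ.≤-trans (𝟏-mono ((x ↑ n) ↑ r ≟ ω ↑ r) (yes a ×-dec ((x ↑ n) ↑ r ≟ ω ↑ r)) (a ,_)) (ℕ.m≤m+n _ (zeros ls x)))))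
        (ℕ.m≤n+m _ (r * solutions r (ρs ls x) (x ↑ n) ω))
        where L = r ^ length ls
      pointwise ls x | no ¬a with (x ↑ n) ↑ r ≟ ω ↑ r
      ... | no _ = ℕ.≤-trans (ℕ.≤-reflexive (trans (cong (λ z → r ^ length ls * (z + 0)) (ℕ.*-zeroʳ r)) (ℕ.*-zeroʳ (r ^ length ls)))) z≤n
      ... | yes e with nonzero-or-zeros ls x
      ...   | inj₂ z = ℕ.≤-trans (ℕ.*-monoʳ-≤ (r ^ length ls) (ℕ.≤-trans (ℕ.≤-reflexive (cong (_+ 1) (ℕ.*-zeroʳ r))) z)) (ℕ.m≤n+m _ (r * solutions r (ρs ls x) (x ↑ n) ω))
      ...   | inj₁ nz = ℕ.≤-trans (ℕ.≤-reflexive (trans (cong (λ z → r ^ length ls * (z + 1)) (ℕ.*-zeroʳ r)) (trans (ℕ.*-identityʳ _) (cong (r ^_) (sym (Listₚ.length-map _ ls))))))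
                (ℕ.≤-trans (solutions-lower pr ω≢0 (Allₚ.map⁺ (All.map (λ {ℓ} ne → root ℓ ne) nz)) e (λ ones → ¬a (Allₚ.map⁻ ones)))
                  (ℕ.m≤m+n (r * solutions r (ρs ls x) (x ↑ n) ω) _))
        where
        lem : ∀ r m n → m * n * r ≡ r * m * n
        lem = solve-∀
        root : ∀ ℓ → ev ℓ x ≢ 𝟘 → (ev ℓ x ↑ (m * n)) ↑ r ≡ 𝟙
        root ℓ ne = trans (^-assocʳ (ev ℓ x) (m * n) r) (trans (cong (ev ℓ x ↑_) (trans (lem r m n) rmn)) (fermat (ev ℓ x) ne))

    -- Averaging Stepanov's bound for x ℓ₁^(m b₁) ⋯ ℓₖ^(m bₖ) over all exponents b below r.
    refine : ∀ ls → All Form ls → 1 + length ls * (m * r) ≤ D →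
             r * ∑ (λ x → 𝟏 (all-one? ls x ×-dec (x ↑ n ≟ ω))) + ∑ (λ x → 𝟏 ((x ↑ n) ↑ r ≟ ω ↑ r))
             ≤ r * bound + (∑ (λ x → 𝟏 (all-one? ls x ×-dec ((x ↑ n) ↑ r ≟ ω ↑ r))) + length ls)
    refine ls fs le = ℕ.*-cancelˡ-≤ L (begin
      L * (r * ∑ i₁ + ∑ i₃)
        ≡⟨ trans (cong (λ z → L * (z + ∑ i₃)) (sym (∑-*ˡ r i₁))) (trans (cong (L *_) (sym (∑-+ (λ x → r * i₁ x) i₃))) (sym (∑-*ˡ L (λ x → r * i₁ x + i₃ x)))) ⟩
      ∑ (λ x → L * (r * i₁ x + i₃ x))
        ≤⟨ ∑-mono (pointwise ls) ⟩
      ∑ (λ x → r * c x + L * (i₂ x + zeros ls x))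
        ≡⟨ trans (∑-+ (λ x → r * c x) (λ x → L * (i₂ x + zeros ls x))) (cong₂ _+_ (∑-*ˡ r c) (trans (∑-*ˡ L (λ x → i₂ x + zeros ls x)) (cong (L *_) (∑-+ i₂ (zeros ls))))) ⟩
      r * ∑ c + L * (∑ i₂ + ∑ (zeros ls))
        ≤⟨ ℕ.+-mono-≤ (ℕ.*-monoʳ-≤ r c-bound) (ℕ.*-monoʳ-≤ L (ℕ.+-monoʳ-≤ (∑ i₂) (zeros-bound fs))) ⟩
      r * (L * bound) + L * (∑ i₂ + length ls)
        ≡⟨ lem r L bound (∑ i₂ + length ls) ⟩
      L * (r * bound + (∑ i₂ + length ls)) ∎)
      where
      open ℕ.≤-Reasoning
      L = r ^ length ls
      instance
        r≢0 : NonZero r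
        r≢0 = prime⇒nonZero pr
        L≢0 : NonZero L
        L≢0 = ℕ.m^n≢0 r (length ls)
      i₁ i₂ i₃ c : Carrier → ℕ
      i₁ x = 𝟏 (all-one? ls x ×-dec (x ↑ n ≟ ω))
      i₂ x = 𝟏 (all-one? ls x ×-dec ((x ↑ n) ↑ r ≟ ω ↑ r))
      i₃ x = 𝟏 ((x ↑ n) ↑ r ≟ ω ↑ r)
      c x = solutions r (ρs ls x) (x ↑ n) ω
      lem : ∀ r L b t → r * (L * b) + L * t ≡ L * (r * b + t)
      lem = solve-∀
      one-x : ∀ x → x ⊗ ev (𝟙 ∷ []) x ≡ x
      one-x x = trans (cong (x ⊗_) (trans (cong (𝟙 ⊕_) (zeroʳ x)) (+-identityʳ 𝟙))) (*-identityʳ x)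
      c-bound : ∑ c ≤ L * bound
      c-bound = ℕ.≤-trans (ℕ.≤-reflexive (∑-cong (λ x → cong (λ τ → solutions r (ρs ls x) τ ω) (cong (_↑ n) (sym (one-x x))))))
        (solutions-upper ls (𝟙 ∷ []) 0 fs (λ e → 1≢0 (trans (sym (ev-at-zero (𝟙 ∷ []))) e)) ℕ.≤-refl le)

-- Simultaneous power conditions on the values c x + lam.

module Shifted (F : FiniteField) where
  open FieldBasics F
  open FieldPowers F
  open Polynomials F
  open Counting F
  open RootsOfUnity F
  open Recursion F
  open Sumℕ

  ∑-affine : ∀ h {c} lam → c ≢ 𝟘 → ∑ (λ x → h (c ⊗ x ⊕ lam)) ≡ ∑ h
  ∑-affine h lam nz = trans (∑-scale (λ x → h (x ⊕ lam)) _ nz) (∑-translate h lam)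

  nonzero-count : ∀ {p} {P : Pred Carrier p} (P? : Decidable P) → (∀ x → x ≢ 𝟘 → P x) → order ∸ 1 ≤ ∑ (λ x → 𝟏 (P? x))
  nonzero-count P? h = ℕ.m≤n+o⇒m∸n≤o order 1 (begin
    order ≡⟨ sym (trans (∑-const 1) (ℕ.*-identityʳ order)) ⟩
    ∑ (λ _ → 1) ≤⟨ ∑-mono split ⟩
    ∑ (λ x → 𝟏 (x ≟ 𝟘) + 𝟏 (P? x)) ≡⟨ ∑-+ (λ x → 𝟏 (x ≟ 𝟘)) (λ x → 𝟏 (P? x)) ⟩
    ∑ (λ x → 𝟏 (x ≟ 𝟘)) + ∑ (λ x → 𝟏 (P? x)) ≡⟨ cong (_+ ∑ (λ x → 𝟏 (P? x))) (∑-indicator 𝟘) ⟩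
    1 + ∑ (λ x → 𝟏 (P? x)) ∎)
    where
    open ℕ.≤-Reasoning
    split : ∀ x → 1 ≤ 𝟏 (x ≟ 𝟘) + 𝟏 (P? x)
    split x with x ≟ 𝟘
    ... | yes _ = s≤s z≤n
    ... | no ne = ℕ.≤-reflexive (sym (𝟏-yes (P? x) (h x ne)))

  module Ratio {c} (c≢0 : c ≢ 𝟘) (lam : Carrier) (lam≢0 : lam ≢ 𝟘) where
    ratio shift-by : Carrier → Carrier
    ratio c′ = c′ ⊗ inv c c≢0
    shift-by c′ = lam ⊕ ⊖ (ratio c′ ⊗ lam)

    ratio-spec : ∀ c′ x → ratio c′ ⊗ (c ⊗ x ⊕ lam) ⊕ shift-by c′ ≡ c′ ⊗ x ⊕ lam
    ratio-spec c′ x = begin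
      γ ⊗ (c ⊗ x ⊕ lam) ⊕ (lam ⊕ ⊖ (γ ⊗ lam)) ≡⟨ cong (_⊕ (lam ⊕ ⊖ (γ ⊗ lam))) (distribˡ γ (c ⊗ x) lam) ⟩
      γ ⊗ (c ⊗ x) ⊕ γ ⊗ lam ⊕ (lam ⊕ ⊖ (γ ⊗ lam)) ≡⟨ +-assoc _ _ _ ⟩
      γ ⊗ (c ⊗ x) ⊕ (γ ⊗ lam ⊕ (lam ⊕ ⊖ (γ ⊗ lam))) ≡⟨ cong₂ _⊕_ (trans (sym (*-assoc γ c x)) (cong (_⊗ x) (trans (*-assoc c′ _ c) (trans (cong (c′ ⊗_) (trans (*-comm _ c) (inv-r c c≢0))) (*-identityʳ c′)))))
                                                          (trans (+-comm _ _) (⊕-⊖-cancel lam (γ ⊗ lam))) ⟩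
      c′ ⊗ x ⊕ lam ∎
      where
      open ≡-Reasoning
      γ = ratio c′

    -- In the coordinate c x + lam the form of c′ has constant term lam (1 - c′ / c). Thus distinct
    -- multipliers and lam ≠ 0 give the non-vanishing at 0 that Stepanov's bound asks for.
    shift-by≢0 : ∀ c′ → c ≢ c′ → shift-by c′ ≢ 𝟘
    shift-by≢0 c′ c≢c′ e = c≢c′ (⊗-cancelˡ (inv-nonzero c c≢0) (trans (trans (*-comm _ c) (inv-r c c≢0)) (sym (trans (*-comm _ c′) γ≡1))))
      where
      γ = ratio c′
      γ≡1 : γ ≡ 𝟙
      γ≡1 = ⊗-cancelˡ lam≢0 (trans (*-comm lam γ) (trans (sym (⊕-cancelʳ (⊖ (γ ⊗ lam)) (trans e (sym (-‿inverseʳ (γ ⊗ lam)))))) (sym (*-identityʳ lam))))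

    form : Carrier → Poly
    form c′ = shift-by c′ ∷ ratio c′ ∷ []

    form-spec : ∀ c′ x → ev (form c′) (c ⊗ x ⊕ lam) ≡ c′ ⊗ x ⊕ lam
    form-spec c′ x = trans (ev-form (shift-by c′) (ratio c′) _) (trans (+-comm _ _) (trans (cong (_⊕ shift-by c′) (*-comm _ (ratio c′))) (ratio-spec c′ x)))

  module _ (lam : Carrier) (lam≢0 : lam ≢ 𝟘) where

    On : ℕ → List Carrier → Carrier → Set
    On N cs x = All (λ c → (c ⊗ x ⊕ lam) ↑ N ≡ 𝟙) cs

    on? : ∀ N cs x → Dec (On N cs x)
    on? N cs x = All.all? (λ c → (c ⊗ x ⊕ lam) ↑ N ≟ 𝟙) cs

    refine-affine : ∀ {r m n s D} → Prime r → r * m * n ≡ order ∸ 1 → s * s ≤ order → order ≤ s * (s + 2) → D + 2 ≤ s →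
                    ∀ {ω} → ω ≢ 𝟘 → ∀ {c} → c ≢ 𝟘 → ∀ cs → All (c ≢_) cs → 1 + length cs * (m * r) ≤ D →
                    r * ∑ (λ x → 𝟏 (on? (m * n) cs x ×-dec ((c ⊗ x ⊕ lam) ↑ n ≟ ω))) + ∑ (λ x → 𝟏 ((x ↑ n) ↑ r ≟ ω ↑ r))
                    ≤ r * (n + (s + 2) * (2 * D + 1)) + (∑ (λ x → 𝟏 (on? (m * n) cs x ×-dec (((c ⊗ x ⊕ lam) ↑ n) ↑ r ≟ ω ↑ r))) + length cs)
    refine-affine {r} {m} {n} {s} {D} pr rmn ss≤q q≤ D+2≤s {ω} ω≢0 {c} c≢0 cs c∉ le = begin
      r * ∑ (λ x → 𝟏 (on? (m * n) cs x ×-dec ((c ⊗ x ⊕ lam) ↑ n ≟ ω))) + N₃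
        ≡⟨ cong (λ z → r * z + N₃) (transport (λ y → y ↑ n ≟ ω)) ⟩
      r * ∑ (λ y → 𝟏 (all-one?′ y ×-dec (y ↑ n ≟ ω))) + N₃
        ≤⟨ refine {r} {m} {n} {s} {D} pr rmn ss≤q q≤ D+2≤s ω≢0 (map form cs) forms (subst (λ k → 1 + k * (m * r) ≤ D) (sym (Listₚ.length-map form cs)) le) ⟩
      r * B + (∑ (λ y → 𝟏 (all-one?′ y ×-dec ((y ↑ n) ↑ r ≟ ω ↑ r))) + length (map form cs))
        ≡⟨ cong₂ (λ z k → r * B + (z + k)) (sym (transport (λ y → (y ↑ n) ↑ r ≟ ω ↑ r))) (Listₚ.length-map form cs) ⟩
      r * B + (∑ (λ x → 𝟏 (on? (m * n) cs x ×-dec (((c ⊗ x ⊕ lam) ↑ n) ↑ r ≟ ω ↑ r))) + length cs) ∎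
      where
      open ℕ.≤-Reasoning
      open Ratio c≢0 lam lam≢0
      N₃ = ∑ (λ x → 𝟏 ((x ↑ n) ↑ r ≟ ω ↑ r))
      B = n + (s + 2) * (2 * D + 1)
      all-one?′ = all-one? {r} {m} {n} {s} {D} pr rmn ss≤q q≤ D+2≤s ω≢0 (map form cs)
      forms : All Form (map form cs)
      forms = Allₚ.map⁺ (All.map (λ {c′} ne → shift-by c′ , ratio c′ , shift-by≢0 c′ ne , refl) c∉)
      transport : ∀ {p} {P : Pred Carrier p} (P? : Decidable P) →
                  ∑ (λ x → 𝟏 (on? (m * n) cs x ×-dec P? (c ⊗ x ⊕ lam))) ≡ ∑ (λ y → 𝟏 (all-one?′ y ×-dec P? y))
      transport P? = trans (∑-cong (λ x → 𝟏-cong (on? (m * n) cs x ×-dec P? (c ⊗ x ⊕ lam)) (all-one?′ (c ⊗ x ⊕ lam) ×-dec P? (c ⊗ x ⊕ lam))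
          (λ (o , p) → Allₚ.map⁺ (All.map (λ {c′} e → trans (cong (_↑ (m * n)) (form-spec c′ x)) e) o) , p)
          (λ (o , p) → All.map (λ {c′} e → trans (cong (_↑ (m * n)) (sym (form-spec c′ x))) e) (Allₚ.map⁻ o) , p)))
        (∑-affine (λ y → 𝟏 (all-one?′ y ×-dec P? y)) lam c≢0)

    all-nonzero-powers : ∀ {r n} → r * n ≡ order ∸ 1 → ∀ x → x ≢ 𝟘 → (x ↑ n) ↑ r ≡ 𝟙
    all-nonzero-powers {r} {n} rn x nz = trans (^-assocʳ x n r) (trans (cong (x ↑_) (trans (ℕ.*-comm n r) rn)) (fermat x nz))

    -- As ω ^ r = 1, every non-zero x has (x ^ n) ^ r = ω ^ r. So r n stands on both sides of
    -- `refine-affine` and cancels: one more multiplier divides the count by r, up to an error.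
    refine-prime : ∀ {r n s D} → Prime r → r * n ≡ order ∸ 1 → s * s ≤ order → order ≤ s * (s + 2) → D + 2 ≤ s →
                   ∀ {ω} → ω ≢ 𝟘 → ω ↑ r ≡ 𝟙 → ∀ {c} → c ≢ 𝟘 → ∀ cs → All (c ≢_) cs → 1 + length cs * r ≤ D →
                   r * ∑ (λ x → 𝟏 (on? n cs x ×-dec ((c ⊗ x ⊕ lam) ↑ n ≟ ω))) ≤ r * ((s + 2) * (2 * D + 1)) + (∑ (λ x → 𝟏 (on? n cs x)) + length cs)
    refine-prime {r} {n} {s} {D} pr rn ss≤q q≤ D+2≤s {ω} ω≢0 ωr {c} c≢0 cs c∉ le = ℕ.+-cancelʳ-≤ (r * n) _ _ (begin
      r * ∑ (λ x → 𝟏 (on? n cs x ×-dec ((c ⊗ x ⊕ lam) ↑ n ≟ ω))) + r * n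
        ≤⟨ ℕ.+-mono-≤ (ℕ.*-monoʳ-≤ r (∑-mono (λ x → 𝟏-mono (on? n cs x ×-dec ((c ⊗ x ⊕ lam) ↑ n ≟ ω)) (on? (1 * n) cs x ×-dec ((c ⊗ x ⊕ lam) ↑ n ≟ ω)) (λ (o , e) → subst (λ k → On k cs x) (sym (ℕ.*-identityˡ n)) o , e))))
             (ℕ.≤-trans (ℕ.≤-reflexive rn) (nonzero-count (λ x → (x ↑ n) ↑ r ≟ ω ↑ r) (λ x nz → trans (all-nonzero-powers {r} {n} rn x nz) (sym ωr)))) ⟩
      r * ∑ (λ x → 𝟏 (on? (1 * n) cs x ×-dec ((c ⊗ x ⊕ lam) ↑ n ≟ ω))) + ∑ (λ x → 𝟏 ((x ↑ n) ↑ r ≟ ω ↑ r))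
        ≤⟨ refine-affine {r} {1} {n} {s} {D} pr (trans (cong (_* n) (ℕ.*-identityʳ r)) rn) ss≤q q≤ D+2≤s ω≢0 c≢0 cs c∉ (subst (λ k → 1 + length cs * k ≤ D) (sym (ℕ.*-identityˡ r)) le) ⟩
      r * (n + E) + (∑ (λ x → 𝟏 (on? (1 * n) cs x ×-dec (((c ⊗ x ⊕ lam) ↑ n) ↑ r ≟ ω ↑ r))) + length cs)
        ≤⟨ ℕ.+-monoʳ-≤ (r * (n + E)) (ℕ.+-monoˡ-≤ (length cs) (∑-mono (λ x → 𝟏-mono (on? (1 * n) cs x ×-dec (((c ⊗ x ⊕ lam) ↑ n) ↑ r ≟ ω ↑ r)) (on? n cs x) (λ (o , _) → subst (λ k → On k cs x) (ℕ.*-identityˡ n) o)))) ⟩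
      r * (n + E) + (∑ (λ x → 𝟏 (on? n cs x)) + length cs)
        ≡⟨ lem r n E (∑ (λ x → 𝟏 (on? n cs x)) + length cs) ⟩
      r * E + (∑ (λ x → 𝟏 (on? n cs x)) + length cs) + r * n ∎)
      where
      open ℕ.≤-Reasoning
      E = (s + 2) * (2 * D + 1)
      lem : ∀ r n E t → r * (n + E) + t ≡ r * E + t + r * n
      lem = solve-∀

    -- The error made at one multiplier is divided by r at each later one. As r ≥ 2, the errors add
    -- up to at most 2 e.
    chain-bound : ∀ {r n s D e} → Prime r → r * n ≡ order ∸ 1 → s * s ≤ order → order ≤ s * (s + 2) → D + 2 ≤ s →
                  ∀ cs → AllPairs _≢_ cs → All (_≢ 𝟘) cs → 1 + length cs * r ≤ D → (s + 2) * (2 * D + 1) + length cs ≤ e →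
                  r ^ length cs * ∑ (λ x → 𝟏 (on? n cs x)) ≤ order + 2 * (r ^ length cs * e)
    chain-bound {n = n} pr rn ss≤q q≤ D+2≤s [] dist nz le ee = ℕ.≤-trans (ℕ.≤-reflexive (ℕ.*-identityˡ _))
      (ℕ.≤-trans (∑-mono (λ x → 𝟏≤1 (on? n [] x))) (ℕ.≤-trans (ℕ.≤-reflexive (trans (∑-const 1) (ℕ.*-identityʳ order))) (ℕ.m≤m+n order _)))
    chain-bound {r} {n} {s} {D} {e} pr rn ss≤q q≤ D+2≤s (c ∷ cs) (c∉ ∷ dist) (c≢0 ∷ nz) le ee = begin
      r * L * ∑ (λ x → 𝟏 (on? n (c ∷ cs) x))
        ≡⟨ trans (cong (_* ∑ (λ x → 𝟏 (on? n (c ∷ cs) x))) (ℕ.*-comm r L)) (ℕ.*-assoc L r _) ⟩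
      L * (r * ∑ (λ x → 𝟏 (on? n (c ∷ cs) x)))
        ≤⟨ ℕ.*-monoʳ-≤ L (ℕ.≤-trans (ℕ.*-monoʳ-≤ r (∑-mono (λ x → 𝟏-mono (on? n (c ∷ cs) x) (on? n cs x ×-dec ((c ⊗ x ⊕ lam) ↑ n ≟ 𝟙)) (λ { (o ∷ os) → os , o }))))
             (refine-prime {r} {n} {s} {D} pr rn ss≤q q≤ D+2≤s 1≢0 (↑-one r) c≢0 cs c∉ (ℕ.≤-trans (s≤s (ℕ.m≤n+m (length cs * r) r)) le))) ⟩
      L * (r * E + (∑ (λ x → 𝟏 (on? n cs x)) + k))
        ≡⟨ lem₁ L r E k (∑ (λ x → 𝟏 (on? n cs x))) ⟩
      L * ∑ (λ x → 𝟏 (on? n cs x)) + L * (r * E + k)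
        ≤⟨ ℕ.+-mono-≤ (chain-bound {r} {n} {s} {D} {e} pr rn ss≤q q≤ D+2≤s cs dist nz (ℕ.≤-trans (s≤s (ℕ.m≤n+m (length cs * r) r)) le) (ℕ.≤-trans (ℕ.+-monoʳ-≤ E (ℕ.n≤1+n k)) ee))
             (ℕ.*-monoʳ-≤ L (ℕ.+-monoʳ-≤ (r * E) (ℕ.m≤n*m k r))) ⟩
      order + 2 * (L * e) + L * (r * E + r * k)
        ≡⟨ lem₂ order L e r E k ⟩
      order + (2 * (L * e) + r * (L * (E + k)))
        ≤⟨ ℕ.+-monoʳ-≤ order (ℕ.+-mono-≤ (ℕ.*-monoˡ-≤ (L * e) (ℕ.nonTrivial⇒n>1 r)) (ℕ.*-monoʳ-≤ r (ℕ.*-monoʳ-≤ L (ℕ.≤-trans (ℕ.+-monoʳ-≤ E (ℕ.n≤1+n k)) ee)))) ⟩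
      order + (r * (L * e) + r * (L * e))
        ≡⟨ lem₃ order L e r ⟩
      order + 2 * (r * L * e) ∎
      where
      open ℕ.≤-Reasoning
      L = r ^ length cs
      E = (s + 2) * (2 * D + 1)
      k = length cs
      instance
        r≢0 : NonZero r
        r≢0 = prime⇒nonZero pr
        r>1 : ℕ.NonTrivial r
        r>1 = prime⇒nonTrivial pr
      lem₁ : ∀ L r E k N → L * (r * E + (N + k)) ≡ L * N + L * (r * E + k)
      lem₁ = solve-∀
      lem₂ : ∀ q L e r E k → q + 2 * (L * e) + L * (r * E + r * k) ≡ q + (2 * (L * e) + r * (L * (E + k)))
      lem₂ = solve-∀
      lem₃ : ∀ q L e r → q + (r * (L * e) + r * (L * e)) ≡ q + 2 * (r * L * e)
      lem₃ = solve-∀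

-- The residues of exponent d and the variance over lines.

module PowerResidues (F : FiniteField) where
  open FieldBasics F
  open FieldPowers F
  open Counting F
  open RootsOfUnity F
  open Shifted F
  open Sumℕ

  module _ (d : ℕ) where

    Residue : Carrier → Set
    Residue y = ∃ λ x → x ≢ 𝟘 × y ≡ x ↑ d

    residue? : Decidable Residue
    residue? y = any? (λ x → ¬? (x ≟ 𝟘) ×-dec (y ≟ x ↑ d))

    residue-one : Residue 𝟙
    residue-one = 𝟙 , 1≢0 , sym (↑-one d)

    residue-nonzero : ∀ {y} → Residue y → y ≢ 𝟘
    residue-nonzero (x , nz , refl) = ↑-nonzero d nz

    residue-⊗ : ∀ {u v} → Residue u → Residue v → Residue (u ⊗ v)
    residue-⊗ (x , nx , refl) (y , ny , refl) = x ⊗ y , ⊗-nonzero nx ny , sym (^-distrib-* x y d)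

    residue-inv : ∀ {u} (ru : Residue u) → Residue (inv u (residue-nonzero ru))
    residue-inv {u} ru@(x , nx , refl) = inv x nx , inv-nonzero x nx ,
      ⊗-cancelˡ (residue-nonzero ru) (trans (inv-r u _) (sym (trans (sym (^-distrib-* x (inv x nx) d)) (trans (cong (_↑ d) (inv-r x nx)) (↑-one d)))))

    residue-power : ∀ {n} → d * n ≡ order ∸ 1 → ∀ {y} → Residue y → y ↑ n ≡ 𝟙
    residue-power {n} dn (x , nx , refl) = trans (^-assocʳ x d n) (trans (cong (x ↑_) dn) (fermat x nx))

    residues : ℕ
    residues = ∑ (λ y → 𝟏 (residue? y))

    -- With `residues-lower` this pins the number of residues to n by bounding roots of polynomials,
    -- without a generator of the multiplicative group.
    residues-upper : ∀ {n} → d * n ≡ order ∸ 1 → 1 ≤ n → residues ≤ n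
    residues-upper dn 1≤n = ℕ.≤-trans (ℕ.≤-reflexive (sym (length-members residue?)))
      (roots-bound _ 1≤n 𝟙 (members residue?) (members-distinct residue?) (All.map (residue-power dn) (members-satisfy residue?)))

    residues-lower : 1 ≤ d → order ∸ 1 ≤ d * residues
    residues-lower 1≤d = begin
      order ∸ 1
        ≤⟨ nonzero-count (λ x → ¬? (x ≟ 𝟘)) (λ x nz → nz) ⟩
      ∑ (λ x → 𝟏 (¬? (x ≟ 𝟘)))
        ≤⟨ ∑-mono (λ x → ℕ.≤-trans (𝟏-mono (¬? (x ≟ 𝟘)) (¬? (x ≟ 𝟘) ×-dec (x ↑ d ≟ x ↑ d)) (λ nz → nz , refl)) (term≤∑ (λ y → 𝟏 (¬? (x ≟ 𝟘) ×-dec (x ↑ d ≟ y))) (x ↑ d))) ⟩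
      ∑ (λ x → ∑ (λ y → 𝟏 (¬? (x ≟ 𝟘) ×-dec (x ↑ d ≟ y))))
        ≡⟨ ∑-swap (λ x y → 𝟏 (¬? (x ≟ 𝟘) ×-dec (x ↑ d ≟ y))) ⟩
      ∑ (λ y → ∑ (λ x → 𝟏 (¬? (x ≟ 𝟘) ×-dec (x ↑ d ≟ y))))
        ≤⟨ ∑-mono fibre ⟩
      ∑ (λ y → d * 𝟏 (residue? y))
        ≡⟨ ∑-*ˡ d (λ y → 𝟏 (residue? y)) ⟩
      d * residues ∎
      where
      open ℕ.≤-Reasoning
      fibre : ∀ y → ∑ (λ x → 𝟏 (¬? (x ≟ 𝟘) ×-dec (x ↑ d ≟ y))) ≤ d * 𝟏 (residue? y)
      fibre y with residue? y
      ... | yes _ = ℕ.≤-trans (ℕ.≤-reflexive (sym (length-members P?))) (ℕ.≤-trans (roots-bound d 1≤d y (members P?) (members-distinct P?) (All.map proj₂ (members-satisfy P?))) (ℕ.≤-reflexive (sym (ℕ.*-identityʳ d))))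
        where
        P? : Decidable (λ x → x ≢ 𝟘 × x ↑ d ≡ y)
        P? x = ¬? (x ≟ 𝟘) ×-dec (x ↑ d ≟ y)
      ... | no ¬r = ℕ.≤-trans (ℕ.≤-reflexive (trans (∑-cong (λ x → 𝟏-no (¬? (x ≟ 𝟘) ×-dec (x ↑ d ≟ y)) (λ (nz , e) → ¬r (x , nz , sym e)))) (trans (∑-const 0) (ℕ.*-zeroʳ order)))) z≤n

    χ : Carrier → ℕ
    χ y = 𝟏 (residue? y)

    χ-scale : ∀ {u} → Residue u → ∀ y → χ (u ⊗ y) ≡ χ y
    χ-scale {u} ru y = 𝟏-cong (residue? (u ⊗ y)) (residue? y)
      (λ ruy → subst Residue (trans (sym (*-assoc _ u y)) (trans (cong (_⊗ y) (trans (*-comm _ u) (inv-r u _))) (*-identityˡ y))) (residue-⊗ (residue-inv ru) ruy))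
      (residue-⊗ ru)

    private
      σ q : ℕ
      σ = residues
      q = order

      -- The number of points on the line of slope α and intercept β both of whose coordinates are
      -- residues.
      incidence : Carrier → Carrier → ℕ
      incidence α β = ∑ (λ t → χ t * χ (α ⊗ t ⊕ β))

      χ² : ∀ y → χ y * χ y ≤ χ y
      χ² y with residue? y
      ... | yes _ = ℕ.≤-refl
      ... | no _  = z≤n

      ∑-translateˡ : ∀ h c → ∑ (λ x → h (c ⊕ x)) ≡ ∑ h
      ∑-translateˡ h c = trans (∑-cong (λ x → cong h (+-comm c x))) (∑-translate h c)

      ∑χ-affine : ∀ c e → e ≢ 𝟘 → ∑ (λ a → χ (c ⊕ a ⊗ e)) ≡ σ
      ∑χ-affine c e nz = trans (∑-cong (λ a → cong (λ z → χ (c ⊕ z)) (*-comm a e))) (trans (∑-scale (λ x → χ (c ⊕ x)) e nz) (∑-translateˡ χ c))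

      first-moment : ∑ (λ α → ∑ (incidence α)) ≡ q * (σ * σ)
      first-moment = trans (∑-cong (λ α → begin
        ∑ (λ β → ∑ (λ t → χ t * χ (α ⊗ t ⊕ β))) ≡⟨ ∑-swap (λ β t → χ t * χ (α ⊗ t ⊕ β)) ⟩
        ∑ (λ t → ∑ (λ β → χ t * χ (α ⊗ t ⊕ β))) ≡⟨ ∑-cong (λ t → trans (∑-*ˡ (χ t) (λ β → χ (α ⊗ t ⊕ β))) (cong (χ t *_) (∑-translateˡ χ (α ⊗ t)))) ⟩
        ∑ (λ t → χ t * σ) ≡⟨ ∑-*ʳ σ χ ⟩
        σ * σ ∎)) (∑-const (σ * σ))
        where open ≡-Reasoning

      -- Through two points with different abscissae there is exactly one line.
      pairs : ∀ t t′ → ∑ (λ α → ∑ (λ β → χ (α ⊗ t ⊕ β) * χ (α ⊗ t′ ⊕ β))) ≤ σ * σ + q * σ * 𝟏 (t′ ≟ t)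
      pairs t t′ with t′ ≟ t
      ... | yes refl = ℕ.≤-trans (∑-mono (λ α → ℕ.≤-trans (∑-mono (λ β → χ² (α ⊗ t ⊕ β))) (ℕ.≤-reflexive (∑-translateˡ χ (α ⊗ t)))))
                         (ℕ.≤-trans (ℕ.≤-reflexive (trans (∑-const σ) (sym (ℕ.*-identityʳ (q * σ))))) (ℕ.m≤n+m _ (σ * σ)))
      ... | no ne = ℕ.≤-trans (ℕ.≤-reflexive (begin
        ∑ (λ α → ∑ (λ β → χ (α ⊗ t ⊕ β) * χ (α ⊗ t′ ⊕ β)))
          ≡⟨ ∑-cong (λ α → trans (∑-cong (λ β → cong (λ z → χ (α ⊗ t ⊕ β) * χ z) (move α β))) (∑-translateˡ (λ β → χ β * χ (β ⊕ α ⊗ e)) (α ⊗ t))) ⟩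
        ∑ (λ α → ∑ (λ β → χ β * χ (β ⊕ α ⊗ e)))
          ≡⟨ ∑-swap (λ α β → χ β * χ (β ⊕ α ⊗ e)) ⟩
        ∑ (λ β → ∑ (λ α → χ β * χ (β ⊕ α ⊗ e)))
          ≡⟨ ∑-cong (λ β → trans (∑-*ˡ (χ β) (λ α → χ (β ⊕ α ⊗ e))) (cong (χ β *_) (∑χ-affine β e e≢0))) ⟩
        ∑ (λ β → χ β * σ)
          ≡⟨ ∑-*ʳ σ χ ⟩
        σ * σ ∎)) (ℕ.m≤m+n (σ * σ) _)
        where
        open ≡-Reasoning
        e = t′ ⊕ ⊖ t
        e≢0 : e ≢ 𝟘
        e≢0 z = ne (⊕-cancelʳ (⊖ t) (trans z (sym (-‿inverseʳ t))))
        move : ∀ α β → α ⊗ t′ ⊕ β ≡ α ⊗ t ⊕ β ⊕ α ⊗ e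
        move α β = begin
          α ⊗ t′ ⊕ β ≡⟨ cong (λ z → α ⊗ z ⊕ β) (sym (⊕-⊖-cancel t′ t)) ⟩
          α ⊗ (e ⊕ t) ⊕ β ≡⟨ cong (_⊕ β) (trans (distribˡ α e t) (+-comm _ _)) ⟩
          α ⊗ t ⊕ α ⊗ e ⊕ β ≡⟨ trans (+-assoc _ _ _) (trans (cong (α ⊗ t ⊕_) (+-comm _ β)) (sym (+-assoc _ _ _))) ⟩
          α ⊗ t ⊕ β ⊕ α ⊗ e ∎

      -- The square of an incidence counts pairs of points on the line. Sum over all lines first, by
      -- `pairs`, and then over the two abscissae; the diagonal yields the term q σ².
      second-moment : ∑ (λ α → ∑ (λ β → incidence α β * incidence α β)) ≤ σ * σ * (σ * σ) + q * (σ * σ)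
      second-moment = begin
        ∑ (λ α → ∑ (λ β → incidence α β * incidence α β))
          ≡⟨ ∑-cong (λ α → ∑-cong (λ β → square α β)) ⟩
        ∑ (λ α → ∑ (λ β → ∑ (λ t → ∑ (λ t′ → term t t′ α β))))
          ≡⟨ ∑-cong (λ α → trans (∑-swap (λ β t → ∑ (λ t′ → term t t′ α β))) (∑-cong (λ t → ∑-swap (λ β t′ → term t t′ α β)))) ⟩
        ∑ (λ α → ∑ (λ t → ∑ (λ t′ → ∑ (term t t′ α))))
          ≡⟨ trans (∑-swap (λ α t → ∑ (λ t′ → ∑ (term t t′ α)))) (∑-cong (λ t → ∑-swap (λ α t′ → ∑ (term t t′ α)))) ⟩
        ∑ (λ t → ∑ (λ t′ → ∑ (λ α → ∑ (term t t′ α))))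
          ≤⟨ ∑-mono (λ t → ∑-mono (λ t′ → ℕ.≤-trans (ℕ.≤-reflexive (trans (∑-cong (λ α → ∑-*ˡ (χ t * χ t′) (λ β → χ (α ⊗ t ⊕ β) * χ (α ⊗ t′ ⊕ β)))) (∑-*ˡ (χ t * χ t′) (λ α → ∑ (λ β → χ (α ⊗ t ⊕ β) * χ (α ⊗ t′ ⊕ β))))))
               (ℕ.*-monoʳ-≤ (χ t * χ t′) (pairs t t′)))) ⟩
        ∑ (λ t → ∑ (λ t′ → χ t * χ t′ * (σ * σ + q * σ * 𝟏 (t′ ≟ t))))
          ≤⟨ ∑-mono inner ⟩
        ∑ (λ t → χ t * (σ * (σ * σ) + q * σ))
          ≡⟨ ∑-*ʳ (σ * (σ * σ) + q * σ) χ ⟩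
        σ * (σ * (σ * σ) + q * σ)
          ≡⟨ lem₂ σ q ⟩
        σ * σ * (σ * σ) + q * (σ * σ) ∎
        where
        open ℕ.≤-Reasoning
        term : Carrier → Carrier → Carrier → Carrier → ℕ
        term t t′ α β = χ t * χ t′ * (χ (α ⊗ t ⊕ β) * χ (α ⊗ t′ ⊕ β))
        lem₁ : ∀ a b c e → a * b * (c * e) ≡ a * c * (b * e)
        lem₁ = solve-∀
        lem₂ : ∀ σ q → σ * (σ * (σ * σ) + q * σ) ≡ σ * σ * (σ * σ) + q * (σ * σ)
        lem₂ = solve-∀
        lem₃ : ∀ a b c k i → a * b * (c + k * i) ≡ a * (b * c + k * (b * i))
        lem₃ = solve-∀
        square : ∀ α β → incidence α β * incidence α β ≡ ∑ (λ t → ∑ (λ t′ → term t t′ α β))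
        square α β = trans (sym (∑-*ʳ (incidence α β) (λ t → χ t * χ (α ⊗ t ⊕ β)))) (∑-cong (λ t →
          trans (sym (∑-*ˡ (χ t * χ (α ⊗ t ⊕ β)) (λ t′ → χ t′ * χ (α ⊗ t′ ⊕ β)))) (∑-cong (λ t′ → lem₁ (χ t) (χ (α ⊗ t ⊕ β)) (χ t′) (χ (α ⊗ t′ ⊕ β))))))
        inner : ∀ t → ∑ (λ t′ → χ t * χ t′ * (σ * σ + q * σ * 𝟏 (t′ ≟ t))) ≤ χ t * (σ * (σ * σ) + q * σ)
        inner t = begin
          ∑ (λ t′ → χ t * χ t′ * (σ * σ + q * σ * 𝟏 (t′ ≟ t)))
            ≡⟨ ∑-cong (λ t′ → lem₃ (χ t) (χ t′) (σ * σ) (q * σ) (𝟏 (t′ ≟ t))) ⟩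
          ∑ (λ t′ → χ t * (χ t′ * (σ * σ) + q * σ * (χ t′ * 𝟏 (t′ ≟ t))))
            ≡⟨ trans (∑-*ˡ (χ t) (λ t′ → χ t′ * (σ * σ) + q * σ * (χ t′ * 𝟏 (t′ ≟ t)))) (cong (χ t *_) (trans (∑-+ (λ t′ → χ t′ * (σ * σ)) (λ t′ → q * σ * (χ t′ * 𝟏 (t′ ≟ t)))) (cong₂ _+_ (∑-*ʳ (σ * σ) χ) (∑-*ˡ (q * σ) (λ t′ → χ t′ * 𝟏 (t′ ≟ t)))))) ⟩
          χ t * (σ * (σ * σ) + q * σ * ∑ (λ t′ → χ t′ * 𝟏 (t′ ≟ t)))
            ≤⟨ ℕ.*-monoʳ-≤ (χ t) (ℕ.+-monoʳ-≤ (σ * (σ * σ)) (ℕ.≤-trans (ℕ.*-monoʳ-≤ (q * σ) (ℕ.≤-trans (∑-mono (λ t′ → ℕ.≤-trans (ℕ.*-monoˡ-≤ (𝟏 (t′ ≟ t)) (𝟏≤1 (residue? t′))) (ℕ.≤-reflexive (ℕ.*-identityˡ _)))) (ℕ.≤-reflexive (∑-indicator t)))) (ℕ.≤-reflexive (ℕ.*-identityʳ (q * σ))))) ⟩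
          χ t * (σ * (σ * σ) + q * σ) ∎

      module _ {γ δ} (γ≢0 : γ ≢ 𝟘) (δ≢0 : δ ≢ 𝟘) where

        -- Replacing t by (v / u) t and factoring out v preserves residues. So a deviation at one
        -- line recurs over all pairs of residues u, v, that is σ² times, and a variance controls
        -- each single line.
        incidence-orbit : ∀ {u v} → Residue u → Residue v → incidence (γ ⊗ u) (δ ⊗ v) ≡ incidence γ δ
        incidence-orbit {u} {v} ru rv = begin
          ∑ (λ t → χ t * χ (γ ⊗ u ⊗ t ⊕ δ ⊗ v))
            ≡⟨ sym (∑-scale (λ t → χ t * χ (γ ⊗ u ⊗ t ⊕ δ ⊗ v)) w (⊗-nonzero (residue-nonzero rv) (inv-nonzero u _))) ⟩
          ∑ (λ t → χ (w ⊗ t) * χ (γ ⊗ u ⊗ (w ⊗ t) ⊕ δ ⊗ v))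
            ≡⟨ ∑-cong (λ t → cong₂ _*_ (χ-scale (residue-⊗ rv (residue-inv ru)) t) (trans (cong χ (factor t)) (χ-scale rv (γ ⊗ t ⊕ δ)))) ⟩
          ∑ (λ t → χ t * χ (γ ⊗ t ⊕ δ)) ∎
          where
          open ≡-Reasoning
          w = v ⊗ inv u (residue-nonzero ru)
          uw : u ⊗ w ≡ v
          uw = trans (cong (u ⊗_) (*-comm v _)) (trans (sym (*-assoc u _ v)) (trans (cong (_⊗ v) (inv-r u _)) (*-identityˡ v)))
          factor : ∀ t → γ ⊗ u ⊗ (w ⊗ t) ⊕ δ ⊗ v ≡ v ⊗ (γ ⊗ t ⊕ δ)
          factor t = begin
            γ ⊗ u ⊗ (w ⊗ t) ⊕ δ ⊗ v ≡⟨ cong (_⊕ δ ⊗ v) (trans (*-assoc γ u _) (cong (γ ⊗_) (trans (sym (*-assoc u w t)) (cong (_⊗ t) uw)))) ⟩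
            γ ⊗ (v ⊗ t) ⊕ δ ⊗ v ≡⟨ cong₂ _⊕_ (trans (sym (*-assoc γ v t)) (trans (cong (_⊗ t) (*-comm γ v)) (*-assoc v γ t))) (*-comm δ v) ⟩
            v ⊗ (γ ⊗ t) ⊕ v ⊗ δ ≡⟨ sym (distribˡ v (γ ⊗ t) δ) ⟩
            v ⊗ (γ ⊗ t ⊕ δ) ∎

        reparametrize : ∀ (h : Carrier → Carrier → ℕ) → ∑ (λ u → ∑ (λ v → h (γ ⊗ u) (δ ⊗ v))) ≡ ∑ (λ α → ∑ (h α))
        reparametrize h = trans (∑-cong (λ u → ∑-scale (h (γ ⊗ u)) δ δ≢0)) (∑-scale (λ α → ∑ (h α)) γ γ≢0)

        without-excess : ∀ e i → 2 * (q * (σ * σ)) * i + e * e * 0 ≤ q * q * (i * i) + σ * σ * (σ * σ)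
        without-excess e i = ℕ.≤-trans (ℕ.≤-reflexive (lem₁ q (σ * σ) i e)) (ℕ.≤-trans (2xy≤x²+y² (q * i) (σ * σ)) (ℕ.≤-reflexive (cong (_+ σ * σ * (σ * σ)) (lem₂ q i))))
          where
          lem₁ : ∀ q S i e → 2 * (q * S) * i + e * e * 0 ≡ 2 * ((q * i) * S)
          lem₁ = solve-∀
          lem₂ : ∀ q i → q * i * (q * i) ≡ q * q * (i * i)
          lem₂ = solve-∀

        -- The inequality (q i - σ²)² ≥ e² on the orbit and ≥ 0 elsewhere, expanded so that no
        -- subtraction occurs.
        excess-pointwise : ∀ e → q * incidence γ δ ≡ σ * σ + e → ∀ u v → let i = incidence (γ ⊗ u) (δ ⊗ v) in
                           2 * (q * (σ * σ)) * i + e * e * (χ u * χ v) ≤ q * q * (i * i) + σ * σ * (σ * σ)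
        excess-pointwise e eq u v with residue? u | residue? v
        ... | yes ru | yes rv = ℕ.≤-reflexive (begin
            2 * (q * (σ * σ)) * i + e * e * 1 ≡⟨ lem₁ q (σ * σ) i e ⟩
            2 * ((q * i) * (σ * σ)) + e * e ≡⟨ cong (λ z → 2 * (z * (σ * σ)) + e * e) qi ⟩
            2 * ((σ * σ + e) * (σ * σ)) + e * e ≡⟨ lem₂ (σ * σ) e ⟩
            (σ * σ + e) * (σ * σ + e) + σ * σ * (σ * σ) ≡⟨ cong (λ z → z * z + σ * σ * (σ * σ)) (sym qi) ⟩
            q * i * (q * i) + σ * σ * (σ * σ) ≡⟨ cong (_+ σ * σ * (σ * σ)) (lem₃ q i) ⟩
            q * q * (i * i) + σ * σ * (σ * σ) ∎)
          where
          open ≡-Reasoning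
          i = incidence (γ ⊗ u) (δ ⊗ v)
          qi : q * i ≡ σ * σ + e
          qi = trans (cong (q *_) (incidence-orbit ru rv)) eq
          lem₁ : ∀ q S i e → 2 * (q * S) * i + e * e * 1 ≡ 2 * ((q * i) * S) + e * e
          lem₁ = solve-∀
          lem₂ : ∀ S e → 2 * ((S + e) * S) + e * e ≡ (S + e) * (S + e) + S * S
          lem₂ = solve-∀
          lem₃ : ∀ q i → q * i * (q * i) ≡ q * q * (i * i)
          lem₃ = solve-∀
        ... | yes _ | no _ = without-excess e (incidence (γ ⊗ u) (δ ⊗ v))
        ... | no _  | _    = without-excess e (incidence (γ ⊗ u) (δ ⊗ v))

        -- Summed over all lines, the orbit contributes σ² e², and the two moments bound the whole
        -- variance by q³ σ².
        excess-bound : ∀ e → q * incidence γ δ ≡ σ * σ + e → e * e ≤ q * q * q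
        excess-bound e eq = ℕ.*-cancelʳ-≤ (e * e) (q * q * q) (σ * σ) {{σσ≢0}} (ℕ.+-cancelˡ-≤ (2 * (q * q * (σ * σ * (σ * σ)))) _ _ (begin
          2 * (q * q * (σ * σ * (σ * σ))) + e * e * (σ * σ)
            ≡⟨ lem₁ q (σ * σ) (e * e) ⟩
          2 * (q * (σ * σ)) * (q * (σ * σ)) + e * e * (σ * σ)
            ≡⟨ sym (cong₂ _+_ (trans (∑²-*ˡ (2 * (q * (σ * σ))) I) (cong (2 * (q * (σ * σ)) *_) (trans (reparametrize incidence) first-moment)))
                              (trans (∑²-*ˡ (e * e) (λ u v → χ u * χ v)) (cong (e * e *_) (trans (∑-cong (λ u → ∑-*ˡ (χ u) χ)) (∑-*ʳ σ χ))))) ⟩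
          ∑² (λ u v → 2 * (q * (σ * σ)) * I u v) + ∑² (λ u v → e * e * (χ u * χ v))
            ≡⟨ sym (∑²-+ (λ u v → 2 * (q * (σ * σ)) * I u v) (λ u v → e * e * (χ u * χ v))) ⟩
          ∑² (λ u v → 2 * (q * (σ * σ)) * I u v + e * e * (χ u * χ v))
            ≤⟨ ∑-mono (λ u → ∑-mono (excess-pointwise e eq u)) ⟩
          ∑² (λ u v → q * q * (I u v * I u v) + σ * σ * (σ * σ))
            ≡⟨ trans (∑²-+ (λ u v → q * q * (I u v * I u v)) (λ _ _ → σ * σ * (σ * σ))) (cong₂ _+_ (trans (∑²-*ˡ (q * q) (λ u v → I u v * I u v)) (cong (q * q *_) (reparametrize (λ α β → incidence α β * incidence α β)))) (trans (∑-cong (λ _ → ∑-const (σ * σ * (σ * σ)))) (∑-const (q * (σ * σ * (σ * σ)))))) ⟩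
          q * q * ∑² (λ α β → incidence α β * incidence α β) + q * (q * (σ * σ * (σ * σ)))
            ≤⟨ ℕ.+-monoˡ-≤ (q * (q * (σ * σ * (σ * σ)))) (ℕ.*-monoʳ-≤ (q * q) second-moment) ⟩
          q * q * (σ * σ * (σ * σ) + q * (σ * σ)) + q * (q * (σ * σ * (σ * σ)))
            ≡⟨ lem₂ q (σ * σ) ⟩
          2 * (q * q * (σ * σ * (σ * σ))) + q * q * q * (σ * σ) ∎))
          where
          open ℕ.≤-Reasoning
          I : Carrier → Carrier → ℕ
          I u v = incidence (γ ⊗ u) (δ ⊗ v)
          σ≢0 : 1 ≤ σ
          σ≢0 = ℕ.≤-trans (ℕ.≤-reflexive (sym (𝟏-yes (residue? 𝟙) residue-one))) (term≤∑ χ 𝟙)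
          σσ≢0 : NonZero (σ * σ)
          σσ≢0 = ℕ.>-nonZero (ℕ.*-mono-≤ σ≢0 σ≢0)
          lem₁ : ∀ q S E → 2 * (q * q * (S * S)) + E * S ≡ 2 * (q * S) * (q * S) + E * S
          lem₁ = solve-∀
          lem₂ : ∀ q S → q * q * (S * S + q * S) + q * (q * (S * S)) ≡ 2 * (q * q * (S * S)) + q * q * q * S
          lem₂ = solve-∀

        incidence-bound : ∀ {s} → q ≤ s * (s + 2) → q * incidence γ δ ≤ σ * σ + q * (s + 1)
        incidence-bound {s} q≤ with ℕ.≤-total (q * incidence γ δ) (σ * σ)
        ... | inj₁ le = ℕ.≤-trans le (ℕ.m≤m+n (σ * σ) _)
        ... | inj₂ le with ℕ.m≤n⇒∃[o]m+o≡n le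
        ...   | e , eq = ℕ.≤-trans (ℕ.≤-reflexive (sym eq)) (ℕ.+-monoʳ-≤ (σ * σ) (ℕ.≮⇒≥ (λ lt → ℕ.<⇒≱ (ℕ.*-mono-< lt lt) (begin
              e * e ≤⟨ excess-bound e (sym eq) ⟩
              q * q * q ≤⟨ ℕ.*-monoʳ-≤ (q * q) (ℕ.≤-trans q≤ (ℕ.≤-trans (ℕ.m≤m+n _ 1) (ℕ.≤-reflexive (lem₁ s)))) ⟩
              q * q * ((s + 1) * (s + 1)) ≡⟨ lem₂ q (s + 1) ⟩
              q * (s + 1) * (q * (s + 1)) ∎))))
          where
          open ℕ.≤-Reasoning
          lem₁ : ∀ s → s * (s + 2) + 1 ≡ (s + 1) * (s + 1)
          lem₁ = solve-∀
          lem₂ : ∀ q t → q * q * (t * t) ≡ q * t * (q * t)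
          lem₂ = solve-∀

    pair-bound : ∀ {s} → order ≤ s * (s + 2) → ∀ {lam} → lam ≢ 𝟘 → ∀ {c c′} → c ≢ 𝟘 → c′ ≢ 𝟘 → c ≢ c′ →
                 order * ∑ (λ x → 𝟏 (residue? (c ⊗ x ⊕ lam) ×-dec residue? (c′ ⊗ x ⊕ lam))) ≤ residues * residues + order * (s + 1)
    pair-bound {s} q≤ {lam} lam≢0 {c} {c′} c≢0 c′≢0 c≢c′ = ℕ.≤-trans (ℕ.≤-reflexive (cong (order *_) (trans
        (∑-cong (λ x → trans (product (residue? (c ⊗ x ⊕ lam)) (residue? (c′ ⊗ x ⊕ lam))) (cong (λ z → χ (c ⊗ x ⊕ lam) * χ z) (sym (ratio-spec c′ x)))))
        (∑-affine (λ t → χ t * χ (ratio c′ ⊗ t ⊕ shift-by c′)) lam c≢0))))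
      (incidence-bound (⊗-nonzero c′≢0 (inv-nonzero c c≢0)) (shift-by≢0 c′ c≢c′) {s} q≤)
      where
      open Ratio c≢0 lam lam≢0
      product : ∀ {a b} {A : Set a} {B : Set b} (x : Dec A) (y : Dec B) → 𝟏 (x ×-dec y) ≡ 𝟏 x * 𝟏 y
      product (yes _) (yes _) = refl
      product (yes _) (no _)  = refl
      product (no _)  _       = refl

-- Loomis-Whitney for product sets.

module TripleProduct (F : FiniteField) where
  open FieldBasics F
  open Counting F
  open Sumℕ

  private
    -- Sum 2 f f′ ≤ p f′² + f² p′ over all pairs of arguments; p is 1 wherever f is non-zero.
    cauchy-schwarz : ∀ (p f : Carrier → Carrier → ℕ) → (∀ u v → f u v ≡ 0 ⊎ p u v ≡ 1) →
                     ∑² f * ∑² f ≤ ∑² p * ∑² (λ u v → f u v * f u v)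
    cauchy-schwarz p f supp = ℕ.*-cancelˡ-≤ 2 (begin
      2 * (∑² f * ∑² f)
        ≡⟨ sym (trans (∑²-cong (λ u v → trans (∑²-*ˡ 2 (λ u′ v′ → f u v * f u′ v′)) (cong (2 *_) (∑²-*ˡ (f u v) f)))) (trans (∑²-*ˡ 2 (λ u v → f u v * ∑² f)) (cong (2 *_) (∑²-*ʳ (∑² f) f)))) ⟩
      ∑² (λ u v → ∑² (λ u′ v′ → 2 * (f u v * f u′ v′)))
        ≤⟨ ∑²-mono (λ u v → ∑²-mono (λ u′ v′ → pointwise (f u v) (f u′ v′) (p u v) (p u′ v′) (supp u v) (supp u′ v′))) ⟩
      ∑² (λ u v → ∑² (λ u′ v′ → p u v * (f u′ v′ * f u′ v′) + f u v * f u v * p u′ v′))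
        ≡⟨ ∑²-cong (λ u v → trans (∑²-+ (λ u′ v′ → p u v * (f u′ v′ * f u′ v′)) (λ u′ v′ → f u v * f u v * p u′ v′)) (cong₂ _+_ (∑²-*ˡ (p u v) (λ u′ v′ → f u′ v′ * f u′ v′)) (∑²-*ˡ (f u v * f u v) p))) ⟩
      ∑² (λ u v → p u v * Q + f u v * f u v * ∑² p)
        ≡⟨ trans (∑²-+ (λ u v → p u v * Q) (λ u v → f u v * f u v * ∑² p)) (cong₂ _+_ (∑²-*ʳ Q p) (∑²-*ʳ (∑² p) (λ u v → f u v * f u v))) ⟩
      ∑² p * Q + Q * ∑² p
        ≡⟨ lem (∑² p) Q ⟩
      2 * (∑² p * Q) ∎)
      where
      open ℕ.≤-Reasoning
      Q = ∑² (λ u v → f u v * f u v)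
      lem : ∀ P Q → P * Q + Q * P ≡ 2 * (P * Q)
      lem = solve-∀
      pointwise : ∀ x y a b → x ≡ 0 ⊎ a ≡ 1 → y ≡ 0 ⊎ b ≡ 1 → 2 * (x * y) ≤ a * (y * y) + x * x * b
      pointwise x y a b (inj₁ refl) _ = z≤n
      pointwise x y a b (inj₂ _) (inj₁ refl) = ℕ.≤-trans (ℕ.≤-reflexive (cong (2 *_) (ℕ.*-zeroʳ x))) z≤n
      pointwise x y a b (inj₂ refl) (inj₂ refl) = ℕ.≤-trans (2xy≤x²+y² x y) (ℕ.≤-reflexive (lem′ x y))
        where
        lem′ : ∀ x y → x * x + y * y ≡ 1 * (y * y) + x * x * 1
        lem′ = solve-∀

    radix : ∀ {q x y i j} → i < q → j < q → x * q + i ≡ y * q + j → x ≡ y × i ≡ j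
    radix {suc q} {x} {y} {i} {j} i<q j<q e = ℕ.*-cancelʳ-≡ x y (suc q) (ℕ.+-cancelʳ-≡ i _ _ (trans e (cong (y * suc q +_) (sym i≡j)))) , i≡j
      where
      digit : ∀ x {i} → i < suc q → (x * suc q + i) % suc q ≡ i
      digit x {i} lt = trans (cong (_% suc q) (ℕ.+-comm (x * suc q) i)) (trans (DM.[m+kn]%n≡m%n i x (suc q)) (DM.m<n⇒m%n≡m lt))
      i≡j : i ≡ j
      i≡j = trans (sym (digit x i<q)) (trans (cong (_% suc q) e) (digit y j<q))

  module _ {a b} {P : Pred Carrier a} {Q : Pred Carrier b} (P? : Decidable P) (Q? : Decidable Q) where
    Product : Carrier → Set (a ⊔ b)
    Product y = ∃ λ u → ∃ λ v → P u × Q v × y ≡ u ⊗ v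

    product? : Decidable Product
    product? y = any? (λ u → any? (λ v → P? u ×-dec Q? v ×-dec (y ≟ u ⊗ v)))

  module _ {A B C : Pred Carrier 0ℓ} (A? : Decidable A) (B? : Decidable B) (C? : Decidable C) where

    private
      i₁ i₂ i₃ : Carrier → ℕ
      i₁ a = toℕ (index a) * order * order
      i₂ b = toℕ (index b) * order
      i₃ c = toℕ (index c)

      weight : Carrier → Carrier → Carrier → ℕ
      weight a b c = i₁ a + i₂ b + i₃ c

      Represents : Carrier → Carrier → Carrier → Carrier → Set
      Represents y a b c = A a × B b × C c × y ≡ a ⊗ b ⊗ c

      represents? : ∀ y a b c → Dec (Represents y a b c)
      represents? y a b c = A? a ×-dec B? b ×-dec C? c ×-dec (y ≟ a ⊗ b ⊗ c)

      Lighter : Carrier → Carrier → Carrier → Set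
      Lighter a b c = ∃ λ a′ → ∃ λ b′ → ∃ λ c′ → Represents (a ⊗ b ⊗ c) a′ b′ c′ × weight a′ b′ c′ < weight a b c

      lighter? : ∀ a b c → Dec (Lighter a b c)
      lighter? a b c = any? (λ a′ → any? (λ b′ → any? (λ c′ → represents? (a ⊗ b ⊗ c) a′ b′ c′ ×-dec (weight a′ b′ c′ ℕ.<? weight a b c))))

      -- The weight is additive and injective on pairs, so a pair of entries of a lightest
      -- representation is determined by its product.
      Lightest : Carrier → Carrier → Carrier → Set
      Lightest a b c = Represents (a ⊗ b ⊗ c) a b c × ¬ Lighter a b c

      lightest? : ∀ a b c → Dec (Lightest a b c)
      lightest? a b c = represents? (a ⊗ b ⊗ c) a b c ×-dec ¬? (lighter? a b c)

      exists-lightest : ∀ y k a b c → weight a b c < k → Represents y a b c → ∃ λ a′ → ∃ λ b′ → ∃ λ c′ → Lightest a′ b′ c′ × y ≡ a′ ⊗ b′ ⊗ c′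
      exists-lightest y (suc k) a b c (s≤s w≤k) (pa , pb , pc , refl) with lighter? a b c
      ... | no ¬l = a , b , c , ((pa , pb , pc , refl) , ¬l) , refl
      ... | yes (a′ , b′ , c′ , rep , lt) = exists-lightest y k a′ b′ c′ (ℕ.<-≤-trans lt w≤k) rep

      index-injective : ∀ {x y} → toℕ (index x) ≡ toℕ (index y) → x ≡ y
      index-injective {x} {y} e = trans (sym (elem-index x)) (trans (cong elem (Finₚ.toℕ-injective e)) (elem-index y))

      p₁₂ p₁₃ p₂₃ : Carrier → Carrier → Set
      p₁₂ a b = ∃ λ c → Lightest a b c
      p₁₃ a c = ∃ λ b → Lightest a b c
      p₂₃ b c = ∃ λ a → Lightest a b c

      p₁₂? : ∀ a b → Dec (p₁₂ a b)
      p₁₂? a b = any? (λ c → lightest? a b c)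
      p₁₃? : ∀ a c → Dec (p₁₃ a c)
      p₁₃? a c = any? (λ b → lightest? a b c)
      p₂₃? : ∀ b c → Dec (p₂₃ b c)
      p₂₃? b c = any? (λ a → lightest? a b c)

      swapʳ : ∀ a b c → a ⊗ b ⊗ c ≡ a ⊗ c ⊗ b
      swapʳ a b c = trans (*-assoc a b c) (trans (cong (a ⊗_) (*-comm b c)) (sym (*-assoc a c b)))

      -- An exchange argument: otherwise a′, b′ could replace a, b in the lightest representation a
      -- b c and make it lighter.
      le₁₂ : ∀ {a b a′ b′} → a ⊗ b ≡ a′ ⊗ b′ → p₁₂ a b → p₁₂ a′ b′ → i₁ a + i₂ b ≤ i₁ a′ + i₂ b′
      le₁₂ {a} {b} {a′} {b′} e (c , (_ , _ , pc , _) , ¬l) (_ , (pa′ , pb′ , _) , _) =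
        ℕ.+-cancelʳ-≤ (i₃ c) _ _ (ℕ.≮⇒≥ (λ lt → ¬l (a′ , b′ , c , (pa′ , pb′ , pc , cong (_⊗ c) e) , lt)))

      le₁₃ : ∀ {a c a′ c′} → a ⊗ c ≡ a′ ⊗ c′ → p₁₃ a c → p₁₃ a′ c′ → i₁ a + i₃ c ≤ i₁ a′ + i₃ c′
      le₁₃ {a} {c} {a′} {c′} e (b , (_ , pb , _) , ¬l) (_ , (pa′ , _ , pc′ , _) , _) =
        ℕ.+-cancelʳ-≤ (i₂ b) _ _ (ℕ.≮⇒≥ (λ lt → ¬l (a′ , b , c′ , (pa′ , pb , pc′ , trans (swapʳ a b c) (trans (cong (_⊗ b) e) (swapʳ a′ c′ b))) ,
          subst₂ _<_ (lem (i₁ a′) (i₃ c′) (i₂ b)) (lem (i₁ a) (i₃ c) (i₂ b)) lt)))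
        where
        lem : ∀ x y z → x + y + z ≡ x + z + y
        lem = solve-∀

      le₂₃ : ∀ {b c b′ c′} → b ⊗ c ≡ b′ ⊗ c′ → p₂₃ b c → p₂₃ b′ c′ → i₂ b + i₃ c ≤ i₂ b′ + i₃ c′
      le₂₃ {b} {c} {b′} {c′} e (a , (pa , _) , ¬l) (_ , (_ , pb′ , pc′ , _) , _) =
        ℕ.+-cancelˡ-≤ (i₁ a) _ _ (ℕ.≮⇒≥ (λ lt → ¬l (a , b′ , c′ , (pa , pb′ , pc′ , trans (*-assoc a b c) (trans (cong (a ⊗_) e) (sym (*-assoc a b′ c′)))) ,
          subst₂ _<_ (sym (ℕ.+-assoc (i₁ a) (i₂ b′) (i₃ c′))) (sym (ℕ.+-assoc (i₁ a) (i₂ b) (i₃ c))) lt)))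

      <order : ∀ x → toℕ (index x) < order
      <order x = Finₚ.toℕ<n (index x)

      positive : 0 < order
      positive = ℕ.<⇒≤ 1<order

      eq₁₂ : ∀ {a b a′ b′} → a ⊗ b ≡ a′ ⊗ b′ → p₁₂ a b → p₁₂ a′ b′ → a ≡ a′ × b ≡ b′
      eq₁₂ {a} {b} {a′} {b′} e p p′ = index-injective (proj₁ digits) , index-injective (proj₂ digits)
        where
        lem : ∀ x y q → x * q * q + y * q ≡ (x * q + y) * q + 0
        lem = solve-∀
        digits = radix (<order b) (<order b′) (proj₁ (radix positive positive (trans (sym (lem (toℕ (index a)) (toℕ (index b)) order))
          (trans (ℕ.≤-antisym (le₁₂ e p p′) (le₁₂ (sym e) p′ p)) (lem (toℕ (index a′)) (toℕ (index b′)) order)))))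

      eq₁₃ : ∀ {a c a′ c′} → a ⊗ c ≡ a′ ⊗ c′ → p₁₃ a c → p₁₃ a′ c′ → a ≡ a′ × c ≡ c′
      eq₁₃ {a} {c} {a′} {c′} e p p′ = index-injective (proj₁ (radix positive positive (cong (_+ 0) (proj₁ digits)))) , index-injective (proj₂ digits)
        where
        digits = radix (<order c) (<order c′) (ℕ.≤-antisym (le₁₃ e p p′) (le₁₃ (sym e) p′ p))

      eq₂₃ : ∀ {b c b′ c′} → b ⊗ c ≡ b′ ⊗ c′ → p₂₃ b c → p₂₃ b′ c′ → b ≡ b′ × c ≡ c′
      eq₂₃ {b} {c} {b′} {c′} e p p′ = index-injective (proj₁ digits) , index-injective (proj₂ digits)
        where
        digits = radix (<order c) (<order c′) (ℕ.≤-antisym (le₂₃ e p p′) (le₂₃ (sym e) p′ p))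

      ∑²-unique : ∀ {R : Carrier → Carrier → Set} (R? : ∀ u v → Dec (R u v)) → (∀ u v u′ v′ → R u v → R u′ v′ → u ≡ u′ × v ≡ v′) →
                  ∑² (λ u v → 𝟏 (R? u v)) ≤ 1
      ∑²-unique R? unique = ℕ.≤-trans (∑-mono (λ u → row u)) (∑-unique (λ u → any? (R? u)) (λ u u′ (v , r) (v′ , r′) → proj₁ (unique u v u′ v′ r r′)))
        where
        row : ∀ u → ∑ (λ v → 𝟏 (R? u v)) ≤ 𝟏 (any? (R? u))
        row u with any? (R? u)
        ... | yes _ = ∑-unique (R? u) (λ v v′ r r′ → proj₂ (unique u v u v′ r r′))
        ... | no ¬r = ℕ.≤-reflexive (trans (∑-cong (λ v → 𝟏-no (R? u v) (λ r → ¬r (v , r)))) (trans (∑-const 0) (ℕ.*-zeroʳ order)))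

      -- By injectivity each y is the product of at most one pair in p, so the pairs are no more
      -- numerous than the product set.
      project : ∀ {p : Carrier → Carrier → Set} (p? : ∀ u v → Dec (p u v)) {X Y : Pred Carrier 0ℓ} (X? : Decidable X) (Y? : Decidable Y) →
                (∀ {u v} → p u v → X u × Y v) → (∀ {u v u′ v′} → u ⊗ v ≡ u′ ⊗ v′ → p u v → p u′ v′ → u ≡ u′ × v ≡ v′) →
                ∑² (λ u v → 𝟏 (p? u v)) ≤ ∑ (λ y → 𝟏 (product? X? Y? y))
      project p? X? Y? sub inj = begin
        ∑² (λ u v → 𝟏 (p? u v))
          ≤⟨ ∑²-mono (λ u v → ℕ.≤-trans (𝟏-mono (p? u v) (p? u v ×-dec (u ⊗ v ≟ u ⊗ v)) (_, refl)) (term≤∑ (λ y → 𝟏 (p? u v ×-dec (u ⊗ v ≟ y))) (u ⊗ v))) ⟩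
        ∑² (λ u v → ∑ (λ y → 𝟏 (p? u v ×-dec (u ⊗ v ≟ y))))
          ≡⟨ trans (∑-cong (λ u → ∑-swap (λ v y → 𝟏 (p? u v ×-dec (u ⊗ v ≟ y))))) (∑-swap (λ u y → ∑ (λ v → 𝟏 (p? u v ×-dec (u ⊗ v ≟ y))))) ⟩
        ∑ (λ y → ∑² (λ u v → 𝟏 (p? u v ×-dec (u ⊗ v ≟ y))))
          ≤⟨ ∑-mono fibre ⟩
        ∑ (λ y → 𝟏 (product? X? Y? y)) ∎
        where
        open ℕ.≤-Reasoning
        fibre : ∀ y → ∑² (λ u v → 𝟏 (p? u v ×-dec (u ⊗ v ≟ y))) ≤ 𝟏 (product? X? Y? y)
        fibre y with product? X? Y? y
        ... | yes _ = ∑²-unique (λ u v → p? u v ×-dec (u ⊗ v ≟ y)) (λ u v u′ v′ (r , e) (r′ , e′) → inj (trans e (sym e′)) r r′)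
        ... | no ¬y = ℕ.≤-reflexive (trans (∑²-cong (λ u v → 𝟏-no (p? u v ×-dec (u ⊗ v ≟ y)) (λ (r , e) → ¬y (u , v , proj₁ (sub r) , proj₂ (sub r) , sym e))))
                        (trans (∑-cong (λ _ → trans (∑-const 0) (ℕ.*-zeroʳ order))) (trans (∑-const 0) (ℕ.*-zeroʳ order))))

      I : Carrier → Carrier → Carrier → ℕ
      I a b c = 𝟏 (lightest? a b c)

      ∑²-swap³ : ∀ (h : Carrier → Carrier → Carrier → ℕ) → ∑ (λ y → ∑² (h y)) ≡ ∑² (λ u v → ∑ (λ y → h y u v))
      ∑²-swap³ h = trans (∑-swap (λ y u → ∑ (h y u))) (∑-cong (λ u → ∑-swap (λ y v → h y u v)))

    -- Loomis–Whitney applied to the lightest representations.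
    triple-product : ∀ {S : Pred Carrier 0ℓ} (S? : Decidable S) → (∀ y → S y → ∃ λ a → ∃ λ b → ∃ λ c → Represents y a b c) →
                     ∑ (λ y → 𝟏 (S? y)) * ∑ (λ y → 𝟏 (S? y)) ≤
                     ∑ (λ y → 𝟏 (product? A? B? y)) * (∑ (λ y → 𝟏 (product? A? C? y)) * ∑ (λ y → 𝟏 (product? B? C? y)))
    triple-product S? rep = begin
      ∑ (λ y → 𝟏 (S? y)) * ∑ (λ y → 𝟏 (S? y))
        ≤⟨ ℕ.*-mono-≤ total total ⟩
      ∑² f * ∑² f
        ≤⟨ cauchy-schwarz (λ a b → 𝟏 (p₁₂? a b)) f support ⟩
      ∑² (λ a b → 𝟏 (p₁₂? a b)) * ∑² (λ a b → f a b * f a b)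
        ≤⟨ ℕ.*-mono-≤ (project p₁₂? A? B? (λ (c , (pa , pb , _) , _) → pa , pb) eq₁₂) squares ⟩
      ∑ (λ y → 𝟏 (product? A? B? y)) * (∑ (λ y → 𝟏 (product? A? C? y)) * ∑ (λ y → 𝟏 (product? B? C? y))) ∎
      where
      open ℕ.≤-Reasoning
      f : Carrier → Carrier → ℕ
      f a b = ∑ (I a b)
      support : ∀ a b → f a b ≡ 0 ⊎ 𝟏 (p₁₂? a b) ≡ 1
      support a b with p₁₂? a b
      ... | yes _ = inj₂ refl
      ... | no ¬p = inj₁ (trans (∑-cong (λ c → 𝟏-no (lightest? a b c) (λ l → ¬p (c , l)))) (trans (∑-const 0) (ℕ.*-zeroʳ order)))
      total : ∑ (λ y → 𝟏 (S? y)) ≤ ∑² f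
      total = begin
        ∑ (λ y → 𝟏 (S? y))
          ≤⟨ ∑-mono hit ⟩
        ∑ (λ y → ∑² (λ a b → ∑ (λ c → 𝟏 (lightest? a b c ×-dec (y ≟ a ⊗ b ⊗ c)))))
          ≡⟨ trans (∑²-swap³ (λ y a b → ∑ (λ c → 𝟏 (lightest? a b c ×-dec (y ≟ a ⊗ b ⊗ c))))) (∑²-cong (λ a b → ∑-swap (λ y c → 𝟏 (lightest? a b c ×-dec (y ≟ a ⊗ b ⊗ c))))) ⟩
        ∑² (λ a b → ∑ (λ c → ∑ (λ y → 𝟏 (lightest? a b c ×-dec (y ≟ a ⊗ b ⊗ c)))))
          ≤⟨ ∑²-mono (λ a b → ∑-mono (λ c → once a b c)) ⟩
        ∑² f ∎
        where
        once : ∀ a b c → ∑ (λ y → 𝟏 (lightest? a b c ×-dec (y ≟ a ⊗ b ⊗ c))) ≤ 𝟏 (lightest? a b c)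
        once a b c with lightest? a b c
        ... | yes l = ∑-unique (λ y → yes l ×-dec (y ≟ a ⊗ b ⊗ c)) (λ y y′ (_ , e) (_ , e′) → trans e (sym e′))
        ... | no _  = ℕ.≤-reflexive (trans (∑-const 0) (ℕ.*-zeroʳ order))
        hit : ∀ y → 𝟏 (S? y) ≤ ∑² (λ a b → ∑ (λ c → 𝟏 (lightest? a b c ×-dec (y ≟ a ⊗ b ⊗ c))))
        hit y with S? y
        ... | no _  = z≤n
        ... | yes sy with rep y sy
        ...   | a₀ , b₀ , c₀ , r₀ with exists-lightest y (suc (weight a₀ b₀ c₀)) a₀ b₀ c₀ ℕ.≤-refl r₀
        ...     | a , b , c , l , e = ℕ.≤-trans (ℕ.≤-reflexive (sym (𝟏-yes (lightest? a b c ×-dec (y ≟ a ⊗ b ⊗ c)) (l , e))))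
            (ℕ.≤-trans (term≤∑ (λ c → 𝟏 (lightest? a b c ×-dec (y ≟ a ⊗ b ⊗ c))) c)
            (ℕ.≤-trans (term≤∑ (λ b → ∑ (λ c → 𝟏 (lightest? a b c ×-dec (y ≟ a ⊗ b ⊗ c)))) b)
              (term≤∑ (λ a → ∑ (λ b → ∑ (λ c → 𝟏 (lightest? a b c ×-dec (y ≟ a ⊗ b ⊗ c))))) a)))
      squares : ∑² (λ a b → f a b * f a b) ≤ ∑ (λ y → 𝟏 (product? A? C? y)) * ∑ (λ y → 𝟏 (product? B? C? y))
      squares = begin
        ∑² (λ a b → f a b * f a b)
          ≡⟨ ∑²-cong (λ a b → trans (sym (∑-*ʳ (f a b) (I a b))) (∑-cong (λ c → sym (∑-*ˡ (I a b c) (I a b))))) ⟩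
        -- The square counts two third entries c, c′ over the same a, b. Keeping only the pairs (a,
        -- c) and (b, c′) still determines a, b, c, c′ and decouples the sums.
        ∑² (λ a b → ∑² (λ c c′ → I a b c * I a b c′))
          ≤⟨ ∑²-mono (λ a b → ∑²-mono (λ c c′ → ℕ.*-mono-≤ (𝟏-mono (lightest? a b c) (p₁₃? a c) (b ,_)) (𝟏-mono (lightest? a b c′) (p₂₃? b c′) (a ,_)))) ⟩
        ∑² (λ a b → ∑² (λ c c′ → 𝟏 (p₁₃? a c) * 𝟏 (p₂₃? b c′)))
          ≡⟨ ∑²-cong (λ a b → trans (∑-cong (λ c → ∑-*ˡ (𝟏 (p₁₃? a c)) (λ c′ → 𝟏 (p₂₃? b c′)))) (∑-*ʳ (∑ (λ c′ → 𝟏 (p₂₃? b c′))) (λ c → 𝟏 (p₁₃? a c)))) ⟩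
        ∑² (λ a b → ∑ (λ c → 𝟏 (p₁₃? a c)) * ∑ (λ c′ → 𝟏 (p₂₃? b c′)))
          ≡⟨ trans (∑-cong (λ a → ∑-*ˡ (∑ (λ c → 𝟏 (p₁₃? a c))) (λ b → ∑ (λ c′ → 𝟏 (p₂₃? b c′))))) (∑-*ʳ (∑² (λ b c′ → 𝟏 (p₂₃? b c′))) (λ a → ∑ (λ c → 𝟏 (p₁₃? a c)))) ⟩
        ∑² (λ a c → 𝟏 (p₁₃? a c)) * ∑² (λ b c → 𝟏 (p₂₃? b c))
          ≤⟨ ℕ.*-mono-≤ (project p₁₃? A? C? (λ (b , (pa , _ , pc , _) , _) → pa , pc) eq₁₃) (project p₂₃? B? C? (λ (a , (_ , pb , pc , _) , _) → pb , pc) eq₂₃) ⟩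
        ∑ (λ y → 𝟏 (product? A? C? y)) * ∑ (λ y → 𝟏 (product? B? C? y)) ∎

-- Numerical inequalities and the choice of constants.

module Arithmetic where

  sqrt : ∀ q → ∃ λ s → s * s ≤ q × q ≤ s * (s + 2)
  sqrt zero = 0 , z≤n , z≤n
  sqrt (suc q) with sqrt q
  ... | s , lo , hi with suc q ℕ.≤? s * (s + 2)
  ...   | yes le = s , ℕ.m≤n⇒m≤1+n lo , le
  ...   | no ¬le = suc s , ℕ.≤-trans (ℕ.≤-reflexive (lem₁ s)) (ℕ.≰⇒> ¬le) , ℕ.≤-trans (s≤s hi) (ℕ.≤-trans (ℕ.m≤m+n _ (2 * s + 2)) (ℕ.≤-reflexive (lem₂ s)))
    where
    lem₁ : ∀ s → suc s * suc s ≡ suc (s * (s + 2))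
    lem₁ = solve-∀
    lem₂ : ∀ s → suc (s * (s + 2)) + (2 * s + 2) ≡ suc s * (suc s + 2)
    lem₂ = solve-∀

  log₂ : ∀ q → 1 ≤ q → ∃ λ K → q < 2 ^ K × 2 ^ K ≤ 2 * q
  log₂ (suc zero) _ = 1 , s≤s (s≤s z≤n) , ℕ.≤-refl
  log₂ (suc (suc q)) _ with log₂ (suc q) (s≤s z≤n)
  ... | K , lo , hi with suc (suc q) ℕ.<? 2 ^ K
  ...   | yes lt = K , lt , ℕ.≤-trans hi (ℕ.*-monoʳ-≤ 2 (ℕ.n≤1+n (suc q)))
  ...   | no ¬lt = suc K , ℕ.≤-trans (ℕ.m≤m+n (3 + q) (1 + q)) (ℕ.≤-trans (ℕ.≤-reflexive (lem q)) (ℕ.*-monoʳ-≤ 2 lo))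
                  , ℕ.*-monoʳ-≤ 2 (ℕ.≮⇒≥ ¬lt)
    where
    lem : ∀ q → 3 + q + (1 + q) ≡ 2 * (2 + q)
    lem = solve-∀

  prime-divisor : ∀ d → 2 ≤ d → ∃ λ r → Prime r × ∃ λ m → r * m ≡ d
  prime-divisor 1 (s≤s ())
  prime-divisor d@(suc (suc _)) _ with factorise d
  ... | record { factors = [] ; isFactorisation = () }
  ... | record { factors = r ∷ rs ; isFactorisation = eq ; factorsPrime = pr ∷ _ } = r , pr , _ , sym eq

  -- From 5 on, 2 ^ k / k² is smallest at 5, with value 32 / 25, so the margin 6 / 5 fits; at 4
  -- there is equality 2 ^ k = k² and no margin.
  6k²≤5·2^k : ∀ k → 6 * ((5 + k) * (5 + k)) ≤ 5 * 2 ^ (5 + k)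
  6k²≤5·2^k zero    = ℕ.m≤m+n 150 10
  6k²≤5·2^k (suc k) = begin
    6 * ((5 + suc k) * (5 + suc k)) ≤⟨ ℕ.m≤m+n _ (6 * (k * k + 8 * k + 14)) ⟩
    6 * ((5 + suc k) * (5 + suc k)) + 6 * (k * k + 8 * k + 14) ≡⟨ lem₁ k ⟩
    2 * (6 * ((5 + k) * (5 + k))) ≤⟨ ℕ.*-monoʳ-≤ 2 (6k²≤5·2^k k) ⟩
    2 * (5 * 2 ^ (5 + k)) ≡⟨ lem₂ (2 ^ (5 + k)) ⟩
    5 * 2 ^ (5 + suc k) ∎
    where
    open ℕ.≤-Reasoning
    lem₁ : ∀ k → 6 * ((5 + suc k) * (5 + suc k)) + 6 * (k * k + 8 * k + 14) ≡ 2 * (6 * ((5 + k) * (5 + k)))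
    lem₁ = solve-∀
    lem₂ : ∀ x → 2 * (5 * x) ≡ 5 * (2 * x)
    lem₂ = solve-∀

  -- In the two exceptional shapes r ^ k = d * k, so a set of q / r ^ k elements is exactly large enough
  -- for its k multiples to cover the shifted subgroup.
  data Shape (r k d : ℕ) : Set where
    two-two   : r ≡ 2 → k ≡ 2 → d ≡ 2 → Shape r k d
    four-four : r ≡ 2 → k ≡ 4 → d ≡ 4 → Shape r k d
    generic   : 6 * (d * k) ≤ 5 * r ^ k → Shape r k d

  private
    prime≥2 : ∀ {r} → Prime r → 2 ≤ r
    prime≥2 pr = ℕ.nonTrivial⇒n>1 _ {{prime⇒nonTrivial pr}}

    divisor-of-2 : ∀ {r m} → Prime r → r * m ≡ 2 → r ≡ 2
    divisor-of-2 {r} {m} pr e = ℕ.≤-antisym (∣⇒≤ (divides m (trans (sym e) (ℕ.*-comm r m)))) (prime≥2 pr)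

    divisor-of-3 : ∀ {r m} → Prime r → r * m ≡ 3 → r ≡ 3
    divisor-of-3 {r} {m} pr e = go r m e (prime≥2 pr) (∣⇒≤ (divides m (trans (sym e) (ℕ.*-comm r m))))
      where
      go : ∀ r m → r * m ≡ 3 → 2 ≤ r → r ≤ 3 → r ≡ 3
      go 0 m e () _
      go 1 m e (s≤s ()) _
      go 2 0 () _ _
      go 2 1 () _ _
      go 2 (suc (suc m)) e _ _ with trans (sym (lem m)) e
        where
        lem : ∀ m → 2 * suc (suc m) ≡ 4 + 2 * m
        lem = solve-∀
      ... | ()
      go 3 m e _ _ = refl
      go (suc (suc (suc (suc r)))) m e _ (s≤s (s≤s (s≤s ())))

    -- The second alternative may stand: r ≥ 4 gives r ^ 4 ≥ 256, far beyond what the generic shape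
    -- demands.
    divisor-of-4 : ∀ {r m} → Prime r → r * m ≡ 4 → r ≡ 2 ⊎ 4 ≤ r
    divisor-of-4 {r} {m} pr e = go r m e (prime≥2 pr)
      where
      go : ∀ r m → r * m ≡ 4 → 2 ≤ r → r ≡ 2 ⊎ 4 ≤ r
      go 0 m e ()
      go 1 m e (s≤s ())
      go 2 m e _ = inj₁ refl
      go 3 0 () _
      go 3 1 () _
      go 3 (suc (suc m)) e _ with trans (sym (lem m)) e
        where
        lem : ∀ m → 3 * suc (suc m) ≡ 6 + 3 * m
        lem = solve-∀
      ... | ()
      go (suc (suc (suc (suc r)))) m e _ = inj₂ (s≤s (s≤s (s≤s (s≤s z≤n))))

  shape : ∀ {r m k d} → Prime r → r * m ≡ d → 2 ≤ d → d ≤ k → Shape r k d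
  shape {r} {m} {0} {0} pr e () _
  shape {r} {m} {0} {suc d} pr e _ ()
  shape {r} {m} {1} {1} pr e (s≤s ()) _
  shape {r} {m} {1} {suc (suc d)} pr e _ (s≤s ())
  shape {d = 1} pr e (s≤s ()) _
  shape {r} {m} {2} {2} pr e _ _ = two-two (divisor-of-2 {m = m} pr e) refl refl
  shape {r} {m} {2} {suc (suc (suc d))} pr e _ (s≤s (s≤s ()))
  shape {r} {m} {3} {2} pr e _ _ with divisor-of-2 {m = m} pr e
  ... | refl = generic (ℕ.m≤m+n 36 4)
  shape {r} {m} {3} {3} pr e _ _ with divisor-of-3 {m = m} pr e
  ... | refl = generic (ℕ.m≤m+n 54 81)
  shape {r} {m} {3} {suc (suc (suc (suc d)))} pr e _ (s≤s (s≤s (s≤s ())))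
  shape {r} {m} {4} {2} pr e _ _ with divisor-of-2 {m = m} pr e
  ... | refl = generic (ℕ.m≤m+n 48 32)
  shape {r} {m} {4} {3} pr e _ _ with divisor-of-3 {m = m} pr e
  ... | refl = generic (ℕ.m≤m+n 72 333)
  shape {r} {m} {4} {4} pr e _ _ with divisor-of-4 {m = m} pr e
  ... | inj₁ r≡2 = four-four r≡2 refl refl
  ... | inj₂ 4≤r = generic (ℕ.≤-trans (ℕ.m≤m+n 96 1184) (ℕ.*-monoʳ-≤ 5 (ℕ.^-monoˡ-≤ 4 4≤r)))
  shape {r} {m} {4} {suc (suc (suc (suc (suc d))))} pr e _ (s≤s (s≤s (s≤s (s≤s ()))))
  shape {r} {m} {suc (suc (suc (suc (suc k))))} {d} pr e _ d≤k = generic (ℕ.≤-trans (ℕ.*-monoʳ-≤ 6 (ℕ.*-monoˡ-≤ (5 + k) d≤k))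
    (ℕ.≤-trans (6k²≤5·2^k k) (ℕ.*-monoʳ-≤ 5 (ℕ.^-monoˡ-≤ (5 + k) (prime≥2 pr)))))

  -- T is at most n / d + s + 1, so d - 1 multiples miss about n / d elements, and n / d exceeds the
  -- accumulated error.
  pair-contradiction : ∀ {d n q σ T k s} → q ≡ suc (d * n) → σ ≤ n → q * T ≤ σ * σ + q * (s + 1) → n ≤ k * T + 1 → k < d →
                       d * d * (s + 1) + d < n → ⊥
  pair-contradiction {suc d} {n} {q} {σ} {T} {k} {s} q≡ σ≤n qT n≤ (s≤s k≤d) big = ℕ.<⇒≱ big (ℕ.+-cancelˡ-≤ (d * n) _ _ (begin
    d * n + n ≡⟨ ℕ.+-comm (d * n) n ⟩
    suc d * n ≤⟨ ℕ.*-cancelˡ-≤ q {{q≢0}} step ⟩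
    d * n + suc d * d * (s + 1) + suc d ≤⟨ ℕ.+-monoˡ-≤ (suc d) (ℕ.+-monoʳ-≤ (d * n) (ℕ.*-monoˡ-≤ (s + 1) (ℕ.*-monoʳ-≤ (suc d) (ℕ.n≤1+n d)))) ⟩
    d * n + suc d * suc d * (s + 1) + suc d ≡⟨ ℕ.+-assoc (d * n) _ _ ⟩
    d * n + (suc d * suc d * (s + 1) + suc d) ∎))
    where
    open ℕ.≤-Reasoning
    q≢0 : NonZero q
    q≢0 = subst NonZero (sym q≡) (record { nonZero = _ })
    lem₁ : ∀ q d T → q * (suc d * (d * T + 1)) ≡ suc d * d * (q * T) + q * suc d
    lem₁ = solve-∀
    lem₂ : ∀ q d n s → suc d * d * (n * n + q * (s + 1)) + q * suc d ≡ d * (suc d * n * n) + (q * (suc d * d * (s + 1)) + q * suc d)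
    lem₂ = solve-∀
    lem₃ : ∀ q d n s → d * (q * n) + (q * (suc d * d * (s + 1)) + q * suc d) ≡ q * (d * n + suc d * d * (s + 1) + suc d)
    lem₃ = solve-∀
    step : q * (suc d * n) ≤ q * (d * n + suc d * d * (s + 1) + suc d)
    step = begin
      q * (suc d * n) ≤⟨ ℕ.*-monoʳ-≤ q (ℕ.*-monoʳ-≤ (suc d) (ℕ.≤-trans n≤ (ℕ.+-monoˡ-≤ 1 (ℕ.*-monoˡ-≤ T k≤d)))) ⟩
      q * (suc d * (d * T + 1)) ≡⟨ lem₁ q d T ⟩
      suc d * d * (q * T) + q * suc d ≤⟨ ℕ.+-monoˡ-≤ (q * suc d) (ℕ.*-monoʳ-≤ (suc d * d) (ℕ.≤-trans qT (ℕ.+-monoˡ-≤ (q * (s + 1)) (ℕ.*-mono-≤ σ≤n σ≤n)))) ⟩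
      suc d * d * (n * n + q * (s + 1)) + q * suc d ≡⟨ lem₂ q d n s ⟩
      d * (suc d * n * n) + (q * (suc d * d * (s + 1)) + q * suc d) ≤⟨ ℕ.+-monoˡ-≤ _ (ℕ.*-monoʳ-≤ d (ℕ.*-monoˡ-≤ n (ℕ.≤-trans (ℕ.n≤1+n (suc d * n)) (ℕ.≤-reflexive (sym q≡))))) ⟩
      d * (q * n) + (q * (suc d * d * (s + 1)) + q * suc d) ≡⟨ lem₃ q d n s ⟩
      q * (d * n + suc d * d * (s + 1) + suc d) ∎

  -- Up to errors k N ≤ k q / L ≤ (5 / 6) (q / d), so a sixth of the shifted subgroup stays
  -- uncovered.
  chain-contradiction : ∀ {d n q k L N e} → 1 ≤ L → 1 ≤ d → q ≡ suc (d * n) → 6 * (d * k) ≤ 5 * L → L * N ≤ q + 2 * (L * e) → n ≤ k * N + 1 →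
                        12 + 12 * (k * e) < n → ⊥
  chain-contradiction {d} {n} {q} {k} {L} {N} {e} 1≤L 1≤d refl 6dk≤5L LN n≤ big = ℕ.<⇒≱ big (ℕ.*-cancelˡ-≤ (5 * L) {{ℕ.>-nonZero (ℕ.*-mono-≤ (s≤s (z≤n {4})) 1≤L)}} (ℕ.+-cancelˡ-≤ (25 * (L * n)) _ _ (begin
    25 * (L * n) + 5 * L * n ≡⟨ lem₁ L n ⟩
    30 * (L * n) ≤⟨ ℕ.*-monoʳ-≤ 30 (ℕ.*-monoʳ-≤ L n≤) ⟩
    30 * (L * (k * N + 1)) ≡⟨ lem₂ L k N ⟩
    30 * (k * (L * N)) + 30 * L ≤⟨ ℕ.+-monoˡ-≤ (30 * L) (ℕ.*-monoʳ-≤ 30 (ℕ.*-monoʳ-≤ k LN)) ⟩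
    30 * (k * (suc (d * n) + 2 * (L * e))) + 30 * L ≡⟨ lem₃ d n k L e ⟩
    5 * n * (6 * (d * k)) + 30 * k + (60 * (k * (L * e)) + 30 * L) ≤⟨ ℕ.+-monoˡ-≤ _ (ℕ.+-mono-≤ (ℕ.*-monoʳ-≤ (5 * n) 6dk≤5L) (ℕ.*-monoʳ-≤ 30 k≤L)) ⟩
    5 * n * (5 * L) + 30 * L + (60 * (k * (L * e)) + 30 * L) ≡⟨ lem₄ n L k e ⟩
    25 * (L * n) + 5 * L * (12 + 12 * (k * e)) ∎)))
    where
    open ℕ.≤-Reasoning
    lem₁ : ∀ L n → 25 * (L * n) + 5 * L * n ≡ 30 * (L * n)
    lem₁ = solve-∀
    lem₂ : ∀ L k N → 30 * (L * (k * N + 1)) ≡ 30 * (k * (L * N)) + 30 * L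
    lem₂ = solve-∀
    lem₃ : ∀ d n k L e → 30 * (k * (suc (d * n) + 2 * (L * e))) + 30 * L ≡ 5 * n * (6 * (d * k)) + 30 * k + (60 * (k * (L * e)) + 30 * L)
    lem₃ = solve-∀
    lem₄ : ∀ n L k e → 5 * n * (5 * L) + 30 * L + (60 * (k * (L * e)) + 30 * L) ≡ 25 * (L * n) + 5 * L * (12 + 12 * (k * e))
    lem₄ = solve-∀
    k≤L : k ≤ L
    k≤L = ℕ.*-cancelˡ-≤ 5 (ℕ.≤-trans (ℕ.*-monoʳ-≤ 5 (ℕ.≤-trans (ℕ.≤-reflexive (sym (ℕ.*-identityˡ k))) (ℕ.*-monoˡ-≤ k 1≤d))) (ℕ.≤-trans (ℕ.*-monoˡ-≤ (d * k) (ℕ.n≤1+n 5)) 6dk≤5L))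

  -- N is at most about q / 16 and N′ half of that, so four multiples cover about q / 8, only half
  -- of n.
  four-contradiction : ∀ {n q N N′ e} → q ≡ suc (4 * n) → 16 * N ≤ q + 2 * (16 * e) → 2 * N′ ≤ N + 2 * e → n ≤ 4 * N′ + 1 → 10 + 16 * e < n → ⊥
  four-contradiction {n} {q} {N} {N′} {e} refl hN hN′ n≤ big = ℕ.<⇒≱ big (ℕ.*-cancelˡ-≤ 4 (ℕ.+-cancelˡ-≤ (4 * n) _ _ (begin
    4 * n + 4 * n ≡⟨ lem₁ n ⟩
    8 * n ≤⟨ ℕ.*-monoʳ-≤ 8 n≤ ⟩
    8 * (4 * N′ + 1) ≡⟨ lem₂ N′ ⟩
    16 * (2 * N′) + 8 ≤⟨ ℕ.+-monoˡ-≤ 8 (ℕ.*-monoʳ-≤ 16 hN′) ⟩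
    16 * (N + 2 * e) + 8 ≡⟨ lem₃ N e ⟩
    16 * N + (32 * e + 8) ≤⟨ ℕ.+-monoˡ-≤ (32 * e + 8) hN ⟩
    suc (4 * n) + 2 * (16 * e) + (32 * e + 8) ≤⟨ ℕ.m≤m+n _ 31 ⟩
    suc (4 * n) + 2 * (16 * e) + (32 * e + 8) + 31 ≡⟨ lem₄ n e ⟩
    4 * n + 4 * (10 + 16 * e) ∎)))
    where
    open ℕ.≤-Reasoning
    lem₁ : ∀ n → 4 * n + 4 * n ≡ 8 * n
    lem₁ = solve-∀
    lem₂ : ∀ N → 8 * (4 * N + 1) ≡ 16 * (2 * N) + 8
    lem₂ = solve-∀
    lem₃ : ∀ N e → 16 * (N + 2 * e) + 8 ≡ 16 * N + (32 * e + 8)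
    lem₃ = solve-∀
    lem₄ : ∀ n e → suc (4 * n) + 2 * (16 * e) + (32 * e + 8) + 31 ≡ 4 * n + 4 * (10 + 16 * e)
    lem₄ = solve-∀

  -- N and N′ are at most about q / 4, and N″ half of N′. The total 3 q / 8 is below n, which is
  -- about q / 2.
  two-contradiction : ∀ {n q N N′ N″ e} → q ≡ suc (2 * n) → 4 * N ≤ q + 2 * (4 * e) → 4 * N′ ≤ q + 2 * (4 * e) → 2 * N″ ≤ N′ + 2 * e →
                      n ≤ N + N″ + 2 → 10 + 16 * e < n → ⊥
  two-contradiction {n} {q} {N} {N′} {N″} {e} refl hN hN′ hN″ n≤ big = ℕ.<⇒≱ big (ℕ.*-cancelˡ-≤ 2 (ℕ.+-cancelˡ-≤ (6 * n) _ _ (begin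
    6 * n + 2 * n ≡⟨ lem₁ n ⟩
    8 * n ≤⟨ ℕ.*-monoʳ-≤ 8 n≤ ⟩
    8 * (N + N″ + 2) ≡⟨ lem₂ N N″ ⟩
    2 * (4 * N) + 4 * (2 * N″) + 16 ≤⟨ ℕ.+-monoˡ-≤ 16 (ℕ.+-mono-≤ (ℕ.*-monoʳ-≤ 2 hN) (ℕ.*-monoʳ-≤ 4 hN″)) ⟩
    2 * Z + 4 * (N′ + 2 * e) + 16 ≡⟨ lem₃ Z N′ e ⟩
    2 * Z + 4 * N′ + (8 * e + 16) ≤⟨ ℕ.+-monoˡ-≤ (8 * e + 16) (ℕ.+-monoʳ-≤ (2 * Z) hN′) ⟩
    2 * Z + Z + (8 * e + 16) ≤⟨ ℕ.m≤m+n _ 1 ⟩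
    2 * Z + Z + (8 * e + 16) + 1 ≡⟨ lem₄ n e ⟩
    6 * n + 2 * (10 + 16 * e) ∎)))
    where
    open ℕ.≤-Reasoning
    Z = suc (2 * n) + 2 * (4 * e)
    lem₁ : ∀ n → 6 * n + 2 * n ≡ 8 * n
    lem₁ = solve-∀
    lem₂ : ∀ N M → 8 * (N + M + 2) ≡ 2 * (4 * N) + 4 * (2 * M) + 16
    lem₂ = solve-∀
    lem₃ : ∀ Z N e → 2 * Z + 4 * (N + 2 * e) + 16 ≡ 2 * Z + 4 * N + (8 * e + 16)
    lem₃ = solve-∀
    lem₄ : ∀ n e → 2 * (suc (2 * n) + 2 * (4 * e)) + (suc (2 * n) + 2 * (4 * e)) + (8 * e + 16) + 1 ≡ 6 * n + 2 * (10 + 16 * e)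
    lem₄ = solve-∀

  -- The argument needs 21952 = 64 * 7 ^ 3 < scale, for triple-contradiction.
  abstract
    scale : ℕ
    scale = 50000

    ≤scale : ∀ {k} → k ≤ 50000 → k ≤ scale
    ≤scale le = le

  x≤x*y : ∀ x {y} → 1 ≤ y → x ≤ x * y
  x≤x*y x {suc y} _ = ℕ.m≤m*n x (suc y)

  module Sizes {K d s n} (1≤K : 1 ≤ K) (2≤d : 2 ≤ d) (large : scale * (K * K * K * (d * d * d * d * d)) < s) (s²≤q : s * s ≤ suc (d * n)) where

    -- 7 = 2 + 2 + 3: in `error-small` the terms 2 K d s, 3 s and the rest without s are bounded by
    -- 2, 2 and 3 times K d s. Y is the yardstick for n: from s > scale K³ d⁵ and d n + 1 ≥ s²
    -- follows n ≥ scale Y.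
    e Y : ℕ
    e = 7 * (K * (d * s))
    Y = K * K * K * (d * d * d * d) * s

    private
      1≤d : 1 ≤ d
      1≤d = ℕ.≤-trans (s≤s z≤n) 2≤d

      Z : ℕ
      Z = K * K * K * (d * d * d * d * d)

      infixl 7 _⊙_
      _⊙_ : ∀ {x y} → 1 ≤ x → 1 ≤ y → 1 ≤ x * y
      p ⊙ q = ℕ.*-mono-≤ p q

      1≤Z : 1 ≤ Z
      1≤Z = (1≤K ⊙ 1≤K ⊙ 1≤K) ⊙ (1≤d ⊙ 1≤d ⊙ 1≤d ⊙ 1≤d ⊙ 1≤d)

      scaled≤s : ∀ k → k ≤ scale → k ≤ s
      scaled≤s k le = ℕ.≤-trans le (ℕ.≤-trans (x≤x*y scale 1≤Z) (ℕ.<⇒≤ large))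

      1≤s : 1 ≤ s
      1≤s = scaled≤s 1 (≤scale (s≤s z≤n))

      1≤Y : 1 ≤ Y
      1≤Y = (1≤K ⊙ 1≤K ⊙ 1≤K) ⊙ (1≤d ⊙ 1≤d ⊙ 1≤d ⊙ 1≤d) ⊙ 1≤s

      n-large : scale * Y ≤ n
      n-large = ℕ.*-cancelˡ-≤ d {{ℕ.>-nonZero 1≤d}} (ℕ.+-cancelˡ-≤ 1 _ _ (begin
        1 + d * (scale * Y) ≡⟨ cong suc (lem scale K d s) ⟩
        1 + s * (scale * Z) ≤⟨ ℕ.+-monoˡ-≤ (s * (scale * Z)) 1≤s ⟩
        s + s * (scale * Z) ≡⟨ sym (ℕ.*-suc s (scale * Z)) ⟩
        s * suc (scale * Z) ≤⟨ ℕ.*-monoʳ-≤ s large ⟩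
        s * s ≤⟨ s²≤q ⟩
        1 + d * n ∎))
        where
        open ℕ.≤-Reasoning
        lem : ∀ c K d s → d * (c * (K * K * K * (d * d * d * d) * s)) ≡ s * (c * (K * K * K * (d * d * d * d * d)))
        lem = solve-∀

      below-n : ∀ {x} k → x ≤ k * Y → k < scale → x < n
      below-n k x≤ k< = ℕ.≤-<-trans x≤ (ℕ.<-≤-trans (ℕ.*-monoˡ-< Y {{ℕ.>-nonZero 1≤Y}} k<) n-large)

      dds≤Y : d * d * s ≤ Y
      dds≤Y = ℕ.≤-trans (x≤x*y (d * d * s) ((1≤K ⊙ 1≤K ⊙ 1≤K) ⊙ (1≤d ⊙ 1≤d))) (ℕ.≤-reflexive (lem K d s))
        where
        lem : ∀ K d s → d * d * s * (K * K * K * (d * d)) ≡ K * K * K * (d * d * d * d) * s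
        lem = solve-∀

      KKds≤Y : K * (K * (d * s)) ≤ Y
      KKds≤Y = ℕ.≤-trans (x≤x*y (K * (K * (d * s))) (1≤K ⊙ (1≤d ⊙ 1≤d ⊙ 1≤d))) (ℕ.≤-reflexive (lem K d s))
        where
        lem : ∀ K d s → K * (K * (d * s)) * (K * (d * d * d)) ≡ K * K * K * (d * d * d * d) * s
        lem = solve-∀

    1≤n : 1 ≤ n
    1≤n = below-n 0 z≤n (≤scale (s≤s z≤n))

    degree-small : K * d + 1 + 2 ≤ s
    degree-small = begin
      K * d + 1 + 2 ≡⟨ ℕ.+-assoc (K * d) 1 2 ⟩
      K * d + 3 ≤⟨ ℕ.+-mono-≤ Kd≤Z (ℕ.*-monoʳ-≤ 3 1≤Z) ⟩
      Z + 3 * Z ≤⟨ ℕ.*-monoˡ-≤ Z (≤scale (ℕ.m≤m+n 4 49996)) ⟩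
      scale * Z ≤⟨ ℕ.<⇒≤ large ⟩
      s ∎
      where
      open ℕ.≤-Reasoning
      lem : ∀ K d → K * d * (K * K * (d * d * d * d)) ≡ K * K * K * (d * d * d * d * d)
      lem = solve-∀
      Kd≤Z : K * d ≤ Z
      Kd≤Z = ℕ.≤-trans (x≤x*y (K * d) ((1≤K ⊙ 1≤K) ⊙ (1≤d ⊙ 1≤d ⊙ 1≤d ⊙ 1≤d))) (ℕ.≤-reflexive (lem K d))

    error-small : (s + 2) * (2 * (K * d + 1) + 1) + K + 2 ≤ e
    error-small = begin
      (s + 2) * (2 * (K * d + 1) + 1) + K + 2 ≡⟨ lem₁ s K (K * d) ⟩
      2 * X * s + 3 * s + (4 * X + 8 * 1 + K) ≤⟨ ℕ.+-mono-≤ (ℕ.+-monoʳ-≤ (2 * X * s) (ℕ.*-monoˡ-≤ s (ℕ.≤-trans (ℕ.n≤1+n 3) (ℕ.*-monoʳ-≤ 2 2≤X))))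
                                                                 (ℕ.+-mono-≤ (ℕ.+-monoʳ-≤ (4 * X) (ℕ.*-monoʳ-≤ 8 (1≤K ⊙ 1≤d))) (x≤x*y K 1≤d)) ⟩
      2 * X * s + 2 * X * s + (4 * X + 8 * X + X) ≡⟨ lem₂ X s ⟩
      4 * (X * s) + X * 13 ≤⟨ ℕ.+-monoʳ-≤ (4 * (X * s)) (ℕ.*-monoʳ-≤ X (ℕ.≤-trans (scaled≤s 13 (≤scale (ℕ.m≤m+n 13 49987))) (ℕ.m≤n*m s 3))) ⟩
      4 * (X * s) + X * (3 * s) ≡⟨ lem₃ K d s ⟩
      e ∎
      where
      open ℕ.≤-Reasoning
      X = K * d
      2≤X : 2 ≤ X
      2≤X = ℕ.≤-trans 2≤d (ℕ.m≤n*m d K {{ℕ.>-nonZero 1≤K}})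
      lem₁ : ∀ s K X → (s + 2) * (2 * (X + 1) + 1) + K + 2 ≡ 2 * X * s + 3 * s + (4 * X + 8 * 1 + K)
      lem₁ = solve-∀
      lem₂ : ∀ X s → 2 * X * s + 2 * X * s + (4 * X + 8 * X + X) ≡ 4 * (X * s) + X * 13
      lem₂ = solve-∀
      lem₃ : ∀ K d s → 4 * (K * d * s) + K * d * (3 * s) ≡ 7 * (K * (d * s))
      lem₃ = solve-∀

    pair-size : d * d * (s + 1) + d < n
    pair-size = below-n 3 (begin
      d * d * (s + 1) + d ≡⟨ cong (_+ d) (lem d s) ⟩
      d * d * s + d * d + d ≤⟨ ℕ.+-mono-≤ (ℕ.+-monoʳ-≤ (d * d * s) (x≤x*y (d * d) 1≤s)) (ℕ.≤-trans (x≤x*y d 1≤d) (x≤x*y (d * d) 1≤s)) ⟩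
      d * d * s + d * d * s + d * d * s ≤⟨ ℕ.+-mono-≤ (ℕ.+-mono-≤ dds≤Y dds≤Y) dds≤Y ⟩
      Y + Y + Y ≡⟨ lem₂ Y ⟩
      3 * Y ∎) (≤scale (ℕ.m≤m+n 4 49996))
      where
      open ℕ.≤-Reasoning
      lem : ∀ d s → d * d * (s + 1) ≡ d * d * s + d * d
      lem = solve-∀
      lem₂ : ∀ Y → Y + Y + Y ≡ 3 * Y
      lem₂ = solve-∀

    private
      ke≤7Y : ∀ {k} → k ≤ K → k * e ≤ 7 * Y
      ke≤7Y {k} k≤K = begin
        k * e ≤⟨ ℕ.*-monoˡ-≤ e k≤K ⟩
        K * (7 * (K * (d * s))) ≡⟨ lem K (K * (d * s)) ⟩
        7 * (K * (K * (d * s))) ≤⟨ ℕ.*-monoʳ-≤ 7 KKds≤Y ⟩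
        7 * Y ∎
        where
        open ℕ.≤-Reasoning
        lem : ∀ K t → K * (7 * t) ≡ 7 * (K * t)
        lem = solve-∀

    chain-size : ∀ {k} → k ≤ K → 12 + 12 * (k * e) < n
    chain-size {k} k≤K = below-n 96 (begin
      12 + 12 * (k * e) ≤⟨ ℕ.+-mono-≤ (ℕ.*-monoʳ-≤ 12 1≤Y) (ℕ.*-monoʳ-≤ 12 (ke≤7Y k≤K)) ⟩
      12 * Y + 12 * (7 * Y) ≡⟨ lem Y ⟩
      96 * Y ∎) (≤scale (ℕ.m≤m+n 97 49903))
      where
      open ℕ.≤-Reasoning
      lem : ∀ Y → 12 * Y + 12 * (7 * Y) ≡ 96 * Y
      lem = solve-∀

    special-size : 10 + 16 * e < n
    special-size = below-n 122 (begin
      10 + 16 * e ≡⟨ cong (λ z → 10 + 16 * z) (sym (ℕ.*-identityˡ e)) ⟩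
      10 + 16 * (1 * e) ≤⟨ ℕ.+-mono-≤ (ℕ.*-monoʳ-≤ 10 1≤Y) (ℕ.*-monoʳ-≤ 16 (ke≤7Y 1≤K)) ⟩
      10 * Y + 16 * (7 * Y) ≡⟨ lem Y ⟩
      122 * Y ∎) (≤scale (ℕ.m≤m+n 123 49877))
      where
      open ℕ.≤-Reasoning
      lem : ∀ Y → 10 * Y + 16 * (7 * Y) ≡ 122 * Y
      lem = solve-∀

    -- On one side 2 d n² ≥ scale Y s² = scale d (K d s)³; on the other 2 d n² ≤ 8 d S² ≤ 8 d (2 e)³
    -- = 64 · 7³ d (K d s)³. This comparison dictates the powers K³ d⁵ in `large`.
    triple-contradiction : ∀ {S} → n ≤ S + 1 → S * S ≤ 2 * e * (2 * e * (2 * e)) → ⊥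
    triple-contradiction {S} n≤ S² = ℕ.<⇒≱ (ℕ.*-monoˡ-< (d * W) {{ℕ.>-nonZero (1≤d ⊙ 1≤W)}} (≤scale (ℕ.m≤m+n 21953 28047))) (begin
      scale * (d * W) ≡⟨ lem₁ scale K d s ⟩
      scale * Y * (s * s) ≤⟨ ℕ.*-mono-≤ n-large (ℕ.≤-trans s²≤q (ℕ.+-monoˡ-≤ (d * n) (1≤d ⊙ 1≤n))) ⟩
      n * (d * n + d * n) ≡⟨ lem₂ n d ⟩
      2 * d * (n * n) ≤⟨ ℕ.*-monoʳ-≤ (2 * d) (ℕ.*-mono-≤ n≤2S n≤2S) ⟩
      2 * d * (2 * S * (2 * S)) ≡⟨ lem₃ d S ⟩
      8 * d * (S * S) ≤⟨ ℕ.*-monoʳ-≤ (8 * d) S² ⟩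
      8 * d * (2 * e * (2 * e * (2 * e))) ≡⟨ lem₄ 7 d (K * (d * s)) ⟩
      21952 * (d * W) ∎)
      where
      open ℕ.≤-Reasoning
      W = K * (d * s) * (K * (d * s)) * (K * (d * s))
      1≤W : 1 ≤ W
      1≤W = (1≤K ⊙ (1≤d ⊙ 1≤s)) ⊙ (1≤K ⊙ (1≤d ⊙ 1≤s)) ⊙ (1≤K ⊙ (1≤d ⊙ 1≤s))
      1≤S : 1 ≤ S
      1≤S = ℕ.+-cancelʳ-≤ 1 1 S (ℕ.≤-trans (below-n 1 (ℕ.≤-trans 1≤Y (ℕ.≤-reflexive (sym (ℕ.*-identityˡ Y)))) (≤scale (ℕ.m≤m+n 2 49998))) n≤)
      n≤2S : n ≤ 2 * S
      n≤2S = ℕ.≤-trans n≤ (ℕ.≤-trans (ℕ.+-monoʳ-≤ S 1≤S) (ℕ.≤-reflexive (cong (S +_) (sym (ℕ.+-identityʳ S)))))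
      lem₁ : ∀ c K d s → c * (d * (K * (d * s) * (K * (d * s)) * (K * (d * s)))) ≡ c * (K * K * K * (d * d * d * d) * s) * (s * s)
      lem₁ = solve-∀
      lem₂ : ∀ n d → n * (d * n + d * n) ≡ 2 * d * (n * n)
      lem₂ = solve-∀
      lem₃ : ∀ d S → 2 * d * (2 * S * (2 * S)) ≡ 8 * d * (S * S)
      lem₃ = solve-∀
      lem₄ : ∀ c d t → 8 * d * (2 * (c * t) * (2 * (c * t) * (2 * (c * t)))) ≡ 64 * (c * c * c) * (d * (t * t * t))
      lem₄ = solve-∀

  private
    n<2^n : ∀ n → n < 2 ^ n
    n<2^n zero    = s≤s z≤n
    n<2^n (suc n) = ℕ.≤-trans (ℕ.+-mono-≤ (ℕ.≤-trans (s≤s z≤n) (n<2^n n)) (n<2^n n)) (ℕ.≤-reflexive (cong (2 ^ n +_) (sym (ℕ.+-identityʳ _))))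

    ^-distrib-* : ∀ x y n → (x * y) ^ n ≡ x ^ n * y ^ n
    ^-distrib-* x y zero    = refl
    ^-distrib-* x y (suc n) = trans (cong (x * y *_) (^-distrib-* x y n)) (lem x y (x ^ n) (y ^ n))
      where
      lem : ∀ x y a b → x * y * (a * b) ≡ x * a * (y * b)
      lem = solve-∀

    -- K is at most T times 2 ^ (K / T + 1); take T-th powers. With 2 ^ K ≤ 2 q this bounds any
    -- power of the logarithm by an explicit multiple of q.
    power-of-log : ∀ K T .{{_ : NonZero T}} → K ^ T ≤ T ^ T * (2 ^ T * 2 ^ K)
    power-of-log K T = begin
      K ^ T ≤⟨ ℕ.^-monoˡ-≤ T base ⟩
      (T * 2 ^ suc (K / T)) ^ T ≡⟨ ^-distrib-* T (2 ^ suc (K / T)) T ⟩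
      T ^ T * (2 ^ suc (K / T)) ^ T ≡⟨ cong (T ^ T *_) (ℕ.^-*-assoc 2 (suc (K / T)) T) ⟩
      T ^ T * 2 ^ (T + K / T * T) ≤⟨ ℕ.*-monoʳ-≤ (T ^ T) (ℕ.^-monoʳ-≤ 2 (ℕ.+-monoʳ-≤ T (DM.m/n*n≤m K T))) ⟩
      T ^ T * 2 ^ (T + K) ≡⟨ cong (T ^ T *_) (ℕ.^-distribˡ-+-* 2 T K) ⟩
      T ^ T * (2 ^ T * 2 ^ K) ∎
      where
      open ℕ.≤-Reasoning
      base : K ≤ T * 2 ^ suc (K / T)
      base = begin
        K ≡⟨ DM.m≡m%n+[m/n]*n K T ⟩
        K % T + K / T * T ≤⟨ ℕ.+-monoˡ-≤ (K / T * T) (ℕ.<⇒≤ (DM.m%n<n K T)) ⟩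
        suc (K / T) * T ≡⟨ ℕ.*-comm (suc (K / T)) T ⟩
        T * suc (K / T) ≤⟨ ℕ.*-monoʳ-≤ T (ℕ.<⇒≤ (n<2^n (suc (K / T)))) ⟩
        T * 2 ^ suc (K / T) ∎

  -- From q ≤ s (s + 2) ≤ 3 u² for s ≤ u = scale K³ d⁵.
  constant : ℕ
  constant = 3 * (scale * scale)

  threshold : ℕ → ℕ
  threshold b = constant ^ suc b * (T ^ T * (2 ^ T * 2))
    where T = 6 * suc b

  -- Otherwise q ≤ constant K ^ 6 d ^ 10. Raise this to the power b + 1: by the hypothesis on d the
  -- powers of d cancel, leaving q² ≤ q ^ (10 (a + 1)) ≤ constant ^ (b + 1) K ^ T ≤ threshold b · q.
  -- Since q² suffices for every a, the threshold depends on b alone.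
  threshold-large : ∀ a b {q d K s} → threshold b < q → 1 ≤ d → 1 ≤ K → 2 ^ K ≤ 2 * q → q ≤ s * (s + 2) →
                    d ^ (10 * suc b) * q ^ (10 * suc a) ≤ q ^ suc b → scale * (K * K * K * (d * d * d * d * d)) < s
  threshold-large a b {q} {d} {K} {s} Q<q 1≤d 1≤K 2^K q≤ hyp = ℕ.≰⇒> (λ s≤u → ℕ.<⇒≱ Q<q (q≤Q s≤u))
    where
    open ℕ.≤-Reasoning
    T = 6 * suc b
    Z = K * K * K * (d * d * d * d * d)
    u = scale * Z
    instance
      q≢0 : NonZero q
      q≢0 = ℕ.>-nonZero (ℕ.≤-<-trans z≤n Q<q)
      d≢0 : NonZero d
      d≢0 = ℕ.>-nonZero 1≤d
      K≢0 : NonZero K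
      K≢0 = ℕ.>-nonZero 1≤K
      dᵉ≢0 : NonZero (d ^ (10 * suc b))
      dᵉ≢0 = ℕ.m^n≢0 d (10 * suc b)
    1≤u : 1 ≤ u
    1≤u = ℕ.*-mono-≤ (≤scale (s≤s z≤n)) (ℕ.*-mono-≤ (ℕ.*-mono-≤ (ℕ.*-mono-≤ 1≤K 1≤K) 1≤K) (ℕ.*-mono-≤ (ℕ.*-mono-≤ (ℕ.*-mono-≤ (ℕ.*-mono-≤ 1≤d 1≤d) 1≤d) 1≤d) 1≤d))
    q-bound : s ≤ u → q ≤ constant * (K ^ 6 * d ^ 10)
    q-bound s≤u = begin
      q ≤⟨ q≤ ⟩
      s * (s + 2) ≤⟨ ℕ.*-mono-≤ s≤u (ℕ.+-mono-≤ s≤u (ℕ.*-monoʳ-≤ 2 1≤u)) ⟩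
      u * (u + 2 * u) ≡⟨ lem₁ scale Z ⟩
      constant * (Z * Z) ≡⟨ cong (constant *_) (lem₂ K d) ⟩
      constant * (K ^ 6 * d ^ 10) ∎
      where
      lem₁ : ∀ c Z → c * Z * (c * Z + 2 * (c * Z)) ≡ 3 * (c * c) * (Z * Z)
      lem₁ = solve-∀
      lem₂ : ∀ K d → K * K * K * (d * d * d * d * d) * (K * K * K * (d * d * d * d * d)) ≡
                     K * (K * (K * (K * (K * (K * 1))))) * (d * (d * (d * (d * (d * (d * (d * (d * (d * (d * 1))))))))))
      lem₂ = solve-∀
    q≤Q : s ≤ u → q ≤ threshold b
    q≤Q s≤u = ℕ.*-cancelʳ-≤ q (threshold b) q (begin
      q * q ≡⟨ cong (q *_) (sym (ℕ.*-identityʳ q)) ⟩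
      q ^ 2 ≤⟨ ℕ.^-monoʳ-≤ q {2} {10 * suc a} (ℕ.≤-trans (ℕ.m≤m+n 2 8) (ℕ.*-monoʳ-≤ 10 (s≤s z≤n))) ⟩
      q ^ (10 * suc a) ≤⟨ ℕ.*-cancelˡ-≤ (d ^ (10 * suc b)) step ⟩
      constant ^ suc b * K ^ T ≤⟨ ℕ.*-monoʳ-≤ (constant ^ suc b) (ℕ.≤-trans (power-of-log K T) (ℕ.*-monoʳ-≤ (T ^ T) (ℕ.*-monoʳ-≤ (2 ^ T) 2^K))) ⟩
      constant ^ suc b * (T ^ T * (2 ^ T * (2 * q))) ≡⟨ lem (constant ^ suc b) (T ^ T) (2 ^ T) q ⟩
      threshold b * q ∎)
      where
      lem : ∀ x y z q → x * (y * (z * (2 * q))) ≡ x * (y * (z * 2)) * q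
      lem = solve-∀
      step : d ^ (10 * suc b) * q ^ (10 * suc a) ≤ d ^ (10 * suc b) * (constant ^ suc b * K ^ T)
      step = begin
        d ^ (10 * suc b) * q ^ (10 * suc a) ≤⟨ hyp ⟩
        q ^ suc b ≤⟨ ℕ.^-monoˡ-≤ (suc b) (q-bound s≤u) ⟩
        (constant * (K ^ 6 * d ^ 10)) ^ suc b ≡⟨ ^-distrib-* constant (K ^ 6 * d ^ 10) (suc b) ⟩
        constant ^ suc b * (K ^ 6 * d ^ 10) ^ suc b ≡⟨ cong (constant ^ suc b *_) (trans (^-distrib-* (K ^ 6) (d ^ 10) (suc b)) (cong₂ _*_ (ℕ.^-*-assoc K 6 (suc b)) (ℕ.^-*-assoc d 10 (suc b)))) ⟩
        constant ^ suc b * (K ^ T * d ^ (10 * suc b)) ≡⟨ lem₂ (constant ^ suc b) (K ^ T) (d ^ (10 * suc b)) ⟩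
        d ^ (10 * suc b) * (constant ^ suc b * K ^ T) ∎
        where
        lem₂ : ∀ x y z → x * (y * z) ≡ z * (x * y)
        lem₂ = solve-∀

-- Multiplicative decompositions of the shifted subgroup.

module Decomposition (F : FiniteField) where
  open FieldBasics F
  open FieldPowers F
  open Counting F
  open Shifted F
  open PowerResidues F
  open TripleProduct F
  open Arithmetic
  open Sumℕ

  cover-count : ∀ {p q} {P : Pred Carrier p} {Q : Pred Carrier q} (P? : Decidable P) (Q? : Decidable Q) cs → All (_≢ 𝟘) cs →
                (∀ y → P y → Any (λ c → ∃ λ x → Q x × y ≡ c ⊗ x) cs) → ∑ (λ y → 𝟏 (P? y)) ≤ length cs * ∑ (λ x → 𝟏 (Q? x))
  cover-count P? Q? [] nz cover = ℕ.≤-reflexive (trans (∑-cong (λ y → 𝟏-no (P? y) (λ py → none (cover y py)))) (trans (∑-const 0) (ℕ.*-zeroʳ order)))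
    where
    none : ∀ {a} {R : Pred Carrier a} → ¬ Any R []
    none ()
  cover-count {Q = Q} P? Q? (c ∷ cs) (c≢0 ∷ nz) cover = begin
    ∑ (λ y → 𝟏 (P? y))
      ≤⟨ ∑-mono split ⟩
    ∑ (λ y → 𝟏 (head? y) + 𝟏 (tail? y))
      ≡⟨ ∑-+ (λ y → 𝟏 (head? y)) (λ y → 𝟏 (tail? y)) ⟩
    ∑ (λ y → 𝟏 (head? y)) + ∑ (λ y → 𝟏 (tail? y))
      ≡⟨ cong (_+ ∑ (λ y → 𝟏 (tail? y))) (sym (∑-scale (λ y → 𝟏 (head? y)) c c≢0)) ⟩
    ∑ (λ x → 𝟏 (head? (c ⊗ x))) + ∑ (λ y → 𝟏 (tail? y))
      ≤⟨ ℕ.+-mono-≤ (∑-mono (λ x → 𝟏-mono (head? (c ⊗ x)) (Q? x) (λ (x′ , qx′ , e) → subst Q (⊗-cancelˡ c≢0 (sym e)) qx′))) (cover-count tail? Q? cs nz (λ _ h → h)) ⟩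
    length (c ∷ cs) * ∑ (λ x → 𝟏 (Q? x)) ∎
    where
    open ℕ.≤-Reasoning
    head? : Decidable (λ y → ∃ λ x → Q x × y ≡ c ⊗ x)
    head? y = any? (λ x → Q? x ×-dec (y ≟ c ⊗ x))
    tail? : Decidable (λ y → Any (λ c → ∃ λ x → Q x × y ≡ c ⊗ x) cs)
    tail? y = Any.any? (λ c → any? (λ x → Q? x ×-dec (y ≟ c ⊗ x))) cs
    split : ∀ y → 𝟏 (P? y) ≤ 𝟏 (head? y) + 𝟏 (tail? y)
    split y with P? y
    ... | no _ = z≤n
    ... | yes py with cover y py
    ...   | here h  = ℕ.≤-trans (ℕ.≤-reflexive (sym (𝟏-yes (head? y) h))) (ℕ.m≤m+n (𝟏 (head? y)) (𝟏 (tail? y)))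
    ...   | there t = ℕ.≤-trans (ℕ.≤-reflexive (sym (𝟏-yes (tail? y) t))) (ℕ.m≤n+m (𝟏 (tail? y)) (𝟏 (head? y)))

  module _ {d n K s} (dn : d * n ≡ order ∸ 1) (2≤d : 2 ≤ d) (1≤K : 1 ≤ K) (q<2^K : order < 2 ^ K)
           (s²≤q : s * s ≤ order) (q≤ : order ≤ s * (s + 2)) (large : scale * (K * K * K * (d * d * d * d * d)) < s)
           {lam : Carrier} (lam≢0 : lam ≢ 𝟘) where

    private
      q≡ : order ≡ suc (d * n)
      q≡ = trans (sym suc-order∸1) (cong suc (sym dn))

    open Sizes {K} {d} {s} {n} 1≤K 2≤d large (subst (s * s ≤_) q≡ s²≤q)

    private
      1≤d : 1 ≤ d
      1≤d = ℕ.≤-trans (s≤s z≤n) 2≤d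

      D err : ℕ
      -- Room for the simple zero and at most K linear forms, each with an exponent of at most m r ≤
      -- d.
      D = K * d + 1
      err = (s + 2) * (2 * D + 1)

      err+K≤e : ∀ {k} → k ≤ K → err + k ≤ e
      err+K≤e k≤K = ℕ.≤-trans (ℕ.+-monoʳ-≤ err k≤K) (ℕ.≤-trans (ℕ.m≤m+n _ 2) error-small)

      2err+3≤2e : 2 * err + 3 ≤ 2 * e
      2err+3≤2e = begin
        2 * err + 3 ≤⟨ ℕ.+-monoʳ-≤ (2 * err) (ℕ.n≤1+n 3) ⟩
        2 * err + 4 ≡⟨ lem err ⟩
        2 * (err + 2) ≤⟨ ℕ.*-monoʳ-≤ 2 (ℕ.≤-trans (ℕ.+-monoˡ-≤ 2 (ℕ.m≤m+n err K)) error-small) ⟩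
        2 * e ∎
        where
        open ℕ.≤-Reasoning
        lem : ∀ x → 2 * x + 4 ≡ 2 * (x + 2)
        lem = solve-∀

    InS : Carrier → Set
    InS y = y ≢ 𝟘 × Residue d (y ⊕ lam)

    inS? : Decidable InS
    inS? y = ¬? (y ≟ 𝟘) ×-dec residue? d (y ⊕ lam)

    size : ℕ
    size = ∑ (λ y → 𝟏 (inS? y))

    size-lower : n ≤ size + 1
    size-lower = begin
      n ≤⟨ ℕ.*-cancelˡ-≤ d {{ℕ.>-nonZero 1≤d}} (ℕ.≤-trans (ℕ.≤-reflexive dn) (residues-lower d 1≤d)) ⟩
      residues d ≡⟨ sym (∑-translate (χ d) lam) ⟩
      ∑ (λ y → χ d (y ⊕ lam)) ≤⟨ ∑-mono split ⟩
      ∑ (λ y → 𝟏 (inS? y) + 𝟏 (y ≟ 𝟘)) ≡⟨ ∑-+ (λ y → 𝟏 (inS? y)) (λ y → 𝟏 (y ≟ 𝟘)) ⟩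
      size + ∑ (λ y → 𝟏 (y ≟ 𝟘)) ≡⟨ cong (size +_) (∑-indicator 𝟘) ⟩
      size + 1 ∎
      where
      open ℕ.≤-Reasoning
      split : ∀ y → χ d (y ⊕ lam) ≤ 𝟏 (inS? y) + 𝟏 (y ≟ 𝟘)
      split y = by-zero (y ≟ 𝟘)
        where
        by-zero : (z : Dec (y ≡ 𝟘)) → χ d (y ⊕ lam) ≤ 𝟏 (inS? y) + 𝟏 z
        by-zero (yes _) = ℕ.≤-trans (𝟏≤1 (residue? d (y ⊕ lam))) (ℕ.m≤n+m 1 (𝟏 (inS? y)))
        by-zero (no ne) = ℕ.≤-trans (𝟏-mono (residue? d (y ⊕ lam)) (inS? y) (ne ,_)) (ℕ.m≤m+n (𝟏 (inS? y)) 0)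

    private
      on : ℕ → List Carrier → ℕ
      on N cs = ∑ (λ x → 𝟏 (on? lam lam≢0 N cs x))

      inS-power : ∀ {r m y} → r * m ≡ d → InS y → (y ⊕ lam) ↑ (m * n) ≡ 𝟙
      inS-power {r} {m} {y} rm (_ , res) = trans (cong ((y ⊕ lam) ↑_) (ℕ.*-comm m n)) (trans (sym (^-assocʳ (y ⊕ lam) n m)) (trans (cong (_↑ m) (residue-power d dn res)) (↑-one m)))

      inS-power′ : ∀ {y} → InS y → (y ⊕ lam) ↑ n ≡ 𝟙
      inS-power′ (_ , res) = residue-power d dn res

      chain : ∀ {r N} → Prime r → r * N ≡ order ∸ 1 → r ≤ d → ∀ cs → AllPairs _≢_ cs → All (_≢ 𝟘) cs → length cs ≤ K →
              r ^ length cs * on N cs ≤ order + 2 * (r ^ length cs * e)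
      chain {r} {N} pr rN r≤d cs dist nz k≤K = chain-bound lam lam≢0 {r} {N} {s} {D} {e} pr rN s²≤q q≤ degree-small cs dist nz
        (ℕ.≤-trans (s≤s (ℕ.*-mono-≤ k≤K r≤d)) (ℕ.≤-reflexive (ℕ.+-comm 1 (K * d)))) (err+K≤e k≤K)

      prime≤d : ∀ {r m} → r * m ≡ d → r ≤ d
      prime≤d {r} {zero} rm = ⊥-elim (ℕ.<⇒≢ 1≤d (trans (sym (ℕ.*-zeroʳ r)) rm))
      prime≤d {r} {suc m} rm = ℕ.≤-trans (ℕ.m≤m*n r (suc m)) (ℕ.≤-reflexive rm)

      cofactor : ∀ {r m} → r * m ≡ d → r * (m * n) ≡ order ∸ 1
      cofactor {r} {m} rm = trans (sym (ℕ.*-assoc r m n)) (trans (cong (_* n) rm) dn)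

    module _ {P : Pred Carrier 0ℓ} (P? : Decidable P) where

      Closed : List Carrier → Set
      Closed cs = All (λ c → ∀ x → P x → InS (c ⊗ x)) cs

      Covers : List Carrier → Set
      Covers cs = ∀ y → InS y → Any (λ c → ∃ λ x → P x × y ≡ c ⊗ x) cs

      count : ℕ
      count = ∑ (λ x → 𝟏 (P? x))

      private
        -- From "d-th power" only "r-th power" is kept, where r m = d; a prime exponent is what the
        -- refinement can handle.
        closed-on : ∀ {r m cs} → r * m ≡ d → Closed cs → count ≤ on (m * n) cs
        closed-on {r} {m} {cs} rm closed = ∑-mono (λ x → 𝟏-mono (P? x) (on? lam lam≢0 (m * n) cs x) (λ px → All.map (λ c-closed → inS-power {r} {m} rm (c-closed x px)) closed))

        closed-chain : ∀ {r m} → Prime r → r * m ≡ d → ∀ cs → AllPairs _≢_ cs → All (_≢ 𝟘) cs → length cs ≤ K → Closed cs →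
                       r ^ length cs * count ≤ order + 2 * (r ^ length cs * e)
        closed-chain {r} {m} pr rm cs dist nz k≤K closed = ℕ.≤-trans (ℕ.*-monoʳ-≤ (r ^ length cs) (closed-on {r} {m} rm closed)) (chain {r} {m * n} pr (cofactor {r} {m} rm) (prime≤d {r} {m} rm) cs dist nz k≤K)

      -- For K multipliers r ^ K ≥ 2 ^ K > q, so the main term q / r ^ K is below 1 and only the
      -- error 2 e survives.
      closed-bound : ∀ cs → AllPairs _≢_ cs → All (_≢ 𝟘) cs → length cs ≡ K → Closed cs → count ≤ 2 * e
      closed-bound cs dist nz k≡K closed with prime-divisor d 2≤d
      ... | r , pr , m , rm = ℕ.≤-pred (ℕ.*-cancelˡ-< L count (suc (2 * e)) (begin-strict
        L * count ≤⟨ closed-chain {r} {m} pr rm cs dist nz (ℕ.≤-reflexive k≡K) closed ⟩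
        order + 2 * (L * e) <⟨ ℕ.+-monoˡ-< (2 * (L * e)) (ℕ.<-≤-trans q<2^K (ℕ.≤-trans (ℕ.≤-reflexive (cong (2 ^_) (sym k≡K))) (ℕ.^-monoˡ-≤ (length cs) (ℕ.nonTrivial⇒n>1 r {{prime⇒nonTrivial pr}})))) ⟩
        L + 2 * (L * e) ≡⟨ lem L e ⟩
        L * suc (2 * e) ∎))
        where
        open ℕ.≤-Reasoning
        L = r ^ length cs
        lem : ∀ L e → L + 2 * (L * e) ≡ L * suc (2 * e)
        lem = solve-∀

      private
        pair-case : ∀ {c₁ c₂ cs} → length (c₁ ∷ c₂ ∷ cs) < d → AllPairs _≢_ (c₁ ∷ c₂ ∷ cs) → All (_≢ 𝟘) (c₁ ∷ c₂ ∷ cs) → Closed (c₁ ∷ c₂ ∷ cs) →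
                    n ≤ length (c₁ ∷ c₂ ∷ cs) * count + 1 → ⊥
        pair-case {c₁} {c₂} {cs} k<d ((c₁≢c₂ ∷ _) ∷ _) (n₁ ∷ n₂ ∷ _) (cl₁ ∷ cl₂ ∷ _) n≤ =
          pair-contradiction {d} {n} {order} {residues d} {count} {length (c₁ ∷ c₂ ∷ cs)} {s} q≡ (residues-upper d dn 1≤n)
            (ℕ.≤-trans (ℕ.*-monoʳ-≤ order (∑-mono (λ x → 𝟏-mono (P? x) (residue? d (c₁ ⊗ x ⊕ lam) ×-dec residue? d (c₂ ⊗ x ⊕ lam)) (λ px → proj₂ (cl₁ x px) , proj₂ (cl₂ x px)))))
              (pair-bound d {s} q≤ lam≢0 n₁ n₂ c₁≢c₂))
            n≤ k<d pair-size

        -- Being squares at four multipliers leaves about q / 16 elements, just enough to cover S.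
        -- Asking in addition that c x + lam be a fourth power halves this; that is `refine-affine`
        -- with r = m = 2.
        four-case : ∀ {c cs} → d ≡ 4 → length (c ∷ cs) ≡ 4 → 4 ≤ K → AllPairs _≢_ (c ∷ cs) → All (_≢ 𝟘) (c ∷ cs) → Closed (c ∷ cs) →
                    n ≤ 4 * count + 1 → ⊥
        four-case {c} {cs} d≡4 k≡4 4≤K dist@(c∉ ∷ _) nz@(c≢0 ∷ _) closed@(cl ∷ cls) n≤ =
          four-contradiction {n} {order} {on (2 * n) (c ∷ cs)} {count} {e} (trans q≡ (cong (λ z → suc (z * n)) d≡4)) all-even one-fourth n≤ special-size
          where
          open ℕ.≤-Reasoning
          k≤K : length (c ∷ cs) ≤ K
          k≤K = ℕ.≤-trans (ℕ.≤-reflexive k≡4) 4≤K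
          4n : 2 * 2 * n ≡ order ∸ 1
          4n = trans (cong (_* n) (sym d≡4)) dn
          all-even : 16 * on (2 * n) (c ∷ cs) ≤ order + 2 * (16 * e)
          all-even = subst (λ k → 2 ^ k * on (2 * n) (c ∷ cs) ≤ order + 2 * (2 ^ k * e)) k≡4 (chain {2} {2 * n} prime[2] (cofactor {2} {2} (sym d≡4)) 2≤d (c ∷ cs) dist nz k≤K)
          N₁ N₂ N₃ : ℕ
          N₁ = ∑ (λ x → 𝟏 (on? lam lam≢0 (2 * n) cs x ×-dec ((c ⊗ x ⊕ lam) ↑ n ≟ 𝟙)))
          N₂ = ∑ (λ x → 𝟏 (on? lam lam≢0 (2 * n) cs x ×-dec (((c ⊗ x ⊕ lam) ↑ n) ↑ 2 ≟ 𝟙 ↑ 2)))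
          N₃ = ∑ (λ x → 𝟏 ((x ↑ n) ↑ 2 ≟ 𝟙 ↑ 2))
          square : ∀ x → (x ↑ n) ↑ 2 ≡ x ↑ (2 * n)
          square x = trans (^-assocʳ x n 2) (cong (x ↑_) (ℕ.*-comm n 2))
          -- N₃ contains the non-zero squares, of which there are at least (q - 1) / 2 = 2 n. This
          -- cancels the main term 2 n of Stepanov's bound.
          2n≤N₃ : 2 * n ≤ N₃
          2n≤N₃ = ℕ.≤-trans (ℕ.*-cancelˡ-≤ 2 (ℕ.≤-trans (ℕ.≤-reflexive (trans (sym (ℕ.*-assoc 2 2 n)) 4n)) (residues-lower 2 (s≤s z≤n))))
            (∑-mono (λ x → 𝟏-mono (residue? 2 x) ((x ↑ n) ↑ 2 ≟ 𝟙 ↑ 2) (λ res → trans (square x) (trans (residue-power 2 {2 * n} (trans (sym (ℕ.*-assoc 2 2 n)) 4n) res) (sym (↑-one 2))))))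
          one-fourth : 2 * count ≤ on (2 * n) (c ∷ cs) + 2 * e
          one-fourth = ℕ.+-cancelʳ-≤ (2 * n) _ _ (begin
            2 * count + 2 * n
              ≤⟨ ℕ.+-mono-≤ (ℕ.*-monoʳ-≤ 2 (∑-mono (λ x → 𝟏-mono (P? x) (on? lam lam≢0 (2 * n) cs x ×-dec ((c ⊗ x ⊕ lam) ↑ n ≟ 𝟙))
                   (λ px → All.map (λ c-closed → inS-power {2} {2} (sym d≡4) (c-closed x px)) cls , inS-power′ (cl x px))))) 2n≤N₃ ⟩
            2 * N₁ + N₃
              ≤⟨ refine-affine lam lam≢0 {2} {2} {n} {s} {D} prime[2] 4n s²≤q q≤ degree-small 1≢0 c≢0 cs c∉
                   (ℕ.≤-trans (s≤s (ℕ.*-mono-≤ (ℕ.≤-trans (ℕ.n≤1+n _) k≤K) (ℕ.≤-reflexive (sym d≡4)))) (ℕ.≤-reflexive (ℕ.+-comm 1 (K * d)))) ⟩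
            2 * (n + err) + (N₂ + length cs)
              ≤⟨ ℕ.+-monoʳ-≤ (2 * (n + err)) (ℕ.+-mono-≤ (∑-mono (λ x → 𝟏-mono (on? lam lam≢0 (2 * n) cs x ×-dec (((c ⊗ x ⊕ lam) ↑ n) ↑ 2 ≟ 𝟙 ↑ 2)) (on? lam lam≢0 (2 * n) (c ∷ cs) x)
                   (λ (o , e) → trans (sym (square _)) (trans e (↑-one 2)) ∷ o))) (ℕ.≤-reflexive (ℕ.suc-injective k≡4))) ⟩
            2 * (n + err) + (on (2 * n) (c ∷ cs) + 3)
              ≡⟨ lem n err (on (2 * n) (c ∷ cs)) ⟩
            on (2 * n) (c ∷ cs) + (2 * err + 3) + 2 * n
              ≤⟨ ℕ.+-monoˡ-≤ (2 * n) (ℕ.+-monoʳ-≤ (on (2 * n) (c ∷ cs)) 2err+3≤2e) ⟩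
            on (2 * n) (c ∷ cs) + 2 * e + 2 * n ∎)
            where
            lem : ∀ n x N → 2 * (n + x) + (N + 3) ≡ N + (2 * x + 3) + 2 * n
            lem = solve-∀

        ratio-⊗ : ∀ {c} (c≢0 : c ≢ 𝟘) c′ x → (c′ ⊗ inv c c≢0) ⊗ (c ⊗ x) ≡ c′ ⊗ x
        ratio-⊗ {c} c≢0 c′ x = trans (sym (*-assoc _ c x)) (cong (_⊗ x) (trans (*-assoc c′ _ c) (trans (cong (c′ ⊗_) (trans (*-comm _ c) (inv-r c c≢0))) (*-identityʳ c′))))

        ratio≢1 : ∀ {c c′} (c≢0 : c ≢ 𝟘) → c ≢ c′ → 𝟙 ≢ c′ ⊗ inv c c≢0
        ratio≢1 {c} {c′} c≢0 c≢c′ e = c≢c′ (trans (sym (*-identityˡ c)) (trans (cong (_⊗ c) e) (trans (*-assoc c′ _ c) (trans (cong (c′ ⊗_) (trans (*-comm _ c) (inv-r c c≢0))) (*-identityʳ c′)))))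

        -- For d = 2 and two multipliers, every y in S has ρ y or y / ρ in S, so that the sign pattern
        -- of (y / ρ + lam, y + lam, ρ y + lam) omits a positive proportion of S.
        two-case : ∀ {c₁ c₂} → d ≡ 2 → 2 ≤ K → AllPairs _≢_ (c₁ ∷ c₂ ∷ []) → All (_≢ 𝟘) (c₁ ∷ c₂ ∷ []) → Closed (c₁ ∷ c₂ ∷ []) → Covers (c₁ ∷ c₂ ∷ []) → ⊥
        two-case {c₁} {c₂} d≡2 2≤K ((c₁≢c₂ ∷ []) ∷ _) (n₁ ∷ n₂ ∷ []) (cl₁ ∷ cl₂ ∷ []) covers = finish
          where
          ρ ρ′ : Carrier
          ρ = c₂ ⊗ inv c₁ n₁
          ρ′ = c₁ ⊗ inv c₂ n₂
          2n : 2 * n ≡ order ∸ 1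
          2n = trans (cong (_* n) (sym d≡2)) dn
          quarter : ∀ {σ} → σ ≢ 𝟘 → 𝟙 ≢ σ → 4 * on n (𝟙 ∷ σ ∷ []) ≤ order + 2 * (4 * e)
          quarter {σ} nz ne = chain {2} {n} prime[2] 2n 2≤d (𝟙 ∷ σ ∷ []) ((ne ∷ []) ∷ [] ∷ []) (1≢0 ∷ nz ∷ []) 2≤K
          ρ≢0 : ρ ≢ 𝟘
          ρ≢0 = ⊗-nonzero n₂ (inv-nonzero c₁ n₁)
          ρ′≢0 : ρ′ ≢ 𝟘
          ρ′≢0 = ⊗-nonzero n₁ (inv-nonzero c₂ n₂)
          1≢ρ : 𝟙 ≢ ρ
          1≢ρ = ratio≢1 n₁ c₁≢c₂
          1≢ρ′ : 𝟙 ≢ ρ′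
          1≢ρ′ = ratio≢1 n₂ (λ e → c₁≢c₂ (sym e))
          neighbour : ∀ y → InS y → InS (ρ ⊗ y) ⊎ InS (ρ′ ⊗ y)
          neighbour y sy with covers y sy
          ... | here (x , px , refl)         = inj₁ (subst InS (sym (ratio-⊗ n₁ c₂ x)) (cl₂ x px))
          ... | there (here (x , px , refl)) = inj₂ (subst InS (sym (ratio-⊗ n₂ c₁ x)) (cl₁ x px))
          self : ∀ {y} → InS y → (𝟙 ⊗ y ⊕ lam) ↑ n ≡ 𝟙
          self {y} sy = trans (cong (λ z → (z ⊕ lam) ↑ n) (*-identityˡ y)) (inS-power′ sy)
          -- It holds for those y in S with y / ρ in S for which ρ y + lam is a non-square; the n-th
          -- power -1 marks the non-squares.
          pattern? : Decidable (λ y → On lam lam≢0 n (𝟙 ∷ ρ′ ∷ []) y × (ρ ⊗ y ⊕ lam) ↑ n ≡ ⊖ 𝟙)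
          pattern? y = on? lam lam≢0 n (𝟙 ∷ ρ′ ∷ []) y ×-dec ((ρ ⊗ y ⊕ lam) ↑ n ≟ ⊖ 𝟙)
          N″ : ℕ
          N″ = ∑ (λ y → 𝟏 (pattern? y))
          -- The last indicator takes care of the single y with ρ y + lam = 0, whose n-th power is
          -- neither 1 nor -1.
          pointwise : ∀ y → 𝟏 (inS? y) ≤ 𝟏 (on? lam lam≢0 n (𝟙 ∷ ρ ∷ []) y) + 𝟏 (pattern? y) + 𝟏 (ρ ⊗ y ⊕ lam ≟ 𝟘)
          pointwise y = by-membership (inS? y)
            where
            first : (ρ ⊗ y ⊕ lam) ↑ n ≡ 𝟙 → InS y → 1 ≤ 𝟏 (on? lam lam≢0 n (𝟙 ∷ ρ ∷ []) y) + 𝟏 (pattern? y) + 𝟏 (ρ ⊗ y ⊕ lam ≟ 𝟘)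
            first plus sy = ℕ.≤-trans (ℕ.≤-reflexive (sym (𝟏-yes (on? lam lam≢0 n (𝟙 ∷ ρ ∷ []) y) (self sy ∷ plus ∷ []))))
              (ℕ.≤-trans (ℕ.m≤m+n (𝟏 (on? lam lam≢0 n (𝟙 ∷ ρ ∷ []) y)) (𝟏 (pattern? y))) (ℕ.m≤m+n _ (𝟏 (ρ ⊗ y ⊕ lam ≟ 𝟘))))
            second : (ρ ⊗ y ⊕ lam) ↑ n ≡ ⊖ 𝟙 → InS y → InS (ρ′ ⊗ y) → 1 ≤ 𝟏 (on? lam lam≢0 n (𝟙 ∷ ρ ∷ []) y) + 𝟏 (pattern? y) + 𝟏 (ρ ⊗ y ⊕ lam ≟ 𝟘)
            second minus sy prev = ℕ.≤-trans (ℕ.≤-reflexive (sym (𝟏-yes (pattern? y) ((self sy ∷ inS-power′ prev ∷ []) , minus))))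
              (ℕ.≤-trans (ℕ.m≤n+m (𝟏 (pattern? y)) (𝟏 (on? lam lam≢0 n (𝟙 ∷ ρ ∷ []) y))) (ℕ.m≤m+n _ (𝟏 (ρ ⊗ y ⊕ lam ≟ 𝟘))))
            third : ρ ⊗ y ⊕ lam ≡ 𝟘 → 1 ≤ 𝟏 (on? lam lam≢0 n (𝟙 ∷ ρ ∷ []) y) + 𝟏 (pattern? y) + 𝟏 (ρ ⊗ y ⊕ lam ≟ 𝟘)
            third z = ℕ.≤-trans (ℕ.≤-reflexive (sym (𝟏-yes (ρ ⊗ y ⊕ lam ≟ 𝟘) z))) (ℕ.m≤n+m (𝟏 (ρ ⊗ y ⊕ lam ≟ 𝟘)) (𝟏 (on? lam lam≢0 n (𝟙 ∷ ρ ∷ []) y) + 𝟏 (pattern? y)))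
            by-sign : InS y → InS (ρ′ ⊗ y) → Dec (ρ ⊗ y ⊕ lam ≡ 𝟘) → 1 ≤ 𝟏 (on? lam lam≢0 n (𝟙 ∷ ρ ∷ []) y) + 𝟏 (pattern? y) + 𝟏 (ρ ⊗ y ⊕ lam ≟ 𝟘)
            by-sign sy prev (yes z) = third z
            by-sign sy prev (no nz) = Sum.[ (λ plus → first plus sy) , (λ minus → second minus sy prev) ]′
              (square-one ((ρ ⊗ y ⊕ lam) ↑ n) (all-nonzero-powers lam lam≢0 {2} {n} 2n (ρ ⊗ y ⊕ lam) nz))
            by-membership : (sy : Dec (InS y)) → 𝟏 sy ≤ 𝟏 (on? lam lam≢0 n (𝟙 ∷ ρ ∷ []) y) + 𝟏 (pattern? y) + 𝟏 (ρ ⊗ y ⊕ lam ≟ 𝟘)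
            by-membership (no _)   = z≤n
            by-membership (yes sy) = Sum.[ (λ next → first (inS-power′ next) sy) , (λ prev → by-sign sy prev (ρ ⊗ y ⊕ lam ≟ 𝟘)) ]′ (neighbour y sy)
          size≤ : size ≤ on n (𝟙 ∷ ρ ∷ []) + N″ + 1
          size≤ = begin
            size
              ≤⟨ ∑-mono pointwise ⟩
            ∑ (λ y → 𝟏 (on? lam lam≢0 n (𝟙 ∷ ρ ∷ []) y) + 𝟏 (pattern? y) + 𝟏 (ρ ⊗ y ⊕ lam ≟ 𝟘))
              ≡⟨ trans (∑-+ (λ y → 𝟏 (on? lam lam≢0 n (𝟙 ∷ ρ ∷ []) y) + 𝟏 (pattern? y)) (λ y → 𝟏 (ρ ⊗ y ⊕ lam ≟ 𝟘)))
                   (cong₂ _+_ (∑-+ (λ y → 𝟏 (on? lam lam≢0 n (𝟙 ∷ ρ ∷ []) y)) (λ y → 𝟏 (pattern? y))) (trans (∑-affine (λ z → 𝟏 (z ≟ 𝟘)) lam ρ≢0) (∑-indicator 𝟘))) ⟩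
            on n (𝟙 ∷ ρ ∷ []) + N″ + 1 ∎
            where open ℕ.≤-Reasoning
          -- The refinement step at the value ω = -1 instead of 1. It adds ρ to the multipliers 1
          -- and ρ′, from which ρ must differ.
          N″-bound : ρ ≢ ρ′ → 2 * N″ ≤ on n (𝟙 ∷ ρ′ ∷ []) + 2 * e
          N″-bound ρ≢ρ′ = begin
            2 * N″
              ≤⟨ refine-prime lam lam≢0 {2} {n} {s} {D} prime[2] 2n s²≤q q≤ degree-small ⊖𝟙≢0 ⊖𝟙² ρ≢0 (𝟙 ∷ ρ′ ∷ []) ((λ e → 1≢ρ (sym e)) ∷ ρ≢ρ′ ∷ [])
                   (ℕ.≤-trans (s≤s (ℕ.*-mono-≤ 2≤K 2≤d)) (ℕ.≤-reflexive (ℕ.+-comm 1 (K * d)))) ⟩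
            2 * err + (on n (𝟙 ∷ ρ′ ∷ []) + 2)
              ≤⟨ ℕ.+-monoʳ-≤ (2 * err) (ℕ.+-monoʳ-≤ (on n (𝟙 ∷ ρ′ ∷ [])) (ℕ.n≤1+n 2)) ⟩
            2 * err + (on n (𝟙 ∷ ρ′ ∷ []) + 3)
              ≡⟨ lem err (on n (𝟙 ∷ ρ′ ∷ [])) ⟩
            on n (𝟙 ∷ ρ′ ∷ []) + (2 * err + 3)
              ≤⟨ ℕ.+-monoʳ-≤ (on n (𝟙 ∷ ρ′ ∷ [])) 2err+3≤2e ⟩
            on n (𝟙 ∷ ρ′ ∷ []) + 2 * e ∎
            where
            open ℕ.≤-Reasoning
            lem : ∀ x N → 2 * x + (N + 3) ≡ N + (2 * x + 3)
            lem = solve-∀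
          equal-ratios : ρ ≡ ρ′ → size ≤ on n (𝟙 ∷ ρ ∷ [])
          equal-ratios eq = ∑-mono (λ y → 𝟏-mono (inS? y) (on? lam lam≢0 n (𝟙 ∷ ρ ∷ []) y) (λ sy → self sy ∷ next y (neighbour y sy) ∷ []))
            where
            next : ∀ y → InS (ρ ⊗ y) ⊎ InS (ρ′ ⊗ y) → (ρ ⊗ y ⊕ lam) ↑ n ≡ 𝟙
            next y (inj₁ i) = inS-power′ i
            next y (inj₂ i) = inS-power′ (subst (λ z → InS (z ⊗ y)) (sym eq) i)
          q≡2n : order ≡ suc (2 * n)
          q≡2n = trans q≡ (cong (λ z → suc (z * n)) d≡2)
          finish : ⊥
          finish with ρ ≟ ρ′
          -- Here ρ = 1 / ρ, so both neighbours coincide, every y in S has ρ y in S, and the sign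
          -- pattern does not occur: N″ is taken as 0.
          ... | yes eq = two-contradiction {n} {order} {on n (𝟙 ∷ ρ ∷ [])} {on n (𝟙 ∷ ρ ∷ [])} {0} {e} q≡2n (quarter ρ≢0 1≢ρ) (quarter ρ≢0 1≢ρ) z≤n
                (ℕ.≤-trans size-lower (ℕ.≤-trans (ℕ.+-mono-≤ (equal-ratios eq) (ℕ.n≤1+n 1)) (ℕ.≤-reflexive (cong (_+ 2) (sym (ℕ.+-identityʳ _)))))) special-size
          ... | no ne = two-contradiction {n} {order} {on n (𝟙 ∷ ρ ∷ [])} {on n (𝟙 ∷ ρ′ ∷ [])} {N″} {e} q≡2n (quarter ρ≢0 1≢ρ) (quarter ρ′≢0 1≢ρ′) (N″-bound ne)
                (ℕ.≤-trans size-lower (ℕ.≤-trans (ℕ.+-monoˡ-≤ 1 size≤) (ℕ.≤-reflexive (ℕ.+-assoc _ 1 1)))) special-size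

      few-impossible : ∀ cs → AllPairs _≢_ cs → All (_≢ 𝟘) cs → 2 ≤ length cs → length cs ≤ K → Closed cs → Covers cs → ⊥
      few-impossible cs dist nz 2≤k k≤K closed covers = go cs dist nz 2≤k k≤K closed covers (length cs ℕ.<? d)
        where
        n≤ : ∀ cs → All (_≢ 𝟘) cs → Covers cs → n ≤ length cs * count + 1
        n≤ cs nz covers = ℕ.≤-trans size-lower (ℕ.+-monoˡ-≤ 1 (cover-count inS? P? cs nz covers))
        go : ∀ cs → AllPairs _≢_ cs → All (_≢ 𝟘) cs → 2 ≤ length cs → length cs ≤ K → Closed cs → Covers cs → Dec (length cs < d) → ⊥
        go (c₁ ∷ c₂ ∷ cs) dist nz _ k≤K closed covers (yes k<d) = pair-case k<d dist nz closed (n≤ (c₁ ∷ c₂ ∷ cs) nz covers)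
        go (_ ∷ []) _ _ (s≤s ()) _ _ _ _
        go cs@(c₁ ∷ c₂ ∷ rest) dist nz _ k≤K closed covers (no k≮d) with prime-divisor d 2≤d
        ... | r , pr , m , rm with shape {r} {m} pr rm 2≤d (ℕ.≮⇒≥ k≮d)
        ...   | generic ineq = chain-contradiction {d} {n} {order} {length cs} {r ^ length cs} {count} {e} (ℕ.m^n>0 r {{prime⇒nonZero pr}} (length cs)) 1≤d q≡ ineq
                  (closed-chain {r} {m} pr rm cs dist nz k≤K closed) (n≤ cs nz covers) (chain-size k≤K)
        ...   | four-four _ k≡4 d≡4 = four-case d≡4 k≡4 (ℕ.≤-trans (ℕ.≤-reflexive (sym k≡4)) k≤K) dist nz closed
                  (subst (λ k → n ≤ k * count + 1) k≡4 (n≤ cs nz covers))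
        ...   | two-two _ k≡2 d≡2 = two rest (ℕ.suc-injective (ℕ.suc-injective k≡2)) dist nz closed covers
          where
          two : ∀ rest → length rest ≡ 0 → AllPairs _≢_ (c₁ ∷ c₂ ∷ rest) → All (_≢ 𝟘) (c₁ ∷ c₂ ∷ rest) → Closed (c₁ ∷ c₂ ∷ rest) → Covers (c₁ ∷ c₂ ∷ rest) → ⊥
          two [] _ dist nz closed covers = two-case d≡2 (ℕ.≤-trans (ℕ.≤-reflexive (sym k≡2)) k≤K) dist nz closed covers

    two-elements : ∀ {P : Pred Carrier 0ℓ} (P? : Decidable P) {a b} → a ≢ b → P a → P b → 2 ≤ length (members P?)
    two-elements {P} P? {a} {b} a≢b pa pb = begin
      2 ≡⟨ sym (cong₂ _+_ (∑-indicator a) (∑-indicator b)) ⟩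
      ∑ (λ x → 𝟏 (x ≟ a)) + ∑ (λ x → 𝟏 (x ≟ b)) ≡⟨ sym (∑-+ (λ x → 𝟏 (x ≟ a)) (λ x → 𝟏 (x ≟ b))) ⟩
      ∑ (λ x → 𝟏 (x ≟ a) + 𝟏 (x ≟ b)) ≤⟨ ∑-mono pointwise ⟩
      ∑ (λ x → 𝟏 (P? x)) ≡⟨ sym (length-members P?) ⟩
      length (members P?) ∎
      where
      open ℕ.≤-Reasoning
      pointwise : ∀ x → 𝟏 (x ≟ a) + 𝟏 (x ≟ b) ≤ 𝟏 (P? x)
      pointwise x = by-cases (x ≟ a) (x ≟ b)
        where
        by-cases : (u : Dec (x ≡ a)) (v : Dec (x ≡ b)) → 𝟏 u + 𝟏 v ≤ 𝟏 (P? x)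
        by-cases (yes refl) (yes eq)   = ⊥-elim (a≢b eq)
        by-cases (yes refl) (no _)     = ℕ.≤-reflexive (sym (𝟏-yes (P? a) pa))
        by-cases (no _)     (yes refl) = ℕ.≤-reflexive (sym (𝟏-yes (P? b) pb))
        by-cases (no _)     (no _)     = z≤n

    -- If X has at most K elements, its multiples of Y cannot cover S. Otherwise any K elements of X
    -- suffice to bound Y; covering is then irrelevant.
    factor-bound : ∀ {X Y : Pred Carrier 0ℓ} (X? : Decidable X) (Y? : Decidable Y) → (∀ x → X x → x ≢ 𝟘) → 2 ≤ length (members X?) →
                   (∀ x y → X x → Y y → InS (x ⊗ y)) → (∀ z → InS z → ∃ λ x → ∃ λ y → X x × Y y × z ≡ x ⊗ y) → ∑ (λ y → 𝟏 (Y? y)) ≤ 2 * e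
    factor-bound {X} {Y} X? Y? units two closed covers with length (members X?) ℕ.≤? K
    ... | yes le = ⊥-elim (few-impossible Y? (members X?) (members-distinct X?) (All.map (units _) (members-satisfy X?)) two le
            (All.map (λ {c} xc y yy → closed c y xc yy) (members-satisfy X?)) covers′)
      where
      covers′ : Covers Y? (members X?)
      covers′ z sz with covers z sz
      ... | x , y , xx , yy , refl = Any.map (λ { refl → y , yy , refl }) (∈-members X? xx)
    ... | no ¬le = closed-bound Y? (take K (members X?)) (AllPairsₚ.take⁺ K (members-distinct X?)) (Allₚ.take⁺ K (All.map (units _) (members-satisfy X?)))
            (trans (Listₚ.length-take K (members X?)) (ℕ.m≤n⇒m⊓n≡m (ℕ.<⇒≤ (ℕ.≰⇒> ¬le)))) (Allₚ.take⁺ K (All.map (λ {c} xc y yy → closed c y xc yy) (members-satisfy X?)))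

    no-triple : ∀ {A B C : Pred Carrier 0ℓ} (A? : Decidable A) (B? : Decidable B) (C? : Decidable C) →
                (∀ x → A x → x ≢ 𝟘) → (∀ x → B x → x ≢ 𝟘) → (∀ x → C x → x ≢ 𝟘) →
                2 ≤ length (members A?) → 2 ≤ length (members B?) → 2 ≤ length (members C?) →
                (∀ a b c → A a → B b → C c → InS (a ⊗ b ⊗ c)) →
                (∀ y → InS y → ∃ λ a → ∃ λ b → ∃ λ c → A a × B b × C c × y ≡ a ⊗ b ⊗ c) → ⊥
    no-triple {A} {B} {C} A? B? C? uA uB uC twoA twoB twoC closed covers = triple-contradiction {size} size-lower
      (ℕ.≤-trans (triple-product A? B? C? inS? covers) (ℕ.*-mono-≤ AB (ℕ.*-mono-≤ AC BC)))
      where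
      AB : ∑ (λ y → 𝟏 (product? A? B? y)) ≤ 2 * e
      AB = factor-bound C? (product? A? B?) uC twoC
        (λ { c _ cc (a , b , aa , bb , refl) → subst InS (*-comm (a ⊗ b) c) (closed a b c aa bb cc) })
        (λ y sy → let (a , b , c , aa , bb , cc , eq) = covers y sy in c , a ⊗ b , cc , (a , b , aa , bb , refl) , trans eq (*-comm (a ⊗ b) c))
      AC : ∑ (λ y → 𝟏 (product? A? C? y)) ≤ 2 * e
      AC = factor-bound B? (product? A? C?) uB twoB
        (λ { b _ bb (a , c , aa , cc , refl) → subst InS (rotate a b c) (closed a b c aa bb cc) })
        (λ y sy → let (a , b , c , aa , bb , cc , eq) = covers y sy in b , a ⊗ c , bb , (a , c , aa , cc , refl) , trans eq (rotate a b c))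
        where
        rotate : ∀ a b c → a ⊗ b ⊗ c ≡ b ⊗ (a ⊗ c)
        rotate a b c = trans (cong (_⊗ c) (*-comm a b)) (*-assoc b a c)
      BC : ∑ (λ y → 𝟏 (product? B? C? y)) ≤ 2 * e
      BC = factor-bound A? (product? B? C?) uA twoA
        (λ { a _ aa (b , c , bb , cc , refl) → subst InS (*-assoc a b c) (closed a b c aa bb cc) })
        (λ y sy → let (a , b , c , aa , bb , cc , eq) = covers y sy in a , b ⊗ c , aa , (b , c , bb , cc , refl) , trans eq (*-assoc a b c))

-- The pair (a, b) encodes ε = (a + 1) / (b + 1), and the inequality between powers is d ≤ q ^ (1/10
-- - ε) raised to the power 10 (b + 1). Rational ε are enough, as the claim for a smaller ε implies
-- it for a larger one.
theorem6p7 : (a b : ℕ) → Σ ℕ λ Q →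
    (F : FiniteField) → Q < FiniteField.order F →
    (d : ℕ) → d ∣ (FiniteField.order F ∸ 1) → 2 ≤ d →
    d ^ (10 * suc b) * FiniteField.order F ^ (10 * suc a) ≤ FiniteField.order F ^ suc b →
    (lam : FiniteField.Carrier F) → lam ≢ FiniteField.0# F →
    (A B C : FiniteField.Subset F) →
    FiniteField.⊆Units F A → FiniteField.⊆Units F B → FiniteField.⊆Units F C →
    FiniteField.AtLeastTwo F A → FiniteField.AtLeastTwo F B → FiniteField.AtLeastTwo F C →
    FiniteField.TripleProductEquals F A B C (FiniteField.InShiftedPowersNonzero F d lam) →
    ⊥
theorem6p7 a b = Arithmetic.threshold b , λ F Q<q d d∣q-1 2≤d hyp lam lam≢0 A B C uA uB uC tA tB tC eq →
    Conclusion.impossible F Q<q d∣q-1 2≤d hyp lam≢0 A B C uA uB uC tA tB tC eq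
  where
  module Conclusion (F : FiniteField) (Q<q : Arithmetic.threshold b < FiniteField.order F) where
    open FieldBasics F
    open Counting F
    open PowerResidues F
    open Decomposition F
    open Arithmetic
    open FiniteField F using (Subset; ⊆Units; AtLeastTwo; TripleProductEquals; InShiftedPowersNonzero) renaming (_^_ to _^ᶠ_)

    ^ᶠ≡↑ : ∀ x k → x ^ᶠ k ≡ x ↑ k
    ^ᶠ≡↑ x zero    = refl
    ^ᶠ≡↑ x (suc k) = cong (x ⊗_) (^ᶠ≡↑ x k)

    impossible : ∀ {d} → d ∣ (order ∸ 1) → 2 ≤ d → d ^ (10 * suc b) * order ^ (10 * suc a) ≤ order ^ suc b →
                 ∀ {lam} → lam ≢ 𝟘 → (A B C : Subset) → ⊆Units A → ⊆Units B → ⊆Units C → AtLeastTwo A → AtLeastTwo B → AtLeastTwo C →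
                 TripleProductEquals A B C (InShiftedPowersNonzero d lam) → ⊥
    impossible {d} (divides n q-1≡nd) 2≤d hyp {lam} lam≢0 A B C uA uB uC (a₁ , a₂ , a≢ , pa₁ , pa₂) (b₁ , b₂ , b≢ , pb₁ , pb₂) (c₁ , c₂ , c≢ , pc₁ , pc₂) eq =
      no-triple dn 2≤d 1≤K q<2^K s²≤q q≤ large lam≢0 (λ x → A x Bool.≟ true) (λ x → B x Bool.≟ true) (λ x → C x Bool.≟ true) uA uB uC
        (two-elements dn 2≤d 1≤K q<2^K s²≤q q≤ large lam≢0 (λ x → A x Bool.≟ true) a≢ pa₁ pa₂)
        (two-elements dn 2≤d 1≤K q<2^K s²≤q q≤ large lam≢0 (λ x → B x Bool.≟ true) b≢ pb₁ pb₂)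
        (two-elements dn 2≤d 1≤K q<2^K s²≤q q≤ large lam≢0 (λ x → C x Bool.≟ true) c≢ pc₁ pc₂)
        (λ a b c pa pb pc → let (nz , x , x≢0 , e) = Equivalence.from (eq (a ⊗ b ⊗ c)) (a , b , c , pa , pb , pc , refl) in
          nz , x , x≢0 , trans (cong (_⊕ lam) e) (trans (⊕-⊖-cancel (x ^ᶠ d) lam) (^ᶠ≡↑ x d)))
        (λ { y (nz , x , x≢0 , e) → Equivalence.to (eq y) (nz , x , x≢0 , trans (sym (⊕-⊖-cancel′ y lam)) (cong (_⊕ ⊖ lam) (trans e (sym (^ᶠ≡↑ x d))))) })
      where
      dn : d * n ≡ order ∸ 1
      dn = trans (ℕ.*-comm d n) (sym q-1≡nd)
      s = proj₁ (sqrt order)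
      s²≤q = proj₁ (proj₂ (sqrt order))
      q≤ = proj₂ (proj₂ (sqrt order))
      K = proj₁ (log₂ order (ℕ.<⇒≤ 1<order))
      q<2^K = proj₁ (proj₂ (log₂ order (ℕ.<⇒≤ 1<order)))
      2^K≤2q = proj₂ (proj₂ (log₂ order (ℕ.<⇒≤ 1<order)))
      positive : ∀ k → order < 2 ^ k → 1 ≤ k
      positive zero    lt = ⊥-elim (ℕ.<⇒≱ lt (ℕ.<⇒≤ 1<order))
      positive (suc k) _  = s≤s z≤n
      1≤K : 1 ≤ K
      1≤K = positive K q<2^K
      large = threshold-large a b {order} {d} {K} {s} Q<q (ℕ.≤-trans (s≤s z≤n) 2≤d) 1≤K 2^K≤2q q≤ hyp
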